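{- For every integer $n\ge 1$ there is a bijection $\Phi:\mathcal{A}_n\to\mathcal{A}_n$ such that for every $s\in\mathcal{A}_n$, \[ (\mathrm{asc},\mathrm{rep},\mathrm{zero},\max,\mathrm{ealm},\mathrm{rmin},\mathrm{rpos})(s)=(\mathrm{asc},\mathrm{rep},\mathrm{zero},\mathrm{rmin},\mathrm{rpos},\max,\mathrm{ealm})(\Phi(s)), \] i.e. $\mathrm{asc}(s)=\mathrm{asc}(\Phi(s))$, $\mathrm{rep}(s)=\mathrm{rep}(\Phi(s))$, $\mathrm{zero}(s)=\mathrm{zero}(\Phi(s))$, $\max(s)=\mathrm{rmin}(\Phi(s))$, $\mathrm{ealm}(s)=\mathrm{rpos}(\Phi(s))$, $\mathrm{rmin}(s)=\max(\Phi(s))$ and $\mathrm{rpos}(s)=\mathrm{ealm}(\Phi(s))$.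
   Context: An inversion sequence of length $n$ is a sequence $s=(s_1,\dots,s_n)$ of integers with $0\le s_i<i$ for all $i$; write $|s|=n$. For such $s$ let $\mathrm{asc}(s)=|\{i\in[n-1]:s_i<s_{i+1}\}|$. An ascent sequence is an inversion sequence $s$ with $s_i\le \mathrm{asc}(s_1,\dots,s_{i-1})+1$ for all $2\le i\le n$; $\mathcal{A}_n$ denotes the set of ascent sequences of length $n$. Statistics: $\mathrm{rep}(s)=n-|\{s_1,\dots,s_n\}|$; $\mathrm{zero}(s)=|\{i:s_i=0\}|$; $\max(s)=|\{i:s_i=i-1\}|$ (entries with $s_i=i-1$ are called maximals); $\mathrm{Rmin}(s)=\{s_i: s_i<s_j\text{ for all }j>i\}$ (values of right-to-left minima) and $\mathrm{rmin}(s)=|\mathrm{Rmin}(s)|$. Index the right-to-left minima from left to right by $0,1,\dots,\mathrm{rmin}(s)-1$ (so the $m$-th right-to-left minimum is the $m$-th smallest element of $\mathrm{Rmin}(s)$, counting from $0$; it is located at the rightmost occurrence of its value). $\mathrm{ealm}(s)$: if $\max(s)\ne |s|$ then $\mathrm{ealm}(s)=s_{\max(s)+1}$ (the entry right after the last maximal); if $\max(s)=|s|$, i.e. $s=(0,1,\dots,|s|-1)$, then $\mathrm{ealm}(s)=0$. $\mathrm{rpos}(s)$: if $\mathrm{rmin}(s)\ne|s|$, $\mathrm{rpos}(s)$ is the maximal index $m$ such that the value of the $m$-th right-to-left minimum occurs at least twice after the position of the $(m-1)$-th right-to-left minimum (for $m=0$: occurs at least twice in $s$); if no such $m$ exists or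 $\mathrm{rmin}(s)=|s|$, then $\mathrm{rpos}(s)=0$. For example $\mathrm{rpos}(0,0,1,2,3,4)=0$ and $\mathrm{rpos}(0,0,1,2,0,1,2,1,3,3,4)=2$. -}

module Defs where

open import Data.Nat using (ℕ; zero; suc; _+_; _∸_; _≤_; _<_; _<ᵇ_; _≡ᵇ_; _⊔_)
open import Data.Nat.Properties using (_≟_)
open import Data.Bool using (Bool; true; false; if_then_else_; T)
open import Data.List using (List; []; _∷_; length; filter; deduplicate; drop)
open import Data.Product using (_×_; _,_)
open import Data.Unit using (⊤)
open import Relation.Binary.PropositionalEquality using (_≡_)

-- Sequences s = (s_1,...,s_n) are lists of naturals; positions are 1-based
-- in the comments below.

asc : List ℕ → ℕ
asc (x ∷ y ∷ r) = (if x <ᵇ y then 1 else 0) + asc (y ∷ r)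
asc _ = 0

IsInvFrom : ℕ → List ℕ → Set
IsInvFrom k []       = ⊤
IsInvFrom k (x ∷ xs) = (x < suc k) × IsInvFrom (suc k) xs

IsInversionSeq : List ℕ → Set
IsInversionSeq s = IsInvFrom 0 s

-- ascent condition: s_i ≤ asc(s_1,...,s_{i-1}) + 1 for 2 ≤ i ≤ n.
-- pre = (s_1,...,s_{i-1}) (the part already read), processed left to right.
AscCondFrom : List ℕ → List ℕ → Set
AscCondFrom pre []       = ⊤
AscCondFrom [] (x ∷ xs)  = AscCondFrom (x ∷ []) xs
AscCondFrom pre@(_ ∷ _) (x ∷ xs) =
  (x ≤ asc pre + 1) × AscCondFrom (pre Data.List.++ (x ∷ [])) xs

IsAscentSeq : List ℕ → Set
IsAscentSeq s = IsInversionSeq s × AscCondFrom [] s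

InA : ℕ → List ℕ → Set
InA n s = (length s ≡ n) × IsAscentSeq s

rep : List ℕ → ℕ
rep s = length s ∸ length (deduplicate _≟_ s)

zeroStat : List ℕ → ℕ
zeroStat s = length (filter (_≟ 0) s)

maxFrom : ℕ → List ℕ → ℕ
maxFrom k []       = 0
maxFrom k (x ∷ xs) = (if x ≡ᵇ k then 1 else 0) + maxFrom (suc k) xs

maxStat : List ℕ → ℕ
maxStat s = maxFrom 0 s

-- entry at 0-based index j (i.e. s_{j+1}); 0 if out of range
at : ℕ → List ℕ → ℕ
at _       []       = 0
at zero    (x ∷ _)  = x
at (suc j) (_ ∷ xs) = at j xs

ealm : List ℕ → ℕ
ealm s = if maxStat s ≡ᵇ length s then 0 else at (maxStat s) s

allGreater : ℕ → List ℕ → Bool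
allGreater x []       = true
allGreater x (y ∷ ys) = if x <ᵇ y then allGreater x ys else false

-- right-to-left minima, listed left to right as (value , 1-based position);
-- k = number of entries before the current one
rlMinFrom : ℕ → List ℕ → List (ℕ × ℕ)
rlMinFrom k []       = []
rlMinFrom k (x ∷ xs) =
  if allGreater x xs then (x , suc k) ∷ rlMinFrom (suc k) xs
                           else rlMinFrom (suc k) xs

rlMins : List ℕ → List (ℕ × ℕ)
rlMins s = rlMinFrom 0 s

rmin : List ℕ → ℕ
rmin s = length (rlMins s)

count : ℕ → List ℕ → ℕ
count v s = length (filter (_≟ v) s)

-- rpos: maximal m such that the value of the m-th right-to-left minimum
-- occurs at least twice after the position q of the (m-1)-th one
-- (q = 0 for m = 0, i.e. in all of s); 0 if no such m exists.
rposGo : List ℕ → ℕ → ℕ → List (ℕ × ℕ) → ℕ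
rposGo s m q []             = 0
rposGo s m q ((v , p) ∷ rs) =
  if 2 Data.Nat.≤ᵇ count v (drop q s)
    then m ⊔ rposGo s (suc m) p rs
    else rposGo s (suc m) p rs

rpos : List ℕ → ℕ
rpos s = if rmin s ≡ᵇ length s then 0 else rposGo s 0 0 (rlMins s)

{-# OPTIONS --safe #-}
module Submission where

-- The statistics (max, ealm) and (rmin, rpos) have the same joint distribution
-- with (asc, rep, zero) in either order; a bijection is then obtained by matching
-- equal lists of keys. Write s = 0 1 … μ T with the tail T starting with
-- e = ealm s ≤ μ. Deleting e when the next letter f is at most e, and replacing e
-- by the new maximal μ + 1 when f > e, is reversible and keeps (rmin, rpos) as long
-- as zero ≥ 2. With sequences weighted by t^rep y^asc v^zero, this expresses the sums F
-- over sequences with zero ≥ 2 by a linear operator T acting on (max, ealm), up to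
-- a boundary term K from the sequences with zero = 2 and ealm = 0. The operator T
-- commutes with the same operator acting on (rmin, rpos), and the boundary
-- terms satisfy a recursion of their own, from which (1 − T*) K = (1 − T) K*
-- follows, where * exchanges the two pairs. By induction on the length, F then obeys
-- the exchanged recursion as well and is therefore symmetric. Sequences with zero = 1
-- arise from shorter ones by prepending 0 and raising all letters.

open import Defs
open import Data.Nat using (ℕ; _≥_)
open import Data.List using (List)
open import Data.Product using (Σ; _×_)
open import Relation.Binary.PropositionalEquality using (_≡_)
open import Data.Nat.Base as ℕ using (zero; suc; z≤n; s≤s; _<ᵇ_; _≡ᵇ_; _⊔_; _∸_; pred)
import Data.Nat.Properties as ℕₚ
open import Data.Nat.Induction using (<-rec)
open import Data.Integer.Base as ℤ using (ℤ; 0ℤ; 1ℤ; ∣_∣)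
import Data.Integer.Properties as ℤₚ
open import Data.Integer.Tactic.RingSolver using (solve-∀)
open import Data.Bool.Base as Bool using (Bool; true; false; if_then_else_; not; _∨_; _∧_)
open import Data.Empty using (⊥-elim)
open import Data.Unit.Base using (⊤; tt)
open import Data.List.Base using ([]; _∷_; _++_; map; length; filter; deduplicate; drop)
import Data.List.Properties as Listₚ
open import Relation.Binary.PropositionalEquality using (refl; sym; trans; cong; cong₂; subst; setoid; module ≡-Reasoning)
open import Data.List.Membership.Propositional using (_∈_)
import Data.List.Membership.Propositional.Properties as ∈ₚ
open import Data.List.Relation.Unary.Any using (here; there)
import Data.List.Relation.Unary.All as All
open import Data.List.Relation.Unary.AllPairs using ([]; _∷_)
open import Data.List.Relation.Unary.Unique.Propositional using (Unique)
import Data.List.Relation.Unary.Unique.Propositional.Properties as Uniqueₚ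
open import Data.List.Relation.Binary.Permutation.Propositional using (_↭_; ↭-sym; ↭-trans; prep; ↭-refl; ↭⇒↭ₛ)
import Data.List.Relation.Binary.Permutation.Propositional.Properties as ↭ₚ
open import Data.List.Relation.Binary.Permutation.Setoid.Properties (setoid (List ℕ)) using (Unique-resp-↭)
open import Data.Vec.Base using (Vec; []; _∷_)
open import Data.Product using (_,_; proj₁; proj₂; ∃)
open import Data.Sum.Base using (_⊎_; inj₁; inj₂)
open import Relation.Nullary using (yes; no; ¬_; ¬?)
open import Function.Base using (_∘_)

-- Replacing e by the maximal m = μ + 1 keeps asc, but it keeps rep only if the value m occurs later
-- in the tail; otherwise rep drops by one. Tails that avoid m become, once the gap in the values is
-- closed, tails of a sequence with one letter and one ascent less. The defect is therefore again a
-- sum over shorter sequences, with coefficient (t - 1) y; this is `a`. The weight v is kept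
-- variable for the sake of two values. At v = 1 the number of zeros is forgotten. At v = 0 the
-- exchanged recursion loses its operator part for rpos = 0, so that sums of F become sums of K*.
-- This is how the recursion of K, which by itself calls for F, closes up and can be compared with
-- that of K*. No polynomials occur: t, y and v are integers throughout, and coefficients are
-- recovered at the end by letting them range over the positive integers.

infixl 6 _+_ _-_
infixl 7 _*_

-- Integer arithmetic with opaque operations: ℤ's multiplication unfolds, which
-- would leave the summands and factors below uninferrable.
opaque
  _+_ _*_ _-_ : ℤ → ℤ → ℤ
  _+_ = ℤ._+_
  _*_ = ℤ._*_
  _-_ = ℤ._-_

opaque
  unfolding _+_

  +-identityˡ : ∀ x → 0ℤ + x ≡ x
  +-identityˡ = solve-∀

  +-identityʳ : ∀ x → x + 0ℤ ≡ x
  +-identityʳ = solve-∀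

  *-zeroˡ : ∀ x → 0ℤ * x ≡ 0ℤ
  *-zeroˡ = solve-∀

  *-zeroʳ : ∀ x → x * 0ℤ ≡ 0ℤ
  *-zeroʳ = solve-∀

  *-identityˡ : ∀ x → 1ℤ * x ≡ x
  *-identityˡ = solve-∀

  x+0*y≡x : ∀ x y → x + 0ℤ * y ≡ x
  x+0*y≡x = solve-∀

  x+y*0≡x : ∀ x y → x + y * 0ℤ ≡ x
  x+y*0≡x = solve-∀

  x-x≡0 : ∀ x → x - x ≡ 0ℤ
  x-x≡0 = solve-∀

  x-y≡0⇒x≡y : ∀ {x y} → x - y ≡ 0ℤ → x ≡ y
  x-y≡0⇒x≡y {x} {y} = ℤₚ.i-j≡0⇒i≡j x y

  *-distribˡ-+ : ∀ x y z → x * (y + z) ≡ x * y + x * z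
  *-distribˡ-+ = solve-∀

  +-≡0 : ∀ {x y} → x ≡ 0ℤ → y ≡ 0ℤ → x + y ≡ 0ℤ
  +-≡0 refl refl = refl

  x≡y⇒x-y≡0 : ∀ {x y} → x ≡ y → x - y ≡ 0ℤ
  x≡y⇒x-y≡0 {x} refl = x-x≡0 x

-- Finite sums

∑ : ℕ → (ℕ → ℤ) → ℤ
∑ zero    f = 0ℤ
∑ (suc n) f = f 0 + ∑ n (f ∘ suc)

∑-cong : ∀ n {f g} → (∀ i → i ℕ.< n → f i ≡ g i) → ∑ n f ≡ ∑ n g
∑-cong zero    h = refl
∑-cong (suc n) h = cong₂ _+_ (h 0 (s≤s z≤n)) (∑-cong n λ i i<n → h (suc i) (s≤s i<n))

∑-cong′ : ∀ n {f g} → (∀ i → f i ≡ g i) → ∑ n f ≡ ∑ n g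
∑-cong′ n h = ∑-cong n λ i _ → h i

∑-zero : ∀ n {f} → (∀ i → i ℕ.< n → f i ≡ 0ℤ) → ∑ n f ≡ 0ℤ
∑-zero zero    h = refl
∑-zero (suc n) h = +-≡0 (h 0 (s≤s z≤n)) (∑-zero n λ i i<n → h (suc i) (s≤s i<n))

∑-+ : ∀ n (f g : ℕ → ℤ) → ∑ n (λ i → f i + g i) ≡ ∑ n f + ∑ n g
∑-+ zero    f g = sym (+-identityˡ 0ℤ)
∑-+ (suc n) f g = trans (cong (λ z → f 0 + g 0 + z) (∑-+ n (f ∘ suc) (g ∘ suc)))
                        (lemma (f 0) (g 0) (∑ n (f ∘ suc)) (∑ n (g ∘ suc)))
  where
  opaque
    unfolding _+_
    lemma : ∀ a b c d → a + b + (c + d) ≡ a + c + (b + d)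
    lemma = solve-∀

∑-*ˡ : ∀ c n f → ∑ n (λ i → c * f i) ≡ c * ∑ n f
∑-*ˡ c zero    f = sym (*-zeroʳ c)
∑-*ˡ c (suc n) f = trans (cong (c * f 0 +_) (∑-*ˡ c n (f ∘ suc)))
                         (sym (*-distribˡ-+ c (f 0) _))

∑-- : ∀ n (f g : ℕ → ℤ) → ∑ n (λ i → f i - g i) ≡ ∑ n f - ∑ n g
∑-- zero    f g = sym (x-x≡0 0ℤ)
∑-- (suc n) f g = trans (cong (λ z → f 0 - g 0 + z) (∑-- n (f ∘ suc) (g ∘ suc)))
                        (lemma (f 0) (g 0) (∑ n (f ∘ suc)) (∑ n (g ∘ suc)))
  where
  opaque
    unfolding _+_
    lemma : ∀ a b c d → a - b + (c - d) ≡ a + c - (b + d)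
    lemma = solve-∀

∑-swap : ∀ m n (f : ℕ → ℕ → ℤ) → ∑ m (λ i → ∑ n (f i)) ≡ ∑ n (λ j → ∑ m (λ i → f i j))
∑-swap zero    n f = sym (∑-zero n λ _ _ → refl)
∑-swap (suc m) n f = trans (cong (∑ n (f 0) +_) (∑-swap m n (f ∘ suc)))
                           (sym (∑-+ n (f 0) (λ j → ∑ m (λ i → f (suc i) j))))

∑-linear : ∀ n (f g h : ℕ → ℤ) → ∑ n (λ i → f i * (g i + h i)) ≡ ∑ n (λ i → f i * g i) + ∑ n (λ i → f i * h i)
∑-linear n f g h = trans (∑-cong′ n λ i → *-distribˡ-+ (f i) (g i) (h i)) (∑-+ n _ _)

∑-∑-swap : ∀ m n (f g : ℕ → ℤ) (h : ℕ → ℕ → ℤ) →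
  ∑ m (λ i → f i * ∑ n (λ j → g j * h i j)) ≡ ∑ n (λ j → g j * ∑ m (λ i → f i * h i j))
∑-∑-swap m n f g h = begin
  ∑ m (λ i → f i * ∑ n (λ j → g j * h i j))
    ≡⟨ ∑-cong′ m (λ i → sym (∑-*ˡ (f i) n _)) ⟩
  ∑ m (λ i → ∑ n (λ j → f i * (g j * h i j)))
    ≡⟨ ∑-swap m n _ ⟩
  ∑ n (λ j → ∑ m (λ i → f i * (g j * h i j)))
    ≡⟨ ∑-cong′ n (λ j → trans (∑-cong′ m λ i → lemma (f i) (g j) (h i j)) (∑-*ˡ (g j) m _)) ⟩
  ∑ n (λ j → g j * ∑ m (λ i → f i * h i j)) ∎
  where
  open ≡-Reasoning
  opaque
    unfolding _+_
    lemma : ∀ a b c → a * (b * c) ≡ b * (a * c)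
    lemma = solve-∀

-- The transfer operator and its symmetry

prev : (ℕ → ℤ) → ℕ → ℤ
prev g zero    = 0ℤ
prev g (suc n) = g n

-- Removing the letter e costs a factor v exactly if e is a zero.
δ : ℤ → ℕ → ℤ
δ v zero    = v
δ v (suc _) = 1ℤ

ζ : ℕ → ℤ
ζ zero    = 1ℤ
ζ (suc _) = 0ℤ

module Transfer (t y : ℤ) where

  a : ℤ
  a = (t - 1ℤ) * y

  α : ℤ → ℕ → ℕ → ℤ
  α v e f = δ v e * (if e <ᵇ f then a else t)

  β : ℤ → ℕ → ℕ → ℤ
  β v e f = δ v e * (if e <ᵇ f then 1ℤ else 0ℤ)

  -- The letter after e is f. The `α` sum covers shorter sequences: those from deleting e when f ≤
  -- e, and the correction `a` when f > e. The `β` sum covers the replacement of e by the new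
  -- maximal m; it reaches f = m, because f may equal this value.
  T : ℤ → (ℕ → ℕ → ℕ → ℤ) → ℕ → ℕ → ℕ → ℤ
  T v G n m e = ∑ m (λ f → α v e f * prev (λ n′ → G n′ m f) n)
              + ∑ (suc m) (λ f → β v e f * G n (suc m) f)

  T-cong : ∀ v {G H} n m e → (∀ n m f → f ℕ.< m → G n m f ≡ H n m f) → T v G n m e ≡ T v H n m e
  T-cong v zero m e eq = cong₂ _+_ refl
    (∑-cong (suc m) λ f f< → cong (β v e f *_) (eq 0 (suc m) f f<))
  T-cong v (suc n) m e eq = cong₂ _+_
    (∑-cong m λ f f< → cong (α v e f *_) (eq n m f f<))
    (∑-cong (suc m) λ f f< → cong (β v e f *_) (eq (suc n) (suc m) f f<))

  T-+ : ∀ v G H n m e → T v (λ n m f → G n m f + H n m f) n m e ≡ T v G n m e + T v H n m e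
  T-+ v G H n m e = begin
    ∑ m (λ f → α v e f * prev (λ n′ → G n′ m f + H n′ m f) n)
      + ∑ (suc m) (λ f → β v e f * (G n (suc m) f + H n (suc m) f))
      ≡⟨ cong₂ _+_ (trans (∑-cong′ m λ f → cong (α v e f *_) (prev-+ _ _ n)) (∑-linear m _ _ _))
                   (∑-linear (suc m) (β v e) (G n (suc m)) (H n (suc m))) ⟩
    _ ≡⟨ lemma _ _ _ _ ⟩
    _ ∎
    where
    open ≡-Reasoning
    opaque
      unfolding _+_
      lemma : ∀ p q r s → p + q + (r + s) ≡ p + r + (q + s)
      lemma = solve-∀
    prev-+ : ∀ (g h : ℕ → ℤ) n → prev (λ n → g n + h n) n ≡ prev g n + prev h n
    prev-+ g h zero    = sym (+-identityˡ 0ℤ)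
    prev-+ g h (suc n) = refl

  T-* : ∀ v c G n m e → T v (λ n m f → c * G n m f) n m e ≡ c * T v G n m e
  T-* v c G n m e = begin
    ∑ m (λ f → α v e f * prev (λ n′ → c * G n′ m f) n)
      + ∑ (suc m) (λ f → β v e f * (c * G n (suc m) f))
      ≡⟨ cong₂ _+_ (trans (∑-cong′ m λ f → trans (cong (α v e f *_) (prev-* _ n)) (lemma (α v e f) c _))
                          (∑-*ˡ c m _))
                   (trans (∑-cong′ (suc m) λ f → lemma (β v e f) c (G n (suc m) f))
                          (∑-*ˡ c (suc m) (λ f → β v e f * G n (suc m) f))) ⟩
    _ ≡⟨ *-distribˡ-+ c _ _ ⟨
    _ ∎
    where
    open ≡-Reasoning
    opaque
      unfolding _+_
      lemma : ∀ p q r → p * (q * r) ≡ q * (p * r)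
      lemma = solve-∀
    prev-* : ∀ (g : ℕ → ℤ) n → prev (λ n → c * g n) n ≡ c * prev g n
    prev-* g zero    = sym (*-zeroʳ c)
    prev-* g (suc n) = refl

  T-- : ∀ v G H n m e → T v (λ n m f → G n m f - H n m f) n m e ≡ T v G n m e - T v H n m e
  T-- v G H n m e = begin
    T v (λ n m f → G n m f - H n m f) n m e
      ≡⟨ T-cong v n m e (λ n m f _ → minus (G n m f) (H n m f)) ⟩
    T v (λ n m f → G n m f + (0ℤ - 1ℤ) * H n m f) n m e
      ≡⟨ T-+ v G (λ n m f → (0ℤ - 1ℤ) * H n m f) n m e ⟩
    T v G n m e + T v (λ n m f → (0ℤ - 1ℤ) * H n m f) n m e
      ≡⟨ cong (λ z → T v G n m e + z) (T-* v (0ℤ - 1ℤ) H n m e) ⟩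
    T v G n m e + (0ℤ - 1ℤ) * T v H n m e
      ≡⟨ minus _ _ ⟨
    T v G n m e - T v H n m e ∎
    where
    open ≡-Reasoning
    opaque
      unfolding _+_
      minus : ∀ x y → x - y ≡ x + (0ℤ - 1ℤ) * y
      minus = solve-∀

  T-∑ : ∀ v k (G : ℕ → ℕ → ℕ → ℕ → ℤ) n m e →
    T v (λ n m f → ∑ k (λ i → G i n m f)) n m e ≡ ∑ k (λ i → T v (G i) n m e)
  T-∑ v zero G n m e = +-≡0
    (∑-zero m λ f _ → trans (cong (α v e f *_) (prev-0 n)) (*-zeroʳ (α v e f)))
    (∑-zero (suc m) λ f _ → *-zeroʳ (β v e f))
    where
    prev-0 : ∀ n → prev (λ _ → 0ℤ) n ≡ 0ℤ
    prev-0 zero    = refl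
    prev-0 (suc _) = refl
  T-∑ v (suc k) G n m e = trans (T-+ v (G 0) (λ n m f → ∑ k (λ i → G (suc i) n m f)) n m e)
    (cong (λ z → T v (G 0) n m e + z) (T-∑ v k (G ∘ suc) n m e))

  -- The two operators share only the index n, which both may lower. Their coefficients are
  -- independent of n, so commuting them is an interchange of finite sums.
  T-comm : ∀ v (H : ℕ → ℕ → ℕ → ℕ → ℕ → ℤ) n m e r q →
    T v (λ n m e → T v (λ n r q → H n m e r q) n r q) n m e ≡
    T v (λ n r q → T v (λ n m e → H n m e r q) n m e) n r q
  T-comm v H n m e r q = begin
    _ ≡⟨ cong₂ _+_ (∑-cong′ m λ f → cong (α v e f *_) (prev-T (λ n r p → H n m f r p) n r q)) refl ⟩
    _ ≡⟨ exchange m (suc m) r (suc r) (α v e) (β v e) (α v q) (β v q)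
           (λ f p → prev (λ n → prev (λ n → H n m f r p) n) n) (λ f p → prev (λ n → H n m f (suc r) p) n)
           (λ f p → prev (λ n → H n (suc m) f r p) n) (λ f p → H n (suc m) f (suc r) p) ⟩
    _ ≡⟨ cong₂ _+_ (∑-cong′ r λ p → cong (α v q p *_) (sym (prev-T (λ n m f → H n m f r p) n m e))) refl ⟩
    _ ∎
    where
    open ≡-Reasoning
    prev-T : ∀ G n m e → prev (λ n → T v G n m e) n ≡
      ∑ m (λ f → α v e f * prev (λ n → prev (λ n → G n m f) n) n)
        + ∑ (suc m) (λ f → β v e f * prev (λ n → G n (suc m) f) n)
    prev-T G zero m e = sym (+-≡0 (∑-zero m λ f _ → *-zeroʳ (α v e f))
                                       (∑-zero (suc m) λ f _ → *-zeroʳ (β v e f)))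
    prev-T G (suc n) m e = refl
    exchange : ∀ m m′ r r′ (A A′ B B′ : ℕ → ℤ) (PP PQ QP QQ : ℕ → ℕ → ℤ) →
      ∑ m (λ f → A f * (∑ r (λ p → B p * PP f p) + ∑ r′ (λ p → B′ p * PQ f p)))
        + ∑ m′ (λ f → A′ f * (∑ r (λ p → B p * QP f p) + ∑ r′ (λ p → B′ p * QQ f p)))
      ≡ ∑ r (λ p → B p * (∑ m (λ f → A f * PP f p) + ∑ m′ (λ f → A′ f * QP f p)))
        + ∑ r′ (λ p → B′ p * (∑ m (λ f → A f * PQ f p) + ∑ m′ (λ f → A′ f * QQ f p)))
    exchange m m′ r r′ A A′ B B′ PP PQ QP QQ = begin
      _ ≡⟨ cong₂ _+_ (∑-linear m _ _ _) (∑-linear m′ _ _ _) ⟩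
      _ ≡⟨ cong₂ _+_ (cong₂ _+_ (∑-∑-swap m r _ _ _) (∑-∑-swap m r′ _ _ _))
                     (cong₂ _+_ (∑-∑-swap m′ r _ _ _) (∑-∑-swap m′ r′ _ _ _)) ⟩
      _ ≡⟨ lemma _ _ _ _ ⟩
      _ ≡⟨ cong₂ _+_ (∑-linear r _ _ _) (∑-linear r′ _ _ _) ⟨
      _ ∎
      where
      opaque
        unfolding _+_
        lemma : ∀ p q r s → p + q + (r + s) ≡ p + r + (q + s)
        lemma = solve-∀

  -- Every term of `T` lowers n or raises m. At fixed n this permits a downward induction on m that
  -- starts where n ≤ m; the counter k of `go` bounds n - m.
  T-unique : ∀ v (D : ℕ → ℕ → ℕ → ℤ) n →
    (∀ n′ m e → n′ ℕ.< n → e ℕ.< m → D n′ m e ≡ 0ℤ) →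
    (∀ m e → e ℕ.< m → D n m e ≡ T v D n m e) →
    (∀ m e → n ℕ.≤ m → D n m e ≡ 0ℤ) →
    ∀ m e → e ℕ.< m → D n m e ≡ 0ℤ
  T-unique v D n lower step outside m e e<m = go n m e e<m (ℕₚ.m≤m+n n m)
    where
    go : ∀ k m e → e ℕ.< m → n ℕ.≤ k ℕ.+ m → D n m e ≡ 0ℤ
    go zero    m e e<m n≤m = outside m e n≤m
    go (suc k) m e e<m n≤  = trans (step m e e<m) (+-≡0
      (∑-zero m λ f f<m → trans (cong (α v e f *_) (prev-lower n lower m f f<m)) (*-zeroʳ (α v e f)))
      (∑-zero (suc m) λ f f<m → trans (cong (β v e f *_)
        (go k (suc m) f f<m (subst (n ℕ.≤_) (sym (ℕₚ.+-suc k m)) n≤))) (*-zeroʳ (β v e f))))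
      where
      prev-lower : ∀ n → (∀ n′ m e → n′ ℕ.< n → e ℕ.< m → D n′ m e ≡ 0ℤ) →
        ∀ m f → f ℕ.< m → prev (λ n → D n m f) n ≡ 0ℤ
      prev-lower zero    _ m f f<m = refl
      prev-lower (suc n) l m f f<m = l n m f ℕₚ.≤-refl f<m

-- In the intended system, F v n m e r q is the weight of the sequences of length
-- n − 1 with zero ≥ 2 and (max, ealm, rmin, rpos) = (m, e, r, q), where a sequence
-- weighs t^rep y^asc v^(zero − 2), so that v = 0 selects zero = 2. K is the part with
-- zero = 2 and ealm = 0, and A n m r j is the part at v = 1, summed over ealm, with rpos
-- refined to j = qd of the tail: j = 0 and j = 1 split rpos = 0 into zero = 2 and zero ≥ 3.
record System (t y : ℤ) : Set where
  open Transfer t y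
  field
    F  : ℤ → ℕ → ℕ → ℕ → ℕ → ℕ → ℤ
    K  : ℕ → ℕ → ℕ → ℕ → ℤ
    A  : ℕ → ℕ → ℕ → ℕ → ℤ
    st : ℕ → ℕ → ℕ → ℤ
    F-m  : ∀ v n m e r q → n ℕ.≤ m → F v n m e r q ≡ 0ℤ
    F-r  : ∀ v n m e r q → n ℕ.≤ r → F v n m e r q ≡ 0ℤ
    F-r₀ : ∀ v n m e q → F v n m e 0 q ≡ 0ℤ
    K-n  : ∀ n m r q → n ℕ.≤ 2 → K n m r q ≡ 0ℤ
    K-m₀ : ∀ n r q → K n 0 r q ≡ 0ℤ
    K-r₀ : ∀ n m q → K n m 0 q ≡ 0ℤ
    K-r  : ∀ n m r q → n ℕ.≤ r → K n m r q ≡ 0ℤ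
    st-sym : ∀ n m r → st n m r ≡ st n r m
    st-suc : ∀ n m r → st n m (suc r) ≡ 0ℤ
    F-step : ∀ v n m e r q → e ℕ.< m →
      F v n m e r q ≡ T v (λ n m f → F v n m f r q) n m e + ζ e * K n m r q
    K-step : ∀ n m r q → K (suc (suc n)) (suc m) (suc r) q ≡
      y * K (suc n) m (suc r) q + y * (A (suc n) (suc m) r q + a * A n m r q) + ζ q * st n m r
    A-0  : ∀ n m r → A n m r 0 ≡ ∑ m (λ f → F 0ℤ n m f r 0)
    A-1  : ∀ n m r → A n m r 0 + A n m r 1 ≡ ∑ m (λ f → F 1ℤ n m f r 0)
    A-2  : ∀ n m r q → A n m r (suc (suc q)) ≡ ∑ m (λ f → F 1ℤ n m f r (suc q))

-- Symmetry of every solution of the system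

module Symmetry {t y : ℤ} (S : System t y) where
  open Transfer t y
  open System S
  open ≡-Reasoning

  -- The recursion that `F-step` gives for the exchanged function, demanded of F itself: the
  -- operator acts on (r, q), and K appears with its arguments exchanged.
  Star : ℕ → Set
  Star n = ∀ v m e r q → e ℕ.< m → q ℕ.< r →
    F v n m e r q ≡ T v (λ n r p → F v n m e r p) n r q + ζ q * K n r m e

  F̂ : ℕ → ℕ → ℕ → ℕ → ℤ
  F̂ n m r q = ∑ m (λ f → F 1ℤ n m f r q)

  T-0 : ∀ G n m → T 0ℤ G n m 0 ≡ 0ℤ
  T-0 G n m = +-≡0
    (∑-zero m λ f _ → lemma (if 0 <ᵇ f then a else t) _)
    (∑-zero (suc m) λ f _ → lemma (if 0 <ᵇ f then 1ℤ else 0ℤ) (G n (suc m) f))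
    where
    opaque
      unfolding _+_
      lemma : ∀ x y → 0ℤ * x * y ≡ 0ℤ
      lemma = solve-∀

  -- At v = 0 and q = 0 the operator part of `Star` carries the factor `δ 0ℤ 0`, which is zero, and
  -- only the boundary term survives. This converts the part of `K-step` that comes from F back into
  -- K.
  A₀ : ∀ n → Star n → ∀ m r → A n m (suc r) 0 ≡ ∑ m (λ f → K n (suc r) m f)
  A₀ n star m r = trans (A-0 n m (suc r)) (∑-cong m λ f f<m →
    trans (star 0ℤ m f (suc r) 0 f<m (s≤s z≤n))
      (trans (cong₂ _+_ (T-0 (λ n r p → F 0ℤ n m f r p) n (suc r)) (*-identityˡ _)) (+-identityˡ _)))

  star-F̂ : ∀ n → Star n → ∀ m r q → q ℕ.< r →
    F̂ n m r q ≡ T 1ℤ (λ n r p → F̂ n m r p) n r q + ζ q * A n m r 0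
  star-F̂ n star m r@(suc r′) q q<r = begin
    ∑ m (λ f → F 1ℤ n m f r q)
      ≡⟨ ∑-cong m (λ f f<m → star 1ℤ m f r q f<m q<r) ⟩
    ∑ m (λ f → T 1ℤ (λ n r p → F 1ℤ n m f r p) n r q + ζ q * K n r m f)
      ≡⟨ ∑-+ m _ _ ⟩
    ∑ m (λ f → T 1ℤ (λ n r p → F 1ℤ n m f r p) n r q) + ∑ m (λ f → ζ q * K n r m f)
      ≡⟨ cong₂ _+_ (sym (T-∑ 1ℤ m (λ f n r p → F 1ℤ n m f r p) n r q))
                   (trans (∑-*ˡ (ζ q) m _) (cong (ζ q *_) (sym (A₀ n star m r′)))) ⟩
    T 1ℤ (λ n r p → F̂ n m r p) n r q + ζ q * A n m r 0 ∎

  δ-1 : ∀ q → δ 1ℤ q ≡ 1ℤ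
  δ-1 zero    = refl
  δ-1 (suc _) = refl

  -- The indices 0 and 1 of A both belong to rpos = 0. The coefficients cannot tell them apart,
  -- since `α 1ℤ (suc q)` is t at both and `β 1ℤ (suc q)` is zero at both. Hence only their sum
  -- enters, which `A-1` identifies with `F̂` at 0.
  A-T : ∀ n m r q → ∑ (suc (suc r)) (λ p → α 1ℤ (suc q) p * prev (λ n → A n m (suc r) p) n)
      + ∑ (suc (suc (suc r))) (λ p → β 1ℤ (suc q) p * A n m (suc (suc r)) p)
    ≡ T 1ℤ (λ n r p → F̂ n m r p) n (suc r) q
  A-T n m r q = trans (lemma t (prev (λ n → A n m (suc r) 0) n) (prev (λ n → A n m (suc r) 1) n) _ _ _ _)
    (cong₂ _+_
      (cong₂ _+_
        (cong₂ _*_ (trans (sym (*-identityˡ t)) (cong (_* t) (sym (δ-1 q)))) (pA1 n))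
        (∑-cong′ r λ p → cong₂ _*_ (cong (_* (if q <ᵇ suc p then a else t)) (sym (δ-1 q))) (pA2 p n)))
      (cong₂ _+_ (sym (trans (cong (_* F̂ n m (suc (suc r)) 0) (*-zeroʳ (δ 1ℤ q))) (*-zeroˡ _)))
        (∑-cong′ (suc r) λ p → cong₂ _*_ (cong (_* (if q <ᵇ suc p then 1ℤ else 0ℤ)) (sym (δ-1 q)))
          (A-2 n m (suc (suc r)) p))))
    where
    opaque
      unfolding _+_
      lemma : ∀ t x₀ x₁ z₀ z₁ s s′ → 1ℤ * t * x₀ + (1ℤ * t * x₁ + s) + (1ℤ * 0ℤ * z₀ + (1ℤ * 0ℤ * z₁ + s′))
        ≡ t * (x₀ + x₁) + s + (0ℤ + s′)
      lemma = solve-∀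
    pA1 : ∀ n → prev (λ n → A n m (suc r) 0) n + prev (λ n → A n m (suc r) 1) n
                ≡ prev (λ n → F̂ n m (suc r) 0) n
    pA1 zero    = +-identityˡ 0ℤ
    pA1 (suc n) = A-1 n m (suc r)
    pA2 : ∀ p n → prev (λ n → A n m (suc r) (suc (suc p))) n ≡ prev (λ n → F̂ n m (suc r) (suc p)) n
    pA2 p zero    = refl
    pA2 p (suc n) = A-2 n m (suc r) p

  -- At q = 0 the boundary term of `star-F̂` is the entry of A at 0, exactly the amount by which
  -- `F̂` exceeds the entry at 1. The refined sums thus obey a recursion free of boundary terms.
  A-star : ∀ n → Star n → ∀ m r q → q ℕ.< suc r →
    A n m (suc r) (suc q) ≡ T 1ℤ (λ n r p → F̂ n m r p) n (suc r) q
  A-star n star m r zero q<r = begin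
    A n m (suc r) 1 ≡⟨ l₁ (A n m (suc r) 0) _ ⟩
    (A n m (suc r) 0 + A n m (suc r) 1) - A n m (suc r) 0
      ≡⟨ cong (_- A n m (suc r) 0) (trans (A-1 n m (suc r)) (star-F̂ n star m (suc r) 0 q<r)) ⟩
    (T 1ℤ (λ n r p → F̂ n m r p) n (suc r) 0 + 1ℤ * A n m (suc r) 0) - A n m (suc r) 0
      ≡⟨ l₂ (A n m (suc r) 0) _ ⟩
    T 1ℤ (λ n r p → F̂ n m r p) n (suc r) 0 ∎
    where
    opaque
      unfolding _+_
      l₁ : ∀ x y → y ≡ x + y - x
      l₁ = solve-∀
    opaque
      unfolding _+_
      l₂ : ∀ x y → y + 1ℤ * x - x ≡ y
      l₂ = solve-∀
  A-star n star m r (suc q) q<r = trans (A-2 n m (suc r) q)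
    (trans (star-F̂ n star m (suc r) (suc q) q<r) (x+0*y≡x _ _))

  T-vanish : ∀ v G n m e → (∀ n′ m f → n′ ℕ.≤ n → G n′ m f ≡ 0ℤ) → T v G n m e ≡ 0ℤ
  T-vanish v G n m e h = +-≡0
    (∑-zero m λ f _ → trans (cong (α v e f *_) (go n h m f)) (*-zeroʳ (α v e f)))
    (∑-zero (suc m) λ f _ → trans (cong (β v e f *_) (h n (suc m) f ℕₚ.≤-refl)) (*-zeroʳ (β v e f)))
    where
    go : ∀ n → (∀ n′ m f → n′ ℕ.≤ n → G n′ m f ≡ 0ℤ) → ∀ m f → prev (λ n → G n m f) n ≡ 0ℤ
    go zero    h m f = refl
    go (suc n) h m f = h n m f (ℕₚ.n≤1+n n)

  -- Each part of `K-step` satisfies this recursion separately: K by induction, and A by `A-star` at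
  -- smaller n. The initial term `st` drops out on both sides, and v is arbitrary because
  -- `δ v (suc q)` is 1.
  K-star : ∀ n → (∀ n′ → n′ ℕ.< n → Star n′) → ∀ v m r q → suc q ℕ.< r →
    K n m r (suc q) ≡ T v (λ n r p → K n m r p) n r (suc q)
  K-star 0 star v m r q _ = trans (K-n 0 m r (suc q) z≤n)
    (sym (T-vanish v _ 0 r (suc q) λ n r p n≤ → K-n n m r p (ℕₚ.≤-trans n≤ z≤n)))
  K-star 1 star v m r q _ = trans (K-n 1 m r (suc q) (s≤s z≤n))
    (sym (T-vanish v _ 1 r (suc q) λ n r p n≤ → K-n n m r p (ℕₚ.≤-trans n≤ (s≤s z≤n))))
  K-star 2 star v m r q _ = trans (K-n 2 m r (suc q) ℕₚ.≤-refl)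
    (sym (T-vanish v _ 2 r (suc q) λ n r p n≤ → K-n n m r p n≤))
  K-star n@(suc (suc (suc _))) star v zero r q _ = trans (K-m₀ n r (suc q))
    (sym (trans (T-cong v n r (suc q) λ n r p _ → K-m₀ n r p) (T-vanish v _ n r (suc q) λ _ _ _ _ → refl)))
  K-star (suc (suc (suc n))) star v (suc m) (suc (suc r)) q (s≤s q<) = begin
    K (3 ℕ.+ n) (suc m) (2 ℕ.+ r) (suc q)
      ≡⟨ trans (K-step (suc n) m (suc r) (suc q)) (trans (x+0*y≡x _ _) (sym (+-identityʳ _))) ⟩
    y * K (2 ℕ.+ n) m (2 ℕ.+ r) (suc q)
      + y * (A (2 ℕ.+ n) (suc m) (suc r) (suc q) + a * A (1 ℕ.+ n) m (suc r) (suc q)) + 0ℤ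
      ≡⟨ cong₂ _+_ (cong₂ _+_
           (cong (y *_) (K-star (suc (suc n)) (λ n′ n< → star n′ (ℕₚ.m≤n⇒m≤1+n n<)) v m (suc (suc r)) q (s≤s q<)))
           (cong (y *_) (cong₂ _+_
              (trans (A-star (2 ℕ.+ n) (star _ ℕₚ.≤-refl) (suc m) r q q<) (sym (A-T (2 ℕ.+ n) (suc m) r q)))
              (cong (a *_) (trans (A-star (1 ℕ.+ n) (star _ (ℕₚ.n≤1+n _)) m r q q<) (sym (A-T (1 ℕ.+ n) m r q)))))))
           refl ⟩
    y * (∑ R (λ p → α v (suc q) p * K (1 ℕ.+ n) m R p) + ∑ (suc R) (λ p → β v (suc q) p * K (2 ℕ.+ n) m (suc R) p))
      + y * ((∑ R (λ p → α v (suc q) p * A (1 ℕ.+ n) (suc m) (suc r) p) + ∑ (suc R) (λ p → β v (suc q) p * A (2 ℕ.+ n) (suc m) R p))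
            + a * (∑ R (λ p → α v (suc q) p * A n m (suc r) p) + ∑ (suc R) (λ p → β v (suc q) p * A (1 ℕ.+ n) m R p))) + 0ℤ
      ≡⟨ regroup y a _ _ _ _ _ _ ⟩
    (y * ∑ R (λ p → α v (suc q) p * K (1 ℕ.+ n) m R p)
       + y * (∑ R (λ p → α v (suc q) p * A (1 ℕ.+ n) (suc m) (suc r) p) + a * ∑ R (λ p → α v (suc q) p * A n m (suc r) p)))
      + (y * ∑ (suc R) (λ p → β v (suc q) p * K (2 ℕ.+ n) m (suc R) p)
       + y * (∑ (suc R) (λ p → β v (suc q) p * A (2 ℕ.+ n) (suc m) R p) + a * ∑ (suc R) (λ p → β v (suc q) p * A (1 ℕ.+ n) m R p)))
      ≡⟨ cong₂ _+_ (collect R (α v (suc q)) _ _ _ _ (λ p → kst n (suc r) p refl))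
                   (collect (suc R) (β v (suc q)) _ _ _ _ (λ p → kst (suc n) R p refl)) ⟨
    ∑ R (λ p → α v (suc q) p * K (2 ℕ.+ n) (suc m) R p) + ∑ (suc R) (λ p → β v (suc q) p * K (3 ℕ.+ n) (suc m) (suc R) p) ∎
    where
    R = suc (suc r)
    opaque
      unfolding _+_
      regroup : ∀ y a k₁ k₂ a₁ a₂ b₁ b₂ → y * (k₁ + k₂) + y * ((a₁ + a₂) + a * (b₁ + b₂)) + 0ℤ
        ≡ (y * k₁ + y * (a₁ + a * b₁)) + (y * k₂ + y * (a₂ + a * b₂))
      regroup = solve-∀
    kst : ∀ n r′ p → ∀ {r} → r′ ≡ suc r → K (2 ℕ.+ n) (suc m) (suc r′) p ≡
      y * K (1 ℕ.+ n) m (suc r′) p + y * (A (1 ℕ.+ n) (suc m) r′ p + a * A n m r′ p)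
    kst n _ p {r} refl = trans (K-step n m (suc r) p)
      (trans (cong (λ z → k + ζ p * z) (st-suc n m r)) (trans (cong (λ z → k + z) (*-zeroʳ (ζ p))) (+-identityʳ k)))
      where k = y * K (1 ℕ.+ n) m (suc (suc r)) p + y * (A (1 ℕ.+ n) (suc m) (suc r) p + a * A n m (suc r) p)
    collect : ∀ k (c L k₁ a₁ b₁ : ℕ → ℤ) → (∀ p → L p ≡ y * k₁ p + y * (a₁ p + a * b₁ p)) →
      ∑ k (λ p → c p * L p) ≡ y * ∑ k (λ p → c p * k₁ p) + y * (∑ k (λ p → c p * a₁ p) + a * ∑ k (λ p → c p * b₁ p))
    collect k c L k₁ a₁ b₁ eq = begin
      ∑ k (λ p → c p * L p)
        ≡⟨ ∑-cong′ k (λ p → trans (cong (c p *_) (eq p)) (l₁ y a (c p) (k₁ p) (a₁ p) (b₁ p))) ⟩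
      ∑ k (λ p → y * (c p * k₁ p) + y * (c p * a₁ p + a * (c p * b₁ p)))
        ≡⟨ ∑-+ k _ _ ⟩
      _ ≡⟨ cong₂ _+_ (∑-*ˡ y k _) (trans (∑-*ˡ y k _) (cong (y *_) (trans (∑-+ k _ _)
             (cong (λ z → _ + z) (∑-*ˡ a k _))))) ⟩
      _ ∎
      where
      opaque
        unfolding _+_
        l₁ : ∀ y a c k₁ a₁ b₁ → c * (y * k₁ + y * (a₁ + a * b₁)) ≡ y * (c * k₁) + y * (c * a₁ + a * (c * b₁))
        l₁ = solve-∀

  -- `P` is the part of K with rpos > 0. `Q` is the combination of such parts that the exchanged
  -- operator produces from K at q = 0 (`T-K₀`), so its symmetry is what the boundary terms require.
  -- `J` collects what `P-step` contributes besides P and Q; it inherits symmetry from F and from K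
  -- at q = 0.
  P Q X J U : ℕ → ℕ → ℕ → ℤ
  P n m r = ∑ (ℕ.pred r) (λ p → K n m r (suc p))
  Q n m r = P n m (suc r) + a * prev (λ n → P n m r) n
  X n m r = ∑ r (λ p → F̂ n m r p)
  J n m r = X n m r - K n r m 0
  U n m r = ∑ r (λ p → A n m r (suc p))

  P-0 : ∀ n m r → (∀ p → K n m r p ≡ 0ℤ) → P n m r ≡ 0ℤ
  P-0 n m r h = ∑-zero (ℕ.pred r) λ p _ → h (suc p)

  K-P : ∀ n r m → ∑ m (λ f → K n r m f) ≡ K n r m 0 + P n r m
  K-P n r zero    = sym (+-≡0 (K-r₀ n r 0) refl)
  K-P n r (suc m) = refl

  A₀-P : ∀ n → Star n → ∀ m r → A n m r 0 ≡ K n r m 0 + P n r m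
  A₀-P n star m (suc r) = trans (A₀ n star m r) (K-P n (suc r) m)
  A₀-P n star m zero = trans (A-0 n m 0) (trans (∑-zero m λ f _ → F-r₀ 0ℤ n m f 0)
    (sym (+-≡0 (K-m₀ n m 0) (P-0 n 0 m (K-m₀ n m)))))

  U-J : ∀ n → Star n → ∀ m r → U n m r ≡ J n m r - P n r m
  U-J n star m zero = trans (sym (x-x≡0 0ℤ)) (cong₂ _-_
    (trans (sym (x-x≡0 0ℤ)) (cong (λ z → 0ℤ - z) (sym (K-m₀ n m 0)))) (sym (P-0 n 0 m (K-m₀ n m))))
  U-J n star m (suc r) = begin
    A n m (suc r) 1 + ∑ r (λ p → A n m (suc r) (suc (suc p)))
      ≡⟨ cong (λ z → A n m (suc r) 1 + z) (∑-cong′ r λ p → A-2 n m (suc r) p) ⟩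
    A n m (suc r) 1 + S₂ ≡⟨ l₁ (A n m (suc r) 0) _ S₂ ⟩
    (A n m (suc r) 0 + A n m (suc r) 1) + S₂ - A n m (suc r) 0
      ≡⟨ cong₂ _-_ (cong (_+ S₂) (A-1 n m (suc r))) (A₀-P n star m (suc r)) ⟩
    X n m (suc r) - (K n (suc r) m 0 + P n (suc r) m) ≡⟨ l₂ _ _ _ ⟩
    J n m (suc r) - P n (suc r) m ∎
    where
    S₂ = ∑ r (λ p → F̂ n m (suc r) (suc p))
    opaque
      unfolding _+_
      l₁ : ∀ x y z → y + z ≡ x + y + z - x
      l₁ = solve-∀
      l₂ : ∀ x y z → x - (y + z) ≡ x - y - z
      l₂ = solve-∀

  -- Summing `K-step` over positive rpos turns A into `U`. By `U-J` this brings in P with exchanged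
  -- arguments, at two consecutive indices, and these two terms are exactly one `Q`.
  P-step : ∀ n → Star (suc n) → Star n → ∀ m r → P (suc (suc n)) (suc m) (suc r) ≡
    y * P (suc n) m (suc r) + y * (J (suc n) (suc m) r + a * J n m r) - y * Q (suc n) r m
  P-step n star₁ star₀ m r = begin
    ∑ r (λ p → K (suc (suc n)) (suc m) (suc r) (suc p))
      ≡⟨ ∑-cong′ r (λ p → trans (K-step n m r (suc p)) (x+0*y≡x _ _)) ⟩
    ∑ r (λ p → y * K (suc n) m (suc r) (suc p) + y * (A (suc n) (suc m) r (suc p) + a * A n m r (suc p)))
      ≡⟨ ∑-+ r _ _ ⟩
    _ ≡⟨ cong₂ _+_ (∑-*ˡ y r _) (trans (∑-*ˡ y r _) (cong (y *_) (trans (∑-+ r _ _) (cong (λ z → _ + z) (∑-*ˡ a r _))))) ⟩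
    y * P (suc n) m (suc r) + y * (U (suc n) (suc m) r + a * U n m r)
      ≡⟨ cong (λ z → y * P (suc n) m (suc r) + y * z)
           (cong₂ _+_ (U-J (suc n) star₁ (suc m) r) (cong (a *_) (U-J n star₀ m r))) ⟩
    y * P (suc n) m (suc r) + y * ((J (suc n) (suc m) r - P (suc n) r (suc m)) + a * (J n m r - P n r m))
      ≡⟨ lemma _ _ _ _ _ _ _ ⟩
    y * P (suc n) m (suc r) + y * (J (suc n) (suc m) r + a * J n m r) - y * Q (suc n) r m ∎
    where
    opaque
      unfolding _+_
      lemma : ∀ y a p j₁ p₁ j p₀ → y * p + y * ((j₁ - p₁) + a * (j - p₀)) ≡ y * p + y * (j₁ + a * j) - y * (p₁ + a * p₀)
      lemma = solve-∀

  record Symmetric (n : ℕ) : Set where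
    field
      F-sym : ∀ v m e r q → e ℕ.< m → q ℕ.< r → F v n m e r q ≡ F v n r q m e
      star  : Star n
      B-sym : ∀ m r → K n m r 0 ≡ K n r m 0
      Q-sym : ∀ m r → Q n m r ≡ Q n r m
  open Symmetric

  J-sym : ∀ n → Symmetric n → ∀ m r → J n m r ≡ J n r m
  J-sym n s m r = cong₂ _-_
    (trans (∑-cong r λ p p<r → ∑-cong m λ f f<m → F-sym s 1ℤ m f r p f<m p<r) (∑-swap r m _))
    (sym (B-sym s m r))

  -- Once `A₀-P` has been inserted into `K-step` at q = 0, the two terms y K of index one lower are
  -- interchanged by exchanging m and r. All others are symmetric by induction.
  B-sym-step : ∀ n → (∀ n′ → n′ ℕ.< n → Symmetric n′) → ∀ m r → K n m r 0 ≡ K n r m 0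
  B-sym-step 0 ih m r = trans (K-n 0 m r 0 z≤n) (sym (K-n 0 r m 0 z≤n))
  B-sym-step 1 ih m r = trans (K-n 1 m r 0 (s≤s z≤n)) (sym (K-n 1 r m 0 (s≤s z≤n)))
  B-sym-step n@(suc (suc _)) ih zero r = trans (K-m₀ n r 0) (sym (K-r₀ n r 0))
  B-sym-step n@(suc (suc _)) ih (suc m) zero = trans (K-r₀ n (suc m) 0) (sym (K-m₀ n (suc m) 0))
  B-sym-step (suc (suc n)) ih (suc m) (suc r) = trans (expand m r) (trans (swapped _ _ _ _
      (B-sym s₀ r m) (Q-sym s₁ r m) (st-sym n m r)) (sym (expand r m)))
    where
    s₁ = ih (suc n) ℕₚ.≤-refl
    s₀ = ih n (ℕₚ.n≤1+n (suc n))
    expand : ∀ m r → K (suc (suc n)) (suc m) (suc r) 0 ≡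
      y * K (suc n) m (suc r) 0 + y * K (suc n) r (suc m) 0 + y * a * K n r m 0 + y * Q (suc n) r m + st n m r
    expand m r = trans (K-step n m r 0) (trans
      (cong (λ z → y * K (suc n) m (suc r) 0 + y * z + 1ℤ * st n m r)
        (cong₂ _+_ (A₀-P (suc n) (star s₁) (suc m) r) (cong (a *_) (A₀-P n (star s₀) m r))))
      (lemma _ _ _ _ _ _ _ _))
      where
      opaque
        unfolding _+_
        lemma : ∀ y a k k₁ p₁ k₀ p₀ s → y * k + y * ((k₁ + p₁) + a * (k₀ + p₀)) + 1ℤ * s
          ≡ y * k + y * k₁ + y * a * k₀ + y * (p₁ + a * p₀) + s
        lemma = solve-∀
    swapped : ∀ p q {k k′ c c′ s s′} x x′ → k ≡ k′ → c ≡ c′ → s ≡ s′ →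
      p * x + p * x′ + q * k + p * c + s ≡ p * x′ + p * x + q * k′ + p * c′ + s′
    swapped p q {k} {c = c} {s = s} x x′ refl refl refl = lemma p q k c s x x′
      where
      opaque
        unfolding _+_
        lemma : ∀ p q k c s x x′ → p * x + p * x′ + q * k + p * c + s ≡ p * x′ + p * x + q * k + p * c + s
        lemma = solve-∀

  Q-m₀ : ∀ n r → Q n 0 r ≡ 0ℤ
  Q-m₀ n r = +-≡0 (P-0 n 0 (suc r) (K-m₀ n (suc r))) (trans (cong (a *_) (go n)) (*-zeroʳ a))
    where
    go : ∀ n → prev (λ n → P n 0 r) n ≡ 0ℤ
    go zero    = refl
    go (suc n) = P-0 n 0 r (K-m₀ n r)

  Q-r₀ : ∀ n m → Q n m 0 ≡ 0ℤ
  Q-r₀ n m = +-≡0 refl (trans (cong (a *_) (go n)) (*-zeroʳ a))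
    where
    go : ∀ n → prev (λ n → P n m 0) n ≡ 0ℤ
    go zero    = refl
    go (suc n) = refl

  Q-small : ∀ n m r → n ℕ.≤ 2 → Q n m r ≡ 0ℤ
  Q-small n m r n≤2 = +-≡0 (P-0 n m (suc r) λ p → K-n n m (suc r) p n≤2) (trans (cong (a *_) (go n n≤2)) (*-zeroʳ a))
    where
    go : ∀ n → n ℕ.≤ 2 → prev (λ n → P n m r) n ≡ 0ℤ
    go zero    _ = refl
    go (suc n) n<2 = P-0 n m r λ p → K-n n m r p (ℕₚ.≤-trans (ℕₚ.n≤1+n n) n<2)

  -- The two values of P in `Q` expand by `P-step` into a difference of `Q` and its exchange at the
  -- next lower index, which is zero by induction. What remains is built from `J` and an earlier `Q`
  -- and is symmetric term by term.
  Q-sym-step : ∀ n → (∀ n′ → n′ ℕ.< n → Symmetric n′) → ∀ m r → Q n m r ≡ Q n r m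
  Q-sym-step 0 ih m r = trans (Q-small 0 m r z≤n) (sym (Q-small 0 r m z≤n))
  Q-sym-step 1 ih m r = trans (Q-small 1 m r (s≤s z≤n)) (sym (Q-small 1 r m (s≤s z≤n)))
  Q-sym-step 2 ih m r = trans (Q-small 2 m r ℕₚ.≤-refl) (sym (Q-small 2 r m ℕₚ.≤-refl))
  Q-sym-step n@(suc (suc (suc _))) ih zero r = trans (Q-m₀ n r) (sym (Q-r₀ n r))
  Q-sym-step n@(suc (suc (suc _))) ih (suc m) zero = trans (Q-r₀ n (suc m)) (sym (Q-m₀ n (suc m)))
  Q-sym-step (suc (suc (suc n))) ih (suc m) (suc r) = begin
    Q (3 ℕ.+ n) (suc m) (suc r) ≡⟨ expand m r ⟩
    y * (J (2 ℕ.+ n) (suc m) (suc r) + a * J (1 ℕ.+ n) m (suc r) + a * J (1 ℕ.+ n) (suc m) r + a * a * J n m r) - a * y * Q (1 ℕ.+ n) r m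
      ≡⟨ cong₂ (λ j q → y * j - a * y * q)
           (cong₂ _+_ (trans (cong₂ _+_ (cong₂ _+_ (J-sym (2 ℕ.+ n) s₂ (suc m) (suc r))
                (cong (a *_) (J-sym (1 ℕ.+ n) s₁ m (suc r)))) (cong (a *_) (J-sym (1 ℕ.+ n) s₁ (suc m) r))) (lemma _ _ _))
             (cong (a * a *_) (J-sym n s₀ m r)))
           (Q-sym s₁ r m) ⟩
    y * (J (2 ℕ.+ n) (suc r) (suc m) + a * J (1 ℕ.+ n) r (suc m) + a * J (1 ℕ.+ n) (suc r) m + a * a * J n r m) - a * y * Q (1 ℕ.+ n) m r
      ≡⟨ expand r m ⟨
    Q (3 ℕ.+ n) (suc r) (suc m) ∎
    where
    s₂ = ih (2 ℕ.+ n) ℕₚ.≤-refl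
    s₁ = ih (1 ℕ.+ n) (ℕₚ.n≤1+n _)
    s₀ = ih n (ℕₚ.≤-trans (ℕₚ.n≤1+n _) (ℕₚ.n≤1+n _))
    opaque
      unfolding _+_
      lemma : ∀ x y z → x + y + z ≡ x + z + y
      lemma = solve-∀
      collect : ∀ y a p₂ p₁ j₂ j₁ j₁′ j₀ q₂ q₁ →
        (y * p₂ + y * (j₂ + a * j₁) - y * q₂) + a * (y * p₁ + y * (j₁′ + a * j₀) - y * q₁)
        ≡ y * (p₂ + a * p₁) - y * q₂ + (y * (j₂ + a * j₁ + a * j₁′ + a * a * j₀) - a * y * q₁)
      collect = solve-∀
      cancel : ∀ x z → x - x + z ≡ z
      cancel = solve-∀
    expand : ∀ m r → Q (3 ℕ.+ n) (suc m) (suc r) ≡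
      y * (J (2 ℕ.+ n) (suc m) (suc r) + a * J (1 ℕ.+ n) m (suc r) + a * J (1 ℕ.+ n) (suc m) r + a * a * J n m r) - a * y * Q (1 ℕ.+ n) r m
    expand m r = begin
      P (3 ℕ.+ n) (suc m) (2 ℕ.+ r) + a * P (2 ℕ.+ n) (suc m) (suc r)
        ≡⟨ cong₂ _+_ (P-step (suc n) (star s₂) (star s₁) m (suc r)) (cong (a *_) (P-step n (star s₁) (star s₀) m r)) ⟩
      _ ≡⟨ collect _ _ _ _ _ _ _ _ _ _ ⟩
      y * Q (2 ℕ.+ n) m (suc r) - y * Q (2 ℕ.+ n) (suc r) m + rest
        ≡⟨ cong (λ z → y * z - y * Q (2 ℕ.+ n) (suc r) m + rest) (Q-sym s₂ m (suc r)) ⟩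
      y * Q (2 ℕ.+ n) (suc r) m - y * Q (2 ℕ.+ n) (suc r) m + rest ≡⟨ cancel _ rest ⟩
      rest ∎
      where
      rest = y * (J (2 ℕ.+ n) (suc m) (suc r) + a * J (1 ℕ.+ n) m (suc r) + a * J (1 ℕ.+ n) (suc m) r + a * a * J n m r)
        - a * y * Q (1 ℕ.+ n) r m

  T-K₀ : ∀ v n m r → T v (λ n r p → K n m r p) n (suc r) 0 ≡ v * (t * prev (λ n → K n m (suc r) 0) n + Q n m (suc r))
  T-K₀ v n m r = begin
    v * t * k₀ + ∑ r (λ p → v * a * prev (λ n → K n m (suc r) (suc p)) n)
      + (v * 0ℤ * K n m (suc (suc r)) 0 + ∑ (suc r) (λ p → v * 1ℤ * K n m (suc (suc r)) (suc p)))
      ≡⟨ cong₂ (λ x z → v * t * k₀ + x + (v * 0ℤ * K n m (suc (suc r)) 0 + z)) (∑-*ˡ _ r _) (∑-*ˡ (v * 1ℤ) (suc r) (λ p → K n m (suc (suc r)) (suc p))) ⟩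
    _ ≡⟨ cong (λ z → v * t * k₀ + v * a * z + (v * 0ℤ * K n m (suc (suc r)) 0 + v * 1ℤ * P n m (suc (suc r)))) (prev-∑ n) ⟩
    _ ≡⟨ lemma _ _ _ _ _ _ _ ⟩
    v * (t * k₀ + Q n m (suc r)) ∎
    where
    k₀ = prev (λ n → K n m (suc r) 0) n
    prev-∑ : ∀ n → ∑ r (λ p → prev (λ n → K n m (suc r) (suc p)) n) ≡ prev (λ n → P n m (suc r)) n
    prev-∑ zero    = ∑-zero r λ _ _ → refl
    prev-∑ (suc n) = refl
    opaque
      unfolding _+_
      lemma : ∀ v t a k p x s → v * t * k + v * a * p + (v * 0ℤ * x + v * 1ℤ * s) ≡ v * (t * k + (s + a * p))
      lemma = solve-∀

  -- D is the defect of the exchanged recursion; as T commutes with its exchange,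
  -- D = T D up to boundary terms, which cancel by K-star, B and Qs.
  star-step : ∀ n → (∀ n′ → n′ ℕ.< n → Symmetric n′) → (∀ m r → K n m r 0 ≡ K n r m 0) → (∀ m r → Q n m r ≡ Q n r m) → Star n
  star-step n ih B Qs v m e r q e<m q<r = trans (l₁ _ _ _) (trans (cong (_+ (T* n m e + ζ q * K n r m e)) D≡0) (+-identityˡ _))
    where
    T* D : ℕ → ℕ → ℕ → ℤ
    T* n m e = T v (λ n r p → F v n m e r p) n r q
    D n m e = F v n m e r q - (T* n m e + ζ q * K n r m e)
    opaque
      unfolding _+_
      l₁ : ∀ x y z → x ≡ x - (y + z) + (y + z)
      l₁ = solve-∀
    ih-star : ∀ n′ → n′ ℕ.< n → Star n′
    ih-star n′ n′<n = star (ih n′ n′<n)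
    T*-step : ∀ m e → e ℕ.< m → T* n m e ≡ T v T* n m e + ζ e * T v (λ n r p → K n m r p) n r q
    T*-step m e e<m = begin
      T v (λ n r p → F v n m e r p) n r q
        ≡⟨ T-cong v n r q (λ n r p _ → F-step v n m e r p e<m) ⟩
      T v (λ n r p → T v (λ n m f → F v n m f r p) n m e + ζ e * K n m r p) n r q
        ≡⟨ T-+ v (λ n r p → T v (λ n m f → F v n m f r p) n m e) (λ n r p → ζ e * K n m r p) n r q ⟩
      T v (λ n r p → T v (λ n m f → F v n m f r p) n m e) n r q + T v (λ n r p → ζ e * K n m r p) n r q
        ≡⟨ cong₂ _+_ (sym (T-comm v (λ n m f r p → F v n m f r p) n m e r q)) (T-* v (ζ e) (λ n r p → K n m r p) n r q) ⟩
      T v T* n m e + ζ e * T v (λ n r p → K n m r p) n r q ∎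
    prev-K : ∀ n → (∀ n′ → n′ ℕ.< n → Symmetric n′) → ∀ m r → prev (λ n → K n m r 0) n ≡ prev (λ n → K n r m 0) n
    prev-K zero    ih m r = refl
    prev-K (suc n) ih m r = B-sym (ih n ℕₚ.≤-refl) m r
    -- Rearranged, this is ζ e (1 - T*) K = ζ q (1 - T) K*. If e or q is positive, any term that
    -- remains vanishes by `K-star`. For e = q = 0 both operators are evaluated by `T-K₀`, and the
    -- results agree by `B`, `Qs` and the induction hypothesis.
    boundary : ∀ m e r q → e ℕ.< m → q ℕ.< r →
      ζ e * K n m r q - ζ e * T v (λ n r p → K n m r p) n r q - ζ q * K n r m e
        ≡ 0ℤ - ζ q * T v (λ n m f → K n r m f) n m e
    boundary m (suc e) r (suc q) _ _ = l _ _ _ _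
      where
      opaque
        unfolding _+_
        l : ∀ a b c d → 0ℤ * a - 0ℤ * b - 0ℤ * c ≡ 0ℤ - 0ℤ * d
        l = solve-∀
    boundary m zero r (suc q) _ q<r = trans (cong (λ z → 1ℤ * z - 1ℤ * T v (λ n r p → K n m r p) n r (suc q) - 0ℤ * K n r m 0)
        (K-star n ih-star v m r q q<r)) (l _ _ _)
      where
      opaque
        unfolding _+_
        l : ∀ a c d → 1ℤ * a - 1ℤ * a - 0ℤ * c ≡ 0ℤ - 0ℤ * d
        l = solve-∀
    boundary m (suc e) r zero e<m _ = trans (cong (λ z → 0ℤ * K n m r 0 - 0ℤ * T v (λ n r p → K n m r p) n r 0 - 1ℤ * z)
        (K-star n ih-star v r m e e<m)) (l _ _ _)
      where
      opaque
        unfolding _+_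
        l : ∀ a b d → 0ℤ * a - 0ℤ * b - 1ℤ * d ≡ 0ℤ - 1ℤ * d
        l = solve-∀
    boundary (suc m) zero (suc r) zero _ _ = trans
      (cong₂ (λ x z → 1ℤ * x - 1ℤ * z - 1ℤ * K n (suc r) (suc m) 0) (B (suc m) (suc r))
        (trans (T-K₀ v n (suc m) r) (trans
          (cong₂ (λ x z → v * (t * x + z)) (prev-K n ih (suc m) (suc r)) (Qs (suc m) (suc r)))
          (sym (T-K₀ v n (suc r) m)))))
      (l _ _)
      where
      opaque
        unfolding _+_
        l : ∀ a d → 1ℤ * a - 1ℤ * d - 1ℤ * a ≡ 0ℤ - 1ℤ * d
        l = solve-∀
    D-step : ∀ m e → e ℕ.< m → D n m e ≡ T v D n m e
    D-step m e e<m = begin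
      F v n m e r q - (T* n m e + ζ q * K n r m e)
        ≡⟨ cong₂ (λ x z → x - (z + ζ q * K n r m e)) (F-step v n m e r q e<m) (T*-step m e e<m) ⟩
      _ ≡⟨ l₂ _ _ _ _ _ ⟩
      T v (λ n m f → F v n m f r q) n m e - T v T* n m e
        + (ζ e * K n m r q - ζ e * T v (λ n r p → K n m r p) n r q - ζ q * K n r m e)
        ≡⟨ cong (λ z → T v (λ n m f → F v n m f r q) n m e - T v T* n m e + z) (boundary m e r q e<m q<r) ⟩
      _ ≡⟨ l₃ _ _ _ ⟩
      T v (λ n m f → F v n m f r q) n m e - (T v T* n m e + ζ q * T v (λ n m f → K n r m f) n m e)
        ≡⟨ cong (λ z → T v (λ n m f → F v n m f r q) n m e - z)
             (trans (T-+ v T* (λ n m f → ζ q * K n r m f) n m e) (cong (λ z → T v T* n m e + z) (T-* v (ζ q) (λ n m f → K n r m f) n m e))) ⟨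
      T v (λ n m f → F v n m f r q) n m e - T v (λ n m e → T* n m e + ζ q * K n r m e) n m e
        ≡⟨ T-- v (λ n m f → F v n m f r q) (λ n m e → T* n m e + ζ q * K n r m e) n m e ⟨
      T v D n m e ∎
      where
      opaque
        unfolding _+_
        l₂ : ∀ a b c d k → a + b - (c + d + k) ≡ a - c + (b - d - k)
        l₂ = solve-∀
        l₃ : ∀ a c k → a - c + (0ℤ - k) ≡ a - (c + k)
        l₃ = solve-∀
    T*-outside : ∀ m e → n ℕ.≤ m → T* n m e ≡ 0ℤ
    T*-outside m e n≤m = T-vanish v _ n r q λ n′ r p n′≤n → F-m v n′ m e r p (ℕₚ.≤-trans n′≤n n≤m)
    D≡0 : D n m e ≡ 0ℤ
    D≡0 = T-unique v D n
      (λ n′ m e n′<n e<m → x≡y⇒x-y≡0 (ih-star n′ n′<n v m e r q e<m q<r))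
      D-step
      (λ m e n≤m → x≡y⇒x-y≡0 (trans (F-m v n m e r q n≤m) (sym (+-≡0
        (T*-outside m e n≤m) (trans (cong (ζ q *_) (K-r n r m e n≤m)) (*-zeroʳ (ζ q)))))))
      m e e<m

  -- By `F-step` and the newly proved `Star`, F and its exchange satisfy the same recursion with the
  -- same boundary term. Their difference is then a solution of D = T D, to which `T-unique`
  -- applies.
  symmetric-step : ∀ n → (∀ {n′} → n′ ℕ.< n → Symmetric n′) → Symmetric n
  symmetric-step n ih′ = record { F-sym = λ v m e r q e<m q<r → x-y≡0⇒x≡y (D≡0 v m e r q e<m q<r)
                                ; star = st′ ; B-sym = B ; Q-sym = Qs }
    where
    ih : ∀ n′ → n′ ℕ.< n → Symmetric n′
    ih n′ = ih′ {n′}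
    B = B-sym-step n ih
    Qs = Q-sym-step n ih
    st′ = star-step n ih B Qs
    D≡0 : ∀ v m e r q → e ℕ.< m → q ℕ.< r → F v n m e r q - F v n r q m e ≡ 0ℤ
    D≡0 v m e r q e<m q<r = T-unique v (λ n m e → F v n m e r q - F v n r q m e) n
      (λ n′ m e n′<n e<m → x≡y⇒x-y≡0 (F-sym (ih n′ n′<n) v m e r q e<m q<r))
      (λ m e e<m → begin
        F v n m e r q - F v n r q m e
          ≡⟨ cong₂ _-_ (F-step v n m e r q e<m) (st′ v r q m e q<r e<m) ⟩
        (T v (λ n m f → F v n m f r q) n m e + ζ e * K n m r q) - (T v (λ n m f → F v n r q m f) n m e + ζ e * K n m r q)
          ≡⟨ l _ _ _ ⟩
        T v (λ n m f → F v n m f r q) n m e - T v (λ n m f → F v n r q m f) n m e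
          ≡⟨ T-- v (λ n m f → F v n m f r q) (λ n m f → F v n r q m f) n m e ⟨
        T v (λ n m f → F v n m f r q - F v n r q m f) n m e ∎)
      (λ m e n≤m → x≡y⇒x-y≡0 (trans (F-m v n m e r q n≤m) (sym (F-r v n r q m e n≤m))))
      m e e<m
      where
      opaque
        unfolding _+_
        l : ∀ x y z → (x + z) - (y + z) ≡ x - y
        l = solve-∀

  symmetric : ∀ n → Symmetric n
  symmetric = <-rec Symmetric (λ n → symmetric-step n)

-- Powers, indicators and relabellings that skip a value

infixr 9 _^_
_^_ : ℤ → ℕ → ℤ
x ^ zero  = 1ℤ
x ^ suc n = x * x ^ n

ind : Bool → ℤ
ind true  = 1ℤ
ind false = 0ℤ

-- The increasing bijection from ℕ onto ℕ without c; `punch 0` is the successor.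
punch : ℕ → ℕ → ℕ
punch zero    x       = suc x
punch (suc c) zero    = zero
punch (suc c) (suc x) = suc (punch c x)

punch-< : ∀ c x y → (punch c x <ᵇ punch c y) ≡ (x <ᵇ y)
punch-< zero    x       y       = refl
punch-< (suc c) zero    zero    = refl
punch-< (suc c) zero    (suc y) = refl
punch-< (suc c) (suc x) zero    = refl
punch-< (suc c) (suc x) (suc y) = punch-< c x y

punch-≡ : ∀ c x y → (punch c x ≡ᵇ punch c y) ≡ (x ≡ᵇ y)
punch-≡ zero    x       y       = refl
punch-≡ (suc c) zero    zero    = refl
punch-≡ (suc c) zero    (suc y) = refl
punch-≡ (suc c) (suc x) zero    = refl
punch-≡ (suc c) (suc x) (suc y) = punch-≡ c x y

punch-<-suc : ∀ c m x → c ℕ.≤ m → (punch c x <ᵇ suc m) ≡ (x <ᵇ m)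
punch-<-suc zero    m       x       _         = refl
punch-<-suc (suc c) (suc m) zero    _         = refl
punch-<-suc (suc c) (suc m) (suc x) (s≤s c≤m) = punch-<-suc c m x c≤m

punch-missed : ∀ c x → (c ≡ᵇ punch c x) ≡ false
punch-missed zero    x       = refl
punch-missed (suc c) zero    = refl
punch-missed (suc c) (suc x) = punch-missed c x

punch-below : ∀ c x → x ℕ.< c → punch c x ≡ x
punch-below (suc c) zero    _         = refl
punch-below (suc c) (suc x) (s≤s x<c) = cong suc (punch-below c x x<c)

≡ᵇ-refl : ∀ n → (n ≡ᵇ n) ≡ true
≡ᵇ-refl zero    = refl
≡ᵇ-refl (suc n) = ≡ᵇ-refl n

<⇒≢ᵇ : ∀ {x c} → x ℕ.< c → (c ≡ᵇ x) ≡ false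
<⇒≢ᵇ {zero}  {suc c} _         = refl
<⇒≢ᵇ {suc x} {suc c} (s≤s x<c) = <⇒≢ᵇ x<c

<⇒<ᵇ≡true : ∀ {x c} → x ℕ.< c → (x <ᵇ c) ≡ true
<⇒<ᵇ≡true {zero}  {suc c} _         = refl
<⇒<ᵇ≡true {suc x} {suc c} (s≤s x<c) = <⇒<ᵇ≡true x<c

∑-punch : ∀ n c g → c ℕ.≤ n → g c ≡ 0ℤ → ∑ (suc n) g ≡ ∑ n (g ∘ punch c)
∑-punch n       zero    g _         g0 = trans (cong (_+ ∑ n (g ∘ suc)) g0) (+-identityˡ _)
∑-punch (suc n) (suc c) g (s≤s c≤n) gc = cong (λ z → g 0 + z) (∑-punch n c (g ∘ suc) c≤n gc)

∑-last : ∀ n g → ∑ (suc n) g ≡ ∑ n g + g n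
∑-last zero    g = trans (+-identityʳ _) (sym (+-identityˡ _))
∑-last (suc n) g = trans (cong (λ z → g 0 + z) (∑-last n (g ∘ suc))) (lemma _ _ _)
  where
  opaque
    unfolding _+_
    lemma : ∀ x y z → x + (y + z) ≡ x + y + z
    lemma = solve-∀

∑-split-last : ∀ n {L} p s → (∀ x → x ℕ.< n → L x ≡ p x + s x) → L n ≡ s n →
  ∑ (suc n) L ≡ ∑ n p + ∑ (suc n) s
∑-split-last n {L} p s eq last = begin
  ∑ (suc n) L ≡⟨ ∑-last n L ⟩
  ∑ n L + L n ≡⟨ cong₂ _+_ (trans (∑-cong n eq) (∑-+ n p s)) last ⟩
  ∑ n p + ∑ n s + s n ≡⟨ lemma _ _ _ ⟩
  ∑ n p + (∑ n s + s n) ≡⟨ cong (λ z → ∑ n p + z) (∑-last n s) ⟨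
  ∑ n p + ∑ (suc n) s ∎
  where
  open ≡-Reasoning
  opaque
    unfolding _+_
    lemma : ∀ x y z → x + y + z ≡ x + (y + z)
    lemma = solve-∀

-- Statistics of tails

up : ℕ → ℕ → ℕ
up l x = if l <ᵇ x then 1 else 0

has : ℕ → List ℕ → Bool
has c []      = false
has c (x ∷ w) = (c ≡ᵇ x) ∨ has c w

allGE : ℕ → List ℕ → Bool
allGE x []      = true
allGE x (y ∷ w) = if y <ᵇ x then false else allGE x w

-- A new right-to-left minimum on the left shifts every index by one. The code 0, which stands for
-- the absence of an index, is left alone.
bump : ℕ → ℕ
bump zero    = zero
bump (suc j) = suc (suc j)

rr : List ℕ → ℕ
rr []      = 0
rr (x ∷ w) = if allGreater x w then suc (rr w) else rr w

-- qd w is one more than the largest index m as in the definition of rpos, and 0 if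
-- there is no such index: the suffix w alone decides how reading one more
-- letter to its left changes the set of these indices.
qd : List ℕ → ℕ
qd []      = 0
qd (x ∷ w) = if allGreater x w then bump (qd w) else if allGE x w then 1 ⊔ qd w else qd w

-- ρ m w is rep of the sequence 0 1 … m − 1 followed by w (see ρ-bld).
ρ : ℕ → List ℕ → ℕ
ρ m []      = 0
ρ m (x ∷ w) = (if (x <ᵇ m) ∨ has x w then 1 else 0) ℕ.+ ρ m w

zs : List ℕ → ℕ
zs []          = 0
zs (zero  ∷ w) = suc (zs w)
zs (suc _ ∷ w) = zs w

module _ (c : ℕ) where

  has-punch : ∀ x w → has (punch c x) (map (punch c) w) ≡ has x w
  has-punch x []      = refl
  has-punch x (y ∷ w) = cong₂ _∨_ (punch-≡ c x y) (has-punch x w)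

  allGreater-punch : ∀ x w → allGreater (punch c x) (map (punch c) w) ≡ allGreater x w
  allGreater-punch x []      = refl
  allGreater-punch x (y ∷ w) = cong₂ (λ b d → if b then d else false) (punch-< c x y) (allGreater-punch x w)

  allGE-punch : ∀ x w → allGE (punch c x) (map (punch c) w) ≡ allGE x w
  allGE-punch x []      = refl
  allGE-punch x (y ∷ w) = cong₂ (λ b d → if b then false else d) (punch-< c y x) (allGE-punch x w)

  rr-punch : ∀ w → rr (map (punch c) w) ≡ rr w
  rr-punch []      = refl
  rr-punch (x ∷ w) = cong₂ (λ b d → if b then suc d else d) (allGreater-punch x w) (rr-punch w)

  qd-punch : ∀ w → qd (map (punch c) w) ≡ qd w
  qd-punch []      = refl
  qd-punch (x ∷ w) rewrite allGreater-punch x w | allGE-punch x w | qd-punch w = refl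

  asc-punch : ∀ w → asc (map (punch c) w) ≡ asc w
  asc-punch []          = refl
  asc-punch (x ∷ [])    = refl
  asc-punch (x ∷ y ∷ w) = cong₂ (λ b d → (if b then 1 else 0) ℕ.+ d) (punch-< c x y) (asc-punch (y ∷ w))

  ρ-punch : ∀ m w → c ℕ.≤ m → ρ (suc m) (map (punch c) w) ≡ ρ m w
  ρ-punch m []      c≤m = refl
  ρ-punch m (x ∷ w) c≤m = cong₂ (λ b d → (if b then 1 else 0) ℕ.+ d)
    (cong₂ _∨_ (punch-<-suc c m x c≤m) (has-punch x w)) (ρ-punch m w c≤m)

has-0-punch : ∀ c w → has 0 (map (punch (suc c)) w) ≡ has 0 w
has-0-punch c w = has-punch (suc c) 0 w

has-0-suc : ∀ w → has 0 (map suc w) ≡ false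
has-0-suc []      = refl
has-0-suc (x ∷ w) = has-0-suc w

zs-punch : ∀ c w → zs (map (punch (suc c)) w) ≡ zs w
zs-punch c []          = refl
zs-punch c (zero ∷ w)  = cong suc (zs-punch c w)
zs-punch c (suc _ ∷ w) = zs-punch c w

allGreater-0-suc : ∀ w → allGreater 0 (map suc w) ≡ true
allGreater-0-suc []      = refl
allGreater-0-suc (x ∷ w) = allGreater-0-suc w

<ᵇ-irrefl : ∀ m → (m <ᵇ m) ≡ false
<ᵇ-irrefl zero    = refl
<ᵇ-irrefl (suc m) = <ᵇ-irrefl m

≡⊎<ᵇ-suc : ∀ m x → m ≡ x ⊎ ((x <ᵇ suc m) ≡ (x <ᵇ m) × (m ≡ᵇ x) ≡ false)
≡⊎<ᵇ-suc zero    zero    = inj₁ refl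
≡⊎<ᵇ-suc zero    (suc x) = inj₂ (refl , refl)
≡⊎<ᵇ-suc (suc m) zero    = inj₂ (refl , refl)
≡⊎<ᵇ-suc (suc m) (suc x) with ≡⊎<ᵇ-suc m x
... | inj₁ eq = inj₁ (cong suc eq)
... | inj₂ p  = inj₂ p

ρ-suc : ∀ m w → ρ (suc m) w ≡ (if has m w then 1 else 0) ℕ.+ ρ m w
ρ-suc m []      = refl
ρ-suc m (x ∷ w) with ≡⊎<ᵇ-suc m x
... | inj₁ refl rewrite ≡ᵇ-refl m | <⇒<ᵇ≡true (ℕₚ.n<1+n m) | <ᵇ-irrefl m | ρ-suc m w = refl
... | inj₂ (p , q) rewrite p | q | ρ-suc m w = swap (if (x <ᵇ m) ∨ has x w then 1 else 0) (if has m w then 1 else 0) (ρ m w)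
  where
  swap : ∀ x y z → x ℕ.+ (y ℕ.+ z) ≡ y ℕ.+ (x ℕ.+ z)
  swap x y z = trans (sym (ℕₚ.+-assoc x y z)) (trans (cong (ℕ._+ z) (ℕₚ.+-comm x y)) (ℕₚ.+-assoc y x z))

-- Sums over the continuations of an ascent sequence with a ascents and last
-- letter l by k further letters.
V : ℕ → ℕ → ℕ → (List ℕ → ℤ) → ℤ
V a l zero    g = g []
V a l (suc k) g = ∑ (suc (suc a)) λ x → V (up l x ℕ.+ a) x k (λ w → g (x ∷ w))

V-cong : ∀ a l k {g h} → (∀ w → length w ≡ k → g w ≡ h w) → V a l k g ≡ V a l k h
V-cong a l zero    eq = eq [] refl
V-cong a l (suc k) eq = ∑-cong′ (suc (suc a)) λ x → V-cong (up l x ℕ.+ a) x k λ w len → eq (x ∷ w) (cong suc len)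

V-cong′ : ∀ a l k {g h} → (∀ w → g w ≡ h w) → V a l k g ≡ V a l k h
V-cong′ a l k eq = V-cong a l k λ w _ → eq w

V-zero : ∀ a l k {g} → (∀ w → length w ≡ k → g w ≡ 0ℤ) → V a l k g ≡ 0ℤ
V-zero a l zero    eq = eq [] refl
V-zero a l (suc k) eq = ∑-zero (suc (suc a)) λ x _ → V-zero (up l x ℕ.+ a) x k λ w len → eq (x ∷ w) (cong suc len)

V-+ : ∀ a l k g h → V a l k (λ w → g w + h w) ≡ V a l k g + V a l k h
V-+ a l zero    g h = refl
V-+ a l (suc k) g h = trans
  (∑-cong′ (suc (suc a)) λ x → V-+ (up l x ℕ.+ a) x k (λ w → g (x ∷ w)) (λ w → h (x ∷ w)))
  (∑-+ (suc (suc a)) (λ x → V (up l x ℕ.+ a) x k (λ w → g (x ∷ w))) (λ x → V (up l x ℕ.+ a) x k (λ w → h (x ∷ w))))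

V-*ˡ : ∀ a l k c g → V a l k (λ w → c * g w) ≡ c * V a l k g
V-*ˡ a l zero    c g = refl
V-*ˡ a l (suc k) c g = trans
  (∑-cong′ (suc (suc a)) λ x → V-*ˡ (up l x ℕ.+ a) x k c (λ w → g (x ∷ w)))
  (∑-*ˡ c (suc (suc a)) (λ x → V (up l x ℕ.+ a) x k (λ w → g (x ∷ w))))

-- With one ascent more the letters have one more value available, and avoiding c gives that value
-- up again. As `punch c` preserves ascents, the two bounds stay one apart along the whole
-- continuation.
V-punch : ∀ c a l k (h : List ℕ → ℤ) → c ℕ.≤ suc a →
  V (suc a) (punch c l) k (λ w → ind (not (has c w)) * h w) ≡ V a l k (h ∘ map (punch c))
V-punch c a l zero    h c≤ = *-identityˡ (h [])
V-punch c a l (suc k) h c≤ = trans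
  (∑-punch (suc (suc a)) c (λ x → V (up (punch c l) x ℕ.+ suc a) x k (λ w → ind (not (has c (x ∷ w))) * h (x ∷ w)))
    (ℕₚ.m≤n⇒m≤1+n c≤)
    (V-zero _ c k λ w _ → trans (cong (λ b → ind (not (b ∨ has c w)) * h (c ∷ w)) (≡ᵇ-refl c)) (*-zeroˡ _)))
  (∑-cong′ (suc (suc a)) λ x → trans
    (V-cong′ _ (punch c x) k λ w → cong (λ b → ind (not (b ∨ has c w)) * h (punch c x ∷ w)) (punch-missed c x))
    (trans (cong (λ b → V b (punch c x) k (λ w → ind (not (has c w)) * h (punch c x ∷ w)))
              (trans (ℕₚ.+-suc (up (punch c l) (punch c x)) a)
                (cong (λ b → suc ((if b then 1 else 0) ℕ.+ a)) (punch-< c l x))))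
      (V-punch c (up l x ℕ.+ a) x k (λ w → h (punch c x ∷ w)) (ℕₚ.≤-trans c≤ (s≤s (ℕₚ.m≤n+m a _))))))

V-punch-below : ∀ μ x k (h : List ℕ → ℤ) → x ℕ.< suc μ →
  V (suc μ) x k (λ w → ind (not (has (suc μ) (x ∷ w))) * h (x ∷ w)) ≡ V μ x k (λ w → h (map (punch (suc μ)) (x ∷ w)))
V-punch-below μ x k h x< = begin
  V (suc μ) x k (λ w → ind (not (has (suc μ) (x ∷ w))) * h (x ∷ w))
    ≡⟨ V-cong′ (suc μ) x k (λ w → cong₂ (λ b z → ind (not (b ∨ has (suc μ) w)) * h (z ∷ w)) (<⇒≢ᵇ x<) (sym below)) ⟩
  V (suc μ) x k (λ w → ind (not (has (suc μ) w)) * h (punch (suc μ) x ∷ w))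
    ≡⟨ cong (λ z → V (suc μ) z k (λ w → ind (not (has (suc μ) w)) * h (punch (suc μ) x ∷ w))) (sym below) ⟩
  V (suc μ) (punch (suc μ) x) k (λ w → ind (not (has (suc μ) w)) * h (punch (suc μ) x ∷ w))
    ≡⟨ V-punch (suc μ) μ x k (λ w → h (punch (suc μ) x ∷ w)) ℕₚ.≤-refl ⟩
  V μ x k (λ w → h (map (punch (suc μ)) (x ∷ w))) ∎
  where
  open ≡-Reasoning
  below : punch (suc μ) x ≡ x
  below = punch-below (suc μ) x x<

-- Sums over the tails x ∷ w, with k + 1 letters, that follow the maximals 0, …, μ.
𝒯 : ℕ → ℕ → (List ℕ → ℤ) → ℤ
𝒯 μ k g = ∑ (suc μ) λ x → V μ x k (λ w → g (x ∷ w))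

𝒯-cong : ∀ μ k {g h} → (∀ T → g T ≡ h T) → 𝒯 μ k g ≡ 𝒯 μ k h
𝒯-cong μ k eq = ∑-cong′ (suc μ) λ x → V-cong′ μ x k λ w → eq (x ∷ w)

𝒯-+ : ∀ μ k g h → 𝒯 μ k (λ w → g w + h w) ≡ 𝒯 μ k g + 𝒯 μ k h
𝒯-+ μ k g h = trans (∑-cong′ (suc μ) λ x → V-+ μ x k (λ w → g (x ∷ w)) (λ w → h (x ∷ w)))
  (∑-+ (suc μ) (λ x → V μ x k (λ w → g (x ∷ w))) (λ x → V μ x k (λ w → h (x ∷ w))))

𝒯-*ˡ : ∀ μ k c g → 𝒯 μ k (λ w → c * g w) ≡ c * 𝒯 μ k g
𝒯-*ˡ μ k c g = trans (∑-cong′ (suc μ) λ x → V-*ˡ μ x k c (λ w → g (x ∷ w)))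
  (∑-*ˡ c (suc μ) (λ x → V μ x k (λ w → g (x ∷ w))))

𝒯-punch : ∀ c μ k (h : List ℕ → ℤ) → c ℕ.≤ suc μ → 𝒯 (suc μ) k (λ w → ind (not (has c w)) * h w) ≡ 𝒯 μ k (h ∘ map (punch c))
𝒯-punch c μ k h c≤ = trans
  (∑-punch (suc μ) c (λ x → V (suc μ) x k (λ w → ind (not (has c (x ∷ w))) * h (x ∷ w))) c≤
    (V-zero _ c k λ w _ → trans (cong (λ b → ind (not (b ∨ has c w)) * h (c ∷ w)) (≡ᵇ-refl c)) (*-zeroˡ _)))
  (∑-cong′ (suc μ) λ x → trans
    (V-cong′ _ (punch c x) k λ w → cong (λ b → ind (not (b ∨ has c w)) * h (punch c x ∷ w)) (punch-missed c x))
    (V-punch c μ x k (λ w → h (punch c x ∷ w)) c≤))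

^-+ : ∀ x m n → x ^ (m ℕ.+ n) ≡ x ^ m * x ^ n
^-+ x zero    n = sym (*-identityˡ _)
^-+ x (suc m) n = trans (cong (x *_) (^-+ x m n)) (lemma _ _ _)
  where
  opaque
    unfolding _+_
    lemma : ∀ x y z → x * (y * z) ≡ x * y * z
    lemma = solve-∀

-- The sequence h delayed by d, that is, a generating function times the d-th power of its variable.
-- It converts sums indexed by tail length into sums indexed by total length.
lag : ℕ → (ℕ → ℤ) → ℕ → ℤ
lag zero    h n       = h n
lag (suc d) h zero    = 0ℤ
lag (suc d) h (suc n) = lag d h n

lag-cong : ∀ d {g h} → (∀ k → g k ≡ h k) → ∀ n → lag d g n ≡ lag d h n
lag-cong zero    eq n       = eq n
lag-cong (suc d) eq zero    = refl
lag-cong (suc d) eq (suc n) = lag-cong d eq n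

lag-< : ∀ d h n → n ℕ.< d → lag d h n ≡ 0ℤ
lag-< (suc d) h zero    _         = refl
lag-< (suc d) h (suc n) (s≤s n<d) = lag-< d h n n<d

lag-zero : ∀ d h n → (∀ k → n ≡ d ℕ.+ k → h k ≡ 0ℤ) → lag d h n ≡ 0ℤ
lag-zero zero    h n       z = z n refl
lag-zero (suc d) h zero    z = refl
lag-zero (suc d) h (suc n) z = lag-zero d h n λ k eq → z k (cong suc eq)

lag-+ : ∀ d g h n → lag d (λ k → g k + h k) n ≡ lag d g n + lag d h n
lag-+ zero    g h n       = refl
lag-+ (suc d) g h zero    = sym (+-identityˡ 0ℤ)
lag-+ (suc d) g h (suc n) = lag-+ d g h n

lag-*ˡ : ∀ d c g n → lag d (λ k → c * g k) n ≡ c * lag d g n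
lag-*ˡ zero    c g n       = refl
lag-*ˡ (suc d) c g zero    = sym (*-zeroʳ c)
lag-*ˡ (suc d) c g (suc n) = lag-*ˡ d c g n

lag-∑ : ∀ d m (g : ℕ → ℕ → ℤ) n → lag d (λ k → ∑ m (λ i → g i k)) n ≡ ∑ m (λ i → lag d (g i) n)
lag-∑ zero    m g n       = refl
lag-∑ (suc d) m g zero    = sym (∑-zero m λ _ _ → refl)
lag-∑ (suc d) m g (suc n) = lag-∑ d m g n

lag-∑-* : ∀ d m (c : ℕ → ℤ) (g : ℕ → ℕ → ℤ) n →
  lag d (λ k → ∑ m (λ i → c i * g i k)) n ≡ ∑ m (λ i → c i * lag d (g i) n)
lag-∑-* d m c g n = trans (lag-∑ d m (λ i k → c i * g i k) n) (∑-cong′ m λ i → lag-*ˡ d (c i) (g i) n)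

prev-lag : ∀ d h n → prev (lag d h) n ≡ lag (suc d) h n
prev-lag d h zero    = refl
prev-lag d h (suc n) = refl

lag-step : ∀ d h g s → h 0 ≡ s 0 → (∀ k → h (suc k) ≡ g k + s (suc k)) →
  ∀ n → lag d h n ≡ lag (suc d) g n + lag d s n
lag-step zero    h g s h0 hs zero    = trans h0 (sym (+-identityˡ _))
lag-step zero    h g s h0 hs (suc n) = hs n
lag-step (suc d) h g s h0 hs zero    = sym (+-identityˡ 0ℤ)
lag-step (suc d) h g s h0 hs (suc n) = lag-step d h g s h0 hs n

has-0⇒¬allGreater : ∀ z T → has 0 T ≡ true → allGreater z T ≡ false
has-0⇒¬allGreater z       (zero ∷ T)  _  = refl
has-0⇒¬allGreater z       (suc x ∷ T) eq with z <ᵇ suc x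
... | true  = has-0⇒¬allGreater z T eq
... | false = refl

has-0⇒¬allGE : ∀ e T → has 0 T ≡ true → allGE (suc e) T ≡ false
has-0⇒¬allGE e (zero ∷ T)  _  = refl
has-0⇒¬allGE e (suc x ∷ T) eq with x <ᵇ e
... | true  = refl
... | false = has-0⇒¬allGE e T eq

allGE-0 : ∀ T → allGE 0 T ≡ true
allGE-0 []      = refl
allGE-0 (x ∷ T) = allGE-0 T

¬has-0⇒allGreater-0 : ∀ T → has 0 T ≡ false → allGreater 0 T ≡ true
¬has-0⇒allGreater-0 []          eq = refl
¬has-0⇒allGreater-0 (suc x ∷ T) eq = ¬has-0⇒allGreater-0 T eq

has-0⇒zs : ∀ T → has 0 T ≡ true → ∃ λ z → zs T ≡ suc z
has-0⇒zs (zero ∷ T)  eq = zs T , refl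
has-0⇒zs (suc x ∷ T) eq = has-0⇒zs T eq

¬has-0⇒zs : ∀ T → has 0 T ≡ false → zs T ≡ 0
¬has-0⇒zs []          eq = refl
¬has-0⇒zs (suc x ∷ T) eq = ¬has-0⇒zs T eq

pred-1⊔ : ∀ j → pred (1 ⊔ j) ≡ pred j
pred-1⊔ zero          = refl
pred-1⊔ (suc zero)    = refl
pred-1⊔ (suc (suc j)) = refl

pred-bump : ∀ j → pred (bump j) ≡ j
pred-bump zero    = refl
pred-bump (suc j) = refl

rr≤length : ∀ T → rr T ℕ.≤ length T
rr≤length []      = z≤n
rr≤length (x ∷ T) with allGreater x T
... | true  = s≤s (rr≤length T)
... | false = ℕₚ.m≤n⇒m≤1+n (rr≤length T)

rr-∷ : ∀ x T → ∃ λ j → rr (x ∷ T) ≡ suc j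
rr-∷ x []      = 0 , refl
rr-∷ x (z ∷ T) with allGreater x (z ∷ T)
... | true  = rr (z ∷ T) , refl
... | false = rr-∷ z T

<⇒≢ᵇ′ : ∀ {x c} → x ℕ.< c → (x ≡ᵇ c) ≡ false
<⇒≢ᵇ′ {zero}  {suc c} _         = refl
<⇒≢ᵇ′ {suc x} {suc c} (s≤s x<c) = <⇒≢ᵇ′ x<c

-- Weighted sums over tails solve the system

module Tails (t y : ℤ) where
  open Transfer t y
  open ≡-Reasoning

  wt : ℕ → List ℕ → ℤ
  wt m T = t ^ ρ m T * y ^ asc T

  cls : ℕ → ℕ → List ℕ → ℤ
  cls r q T = ind (rr T ≡ᵇ r) * ind (pred (qd T) ≡ᵇ q)

  -- When T contains a zero, no initial maximal is a right-to-left minimum, and among them only the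
  -- leading 0 can affect `qd`, by an amount that `pred` hides. So T alone determines rmin and rpos.
  -- The exponent of v is zero - 2, as one zero precedes T; the factor y^μ of the initial ascents is
  -- kept outside.
  φ : ℤ → ℕ → ℕ → ℕ → List ℕ → ℤ
  φ v m r q T = ind (has 0 T) * (cls r q T * (wt m T * v ^ (zs T ∸ 1)))

  -- T is what follows the second and last zero when that zero is the ealm: the boundary case.
  χ : ℕ → ℕ → ℕ → List ℕ → ℤ
  χ m r q T = ind (not (has 0 T)) * (cls r q (0 ∷ T) * wt m (0 ∷ T))

  -- Graded by `qd` rather than its predecessor: when the letters are raised and a zero is put in
  -- front, `qd` becomes `bump (qd T)`, whose predecessor, the new rpos, is `qd T` itself.
  θ : ℕ → ℕ → ℕ → List ℕ → ℤ
  θ m r q T = ind (has 0 T) * (ind (rr T ≡ᵇ r) * ind (qd T ≡ᵇ q) * wt m T)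

  f : ℤ → ℕ → ℕ → ℕ → ℕ → ℕ → ℤ
  f v μ e r q k = y ^ μ * V μ e k (λ w → φ v (suc μ) r q (e ∷ w))

  κ : ℕ → ℕ → ℕ → ℕ → ℤ
  κ μ r q k = y ^ μ * V μ 0 k (χ (suc μ) r q)

  𝒜 : ℕ → ℕ → ℕ → ℕ → ℤ
  𝒜 μ r q k = y ^ μ * 𝒯 μ k (θ (suc μ) r q)

  -- If a zero remains behind e, then e is no right-to-left minimum, and it can alter `qd` only when
  -- e = 0, where `pred` hides the change. So rmin and rpos survive the loss of e. If no zero
  -- remains, only e = 0 contributes, and it gives the boundary term.
  φ-∷ : ∀ v m r q e x w → e ℕ.< m → φ v m r q (e ∷ x ∷ w) ≡
    δ v e * (t * (y ^ up e x * φ v m r q (x ∷ w))) + ζ e * χ m r q (x ∷ w)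
  φ-∷ v m r q zero x w e<m with has 0 (x ∷ w) in eq
  ... | true rewrite has-0⇒¬allGreater 0 (x ∷ w) eq | allGE-0 (x ∷ w) | pred-1⊔ (qd (x ∷ w))
                   | <⇒<ᵇ≡true e<m | proj₂ (has-0⇒zs (x ∷ w) eq) | ^-+ y (up 0 x) (asc (x ∷ w)) = lemma _ _ _ _ _ _ _ _
    where
    opaque
      unfolding _+_
      lemma : ∀ c t s y z v u d → 1ℤ * (c * (t * s * (y * z) * (v * u))) ≡ v * (t * (y * (1ℤ * (c * (s * z * u))))) + 1ℤ * (0ℤ * d)
      lemma = solve-∀
  ... | false rewrite ¬has-0⇒zs (x ∷ w) eq = lemma _ _ _ _ _ _
    where
    opaque
      unfolding _+_
      lemma : ∀ c d v t y e → 1ℤ * (c * (d * 1ℤ)) ≡ v * (t * (y * (0ℤ * e))) + 1ℤ * (1ℤ * (c * d))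
      lemma = solve-∀
  φ-∷ v m r q (suc e) x w e<m with has 0 (x ∷ w) in eq
  ... | true rewrite has-0⇒¬allGreater (suc e) (x ∷ w) eq | has-0⇒¬allGE e (x ∷ w) eq
                   | <⇒<ᵇ≡true e<m | ^-+ y (up (suc e) x) (asc (x ∷ w)) = lemma _ _ _ _ _ _ _
    where
    opaque
      unfolding _+_
      lemma : ∀ c t s y z u d → 1ℤ * (c * (t * s * (y * z) * u)) ≡ 1ℤ * (t * (y * (1ℤ * (c * (s * z * u))))) + 0ℤ * d
      lemma = solve-∀
  ... | false = lemma _ _ _ _ _
    where
    opaque
      unfolding _+_
      lemma : ∀ c t y e d → 0ℤ * c ≡ 1ℤ * (t * (y * (0ℤ * e))) + 0ℤ * d
      lemma = solve-∀

  -- Once m is among the initial maximals, an occurrence of m in T costs one more repetition, which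
  -- absorbs the factor t. The second summand corrects for tails without m.
  t^ρ-suc : ∀ m T → t * t ^ ρ m T ≡ t ^ ρ (suc m) T + (t - 1ℤ) * (ind (not (has m T)) * t ^ ρ (suc m) T)
  t^ρ-suc m T rewrite ρ-suc m T with has m T
  ... | true  = lemma _ _
    where
    opaque
      unfolding _+_
      lemma : ∀ t s → t * s ≡ t * s + (t - 1ℤ) * (0ℤ * (t * s))
      lemma = solve-∀
  ... | false = lemma _ _
    where
    opaque
      unfolding _+_
      lemma : ∀ t s → t * s ≡ s + (t - 1ℤ) * (1ℤ * s)
      lemma = solve-∀

  φ-suc : ∀ v m r q T → t * φ v m r q T ≡
    φ v (suc m) r q T + (t - 1ℤ) * (ind (not (has m T)) * φ v (suc m) r q T)
  φ-suc v m r q T = trans (l₁ _ _ _ _ _ _) (trans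
    (cong (λ z → ind (has 0 T) * (cls r q T * (z * y ^ asc T * v ^ (zs T ∸ 1)))) (t^ρ-suc m T)) (l₂ _ _ _ _ _ _ _))
    where
    opaque
      unfolding _+_
      l₁ : ∀ t i c s z u → t * (i * (c * (s * z * u))) ≡ i * (c * (t * s * z * u))
      l₁ = solve-∀
      l₂ : ∀ t h i c s z u → i * (c * ((s + (t - 1ℤ) * (h * s)) * z * u))
        ≡ i * (c * (s * z * u)) + (t - 1ℤ) * (h * (i * (c * (s * z * u))))
      l₂ = solve-∀

  φ-punch : ∀ v m r q c T → c ℕ.< m → φ v (suc m) r q (map (punch (suc c)) T) ≡ φ v m r q T
  φ-punch v m r q c T c<m rewrite has-0-punch c T | rr-punch (suc c) T | qd-punch (suc c) T
    | ρ-punch (suc c) m T c<m | asc-punch (suc c) T | zs-punch c T = refl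

  -- The correction of `t^ρ-suc` concerns tails that miss suc μ; closing the gap places them behind
  -- one maximal less. This is the source of the factor t - 1 in `a`; the factor y is the ascent
  -- lost with that maximal.
  raise : ∀ v μ r q x k → x ℕ.< suc μ →
    t * V (suc μ) x k (λ w → φ v (suc μ) r q (x ∷ w)) ≡
    V (suc μ) x k (λ w → φ v (suc (suc μ)) r q (x ∷ w)) + (t - 1ℤ) * V μ x k (λ w → φ v (suc μ) r q (x ∷ w))
  raise v μ r q x k x< = begin
    t * V (suc μ) x k (λ w → φ v (suc μ) r q (x ∷ w))
      ≡⟨ V-*ˡ (suc μ) x k t (λ w → φ v (suc μ) r q (x ∷ w)) ⟨
    V (suc μ) x k (λ w → t * φ v (suc μ) r q (x ∷ w))
      ≡⟨ V-cong′ (suc μ) x k (λ w → φ-suc v (suc μ) r q (x ∷ w)) ⟩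
    V (suc μ) x k (λ w → φ v (suc (suc μ)) r q (x ∷ w)
      + (t - 1ℤ) * (ind (not (has (suc μ) (x ∷ w))) * φ v (suc (suc μ)) r q (x ∷ w)))
      ≡⟨ V-+ (suc μ) x k _ _ ⟩
    _ ≡⟨ cong (λ z → V (suc μ) x k (λ w → φ v (suc (suc μ)) r q (x ∷ w)) + z)
           (V-*ˡ (suc μ) x k (t - 1ℤ) (λ w → ind (not (has (suc μ) (x ∷ w))) * φ v (suc (suc μ)) r q (x ∷ w))) ⟩
    _ ≡⟨ cong (λ z → V (suc μ) x k (λ w → φ v (suc (suc μ)) r q (x ∷ w)) + (t - 1ℤ) * z)
           (trans (V-punch-below μ x k (φ v (suc (suc μ)) r q) x<)
                  (V-cong′ μ x k λ w → φ-punch v (suc μ) r q μ (x ∷ w) ℕₚ.≤-refl)) ⟩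
    _ ∎

  -- A tail that begins with suc μ does contain this value, so there is no correction. Hence the `α`
  -- sum in `T` is one term shorter than the `β` sum.
  raise-last : ∀ v μ r q k →
    t * V (suc μ) (suc μ) k (λ w → φ v (suc μ) r q (suc μ ∷ w)) ≡
    V (suc μ) (suc μ) k (λ w → φ v (suc (suc μ)) r q (suc μ ∷ w))
  raise-last v μ r q k = begin
    t * V (suc μ) (suc μ) k (λ w → φ v (suc μ) r q (suc μ ∷ w))
      ≡⟨ V-*ˡ (suc μ) (suc μ) k t (λ w → φ v (suc μ) r q (suc μ ∷ w)) ⟨
    V (suc μ) (suc μ) k (λ w → t * φ v (suc μ) r q (suc μ ∷ w))
      ≡⟨ V-cong′ (suc μ) (suc μ) k (λ w → trans (φ-suc v (suc μ) r q (suc μ ∷ w))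
           (trans (cong (λ b → φ v (suc (suc μ)) r q (suc μ ∷ w) + (t - 1ℤ) * (ind (not (b ∨ has (suc μ) w))
               * φ v (suc (suc μ)) r q (suc μ ∷ w))) (≡ᵇ-refl μ))
             (lemma _ _))) ⟩
    V (suc μ) (suc μ) k (λ w → φ v (suc (suc μ)) r q (suc μ ∷ w)) ∎
    where
    opaque
      unfolding _+_
      lemma : ∀ x t → x + t * (0ℤ * x) ≡ x
      lemma = solve-∀

  f-zero : ∀ v μ e r q → f v μ e r q 0 ≡ ζ e * κ μ r q 0
  f-zero v μ zero r q = lemma _ _ _
    where
    opaque
      unfolding _+_
      lemma : ∀ p c w → p * (1ℤ * (c * (w * 1ℤ))) ≡ 1ℤ * (p * (1ℤ * (c * w)))
      lemma = solve-∀
  f-zero v μ (suc e) r q = lemma _ _ _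
    where
    opaque
      unfolding _+_
      lemma : ∀ p c d → p * (0ℤ * c) ≡ 0ℤ * d
      lemma = solve-∀

  f-suc : ∀ v μ e r q k → e ℕ.< suc μ → f v μ e r q (suc k) ≡
    (∑ (suc μ) (λ x → α v e x * f v μ x r q k) + ∑ (suc (suc μ)) (λ x → β v e x * f v (suc μ) x r q k))
      + ζ e * κ μ r q (suc k)
  f-suc v μ e r q k e< = begin
    y ^ μ * ∑ (suc (suc μ)) (λ x → V (up e x ℕ.+ μ) x k (λ w → φ v (suc μ) r q (e ∷ x ∷ w)))
      ≡⟨ ∑-*ˡ (y ^ μ) (suc (suc μ)) (λ x → V (up e x ℕ.+ μ) x k (λ w → φ v (suc μ) r q (e ∷ x ∷ w))) ⟨
    ∑ (suc (suc μ)) (λ x → y ^ μ * V (up e x ℕ.+ μ) x k (λ w → φ v (suc μ) r q (e ∷ x ∷ w)))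
      ≡⟨ ∑-cong′ (suc (suc μ)) (λ x → trans (cong (λ z → y ^ μ * z) (expand x)) (l₁ _ _ _ _)) ⟩
    ∑ (suc (suc μ)) (λ x → main x + ζ e * rest x)
      ≡⟨ ∑-+ (suc (suc μ)) main (λ x → ζ e * rest x) ⟩
    ∑ (suc (suc μ)) main + ∑ (suc (suc μ)) (λ x → ζ e * rest x)
      ≡⟨ cong₂ _+_
           (∑-split-last (suc μ) (λ x → α v e x * f v μ x r q k) (λ x → β v e x * f v (suc μ) x r q k) main-step main-last)
           rest-sum ⟩
    _ ∎
    where
    v′ : ℕ → ℤ
    v′ x = V (up e x ℕ.+ μ) x k (λ w → φ v (suc μ) r q (x ∷ w))
    main rest : ℕ → ℤ
    main x = y ^ μ * (δ v e * (t * (y ^ up e x * v′ x)))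
    rest x = y ^ μ * V (up e x ℕ.+ μ) x k (λ w → χ (suc μ) r q (x ∷ w))
    opaque
      unfolding _+_
      l₁ : ∀ p d z c → p * (d + z * c) ≡ p * d + z * (p * c)
      l₁ = solve-∀
      l₂ : ∀ p d t s → p * (d * (t * (1ℤ * s))) ≡ d * t * (p * s) + d * 0ℤ
      l₂ = solve-∀
      l₃ : ∀ p d y t z → p * (d * (t * (y * 1ℤ * z))) ≡ d * (y * p * (t * z))
      l₃ = solve-∀
      l₄ : ∀ p d y t s z → d * (y * p * (s + (t - 1ℤ) * z)) ≡ d * ((t - 1ℤ) * y) * (p * z) + d * 1ℤ * (y * p * s)
      l₄ = solve-∀
      l₅ : ∀ p d y z → d * (y * p * z) ≡ d * 1ℤ * (y * p * z)
      l₅ = solve-∀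
      l₆ : ∀ d s → d * 0ℤ ≡ d * 0ℤ * s
      l₆ = solve-∀
    expand : ∀ x → V (up e x ℕ.+ μ) x k (λ w → φ v (suc μ) r q (e ∷ x ∷ w)) ≡
      δ v e * (t * (y ^ up e x * v′ x)) + ζ e * V (up e x ℕ.+ μ) x k (λ w → χ (suc μ) r q (x ∷ w))
    expand x = begin
      V b x k (λ w → φ v (suc μ) r q (e ∷ x ∷ w))
        ≡⟨ V-cong′ b x k (λ w → φ-∷ v (suc μ) r q e x w e<) ⟩
      V b x k (λ w → δ v e * (t * (y ^ up e x * φ v (suc μ) r q (x ∷ w))) + ζ e * χ (suc μ) r q (x ∷ w))
        ≡⟨ V-+ b x k _ _ ⟩
      _ ≡⟨ cong₂ _+_
            (trans (V-*ˡ b x k (δ v e) (λ w → t * (y ^ up e x * φ v (suc μ) r q (x ∷ w))))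
              (cong (δ v e *_) (trans (V-*ˡ b x k t (λ w → y ^ up e x * φ v (suc μ) r q (x ∷ w)))
                (cong (t *_) (V-*ˡ b x k (y ^ up e x) (λ w → φ v (suc μ) r q (x ∷ w)))))))
            (V-*ˡ b x k (ζ e) (λ w → χ (suc μ) r q (x ∷ w))) ⟩
      _ ∎
      where b = up e x ℕ.+ μ
    -- For x ≤ e the letter e is simply deleted. For x > e the ascent from e to x plays the role of
    -- the ascent to a new maximal, so the sum already has the ascent count suc μ and `raise`
    -- applies.
    main-step : ∀ x → x ℕ.< suc μ → main x ≡ α v e x * f v μ x r q k + β v e x * f v (suc μ) x r q k
    main-step x x< with e <ᵇ x
    ... | false = trans (l₂ _ _ _ _) (cong (λ z → δ v e * t * f v μ x r q k + z) (l₆ _ _))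
    ... | true  = trans (l₃ _ _ _ _ _) (trans (cong (λ z → δ v e * (y * y ^ μ * z)) (raise v μ r q x k x<)) (l₄ _ _ _ _ _ _))
    main-last : main (suc μ) ≡ β v e (suc μ) * f v (suc μ) (suc μ) r q k
    main-last rewrite <⇒<ᵇ≡true e< =
      trans (l₃ _ _ _ _ _) (trans (cong (λ z → δ v e * (y * y ^ μ * z)) (raise-last v μ r q k)) (l₅ _ _ _ _))
    rest-sum : ∑ (suc (suc μ)) (λ x → ζ e * rest x) ≡ ζ e * κ μ r q (suc k)
    rest-sum = trans (∑-*ˡ (ζ e) (suc (suc μ)) rest) (trans
      (cong (ζ e *_) (∑-*ˡ (y ^ μ) (suc (suc μ)) (λ x → V (up e x ℕ.+ μ) x k (λ w → χ (suc μ) r q (x ∷ w)))))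
      (only-0 e))
      where
      only-0 : ∀ e → ζ e * (y ^ μ * ∑ (suc (suc μ)) (λ x → V (up e x ℕ.+ μ) x k (λ w → χ (suc μ) r q (x ∷ w))))
        ≡ ζ e * κ μ r q (suc k)
      only-0 zero    = refl
      only-0 (suc e) = trans (*-zeroˡ _) (sym (*-zeroˡ _))

  ψ : ℕ → ℕ → ℕ → List ℕ → ℤ
  ψ m r q T = ind (rr T ≡ᵇ r) * ind (qd T ≡ᵇ q) * (t * t ^ ρ m T * y ^ asc T)

  -- Behind the last zero all letters are positive, and lowering them gives a tail behind 0, ..., μ.
  -- Repetitions, however, are counted against the lowered maximals 0, ..., μ - 1, which is why `ψ`
  -- appears with `ρ μ` and not with the `ρ (suc μ)` of `θ`. The factor t pays for the second zero,
  -- the outer y for the ascent that leaves it.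
  κ-suc : ∀ μ r q k → κ μ (suc r) q (suc k) ≡ y * (y ^ μ * 𝒯 μ k (ψ μ r q))
  κ-suc μ r q k = begin
    y ^ μ * (V μ 0 k (λ w → χ (suc μ) (suc r) q (0 ∷ w)) + ∑ (suc μ) (λ x → V (suc μ) (suc x) k (λ w → χ (suc μ) (suc r) q (suc x ∷ w))))
      ≡⟨ cong₂ (λ a b → y ^ μ * (a + b)) (V-zero μ 0 k λ w _ → *-zeroˡ _) (∑-cong′ (suc μ) positive) ⟩
    y ^ μ * (0ℤ + ∑ (suc μ) (λ x → y * V μ x k (λ w → ψ μ r q (x ∷ w))))
      ≡⟨ cong (y ^ μ *_) (trans (+-identityˡ _) (∑-*ˡ y (suc μ) (λ x → V μ x k (λ w → ψ μ r q (x ∷ w))))) ⟩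
    y ^ μ * (y * 𝒯 μ k (ψ μ r q)) ≡⟨ exchange _ _ _ ⟩
    y * (y ^ μ * 𝒯 μ k (ψ μ r q)) ∎
    where
    opaque
      unfolding _+_
      exchange : ∀ p y z → p * (y * z) ≡ y * (p * z)
      exchange = solve-∀
      l : ∀ y c s z → c * (s * (y * 1ℤ * z)) ≡ y * (c * (s * z))
      l = solve-∀
    χ₀ : List ℕ → ℤ
    χ₀ T = cls (suc r) q (0 ∷ T) * wt (suc μ) (0 ∷ T)
    χ₀-suc : ∀ x w → χ₀ (map suc (x ∷ w)) ≡ y * ψ μ r q (x ∷ w)
    χ₀-suc x w rewrite allGreater-0-suc (x ∷ w) | rr-punch 0 (x ∷ w) | qd-punch 0 (x ∷ w)
      | pred-bump (qd (x ∷ w)) | ρ-punch 0 μ (x ∷ w) z≤n | asc-punch 0 (x ∷ w) = lemma _ _ _ _ _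
      where
      opaque
        unfolding _+_
        lemma : ∀ c t s y z → c * (t * s * (y * z)) ≡ y * (c * (t * s * z))
        lemma = solve-∀
    positive : ∀ x → V (suc μ) (suc x) k (λ w → χ (suc μ) (suc r) q (suc x ∷ w)) ≡ y * V μ x k (λ w → ψ μ r q (x ∷ w))
    positive x = begin
      V (suc μ) (suc x) k (λ w → ind (not (has 0 w)) * χ₀ (suc x ∷ w))
        ≡⟨ V-punch 0 μ x k (λ w → χ₀ (suc x ∷ w)) z≤n ⟩
      V μ x k (λ w → χ₀ (map suc (x ∷ w)))
        ≡⟨ V-cong′ μ x k (χ₀-suc x) ⟩
      V μ x k (λ w → y * ψ μ r q (x ∷ w))
        ≡⟨ V-*ˡ μ x k y (λ w → ψ μ r q (x ∷ w)) ⟩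
      y * V μ x k (λ w → ψ μ r q (x ∷ w)) ∎

  𝒯-split-0 : ∀ μ k g → 𝒯 μ k g ≡ 𝒯 μ k (λ T → ind (not (has 0 T)) * g T) + 𝒯 μ k (λ T → ind (has 0 T) * g T)
  𝒯-split-0 μ k g = trans (𝒯-cong μ k λ T → split (has 0 T) (g T))
    (𝒯-+ μ k (λ T → ind (not (has 0 T)) * g T) (λ T → ind (has 0 T) * g T))
    where
    split : ∀ b z → z ≡ ind (not b) * z + ind b * z
    split true  = solve₁
      where
      opaque
        unfolding _+_
        solve₁ : ∀ z → z ≡ 0ℤ * z + 1ℤ * z
        solve₁ = solve-∀
    split false = solve₂
      where
      opaque
        unfolding _+_
        solve₂ : ∀ z → z ≡ 1ℤ * z + 0ℤ * z
        solve₂ = solve-∀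

  ψ-punch-0 : ∀ μ r q T → ψ (suc μ) r q (map suc T) ≡ ψ μ r q T
  ψ-punch-0 μ r q T rewrite rr-punch 0 T | qd-punch 0 T | ρ-punch 0 μ T z≤n | asc-punch 0 T = refl

  ψ-has-0 : ∀ μ r q T → ind (has 0 T) * ψ μ r q T ≡
    θ (suc μ) r q T + (t - 1ℤ) * (ind (not (has μ T)) * θ (suc μ) r q T)
  ψ-has-0 μ r q T = trans (cong (λ z → ind (has 0 T) * (ind (rr T ≡ᵇ r) * ind (qd T ≡ᵇ q) * (z * y ^ asc T))) (t^ρ-suc μ T))
    (lemma _ _ _ _ _ _)
    where
    opaque
      unfolding _+_
      lemma : ∀ i c s u n z → i * (c * ((s + u * (n * s)) * z)) ≡ i * (c * (s * z)) + u * (n * (i * (c * (s * z))))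
      lemma = solve-∀

  θ-punch : ∀ m r q c T → c ℕ.< m → θ (suc m) r q (map (punch (suc c)) T) ≡ θ m r q T
  θ-punch m r q c T c<m rewrite has-0-punch c T | rr-punch (suc c) T | qd-punch (suc c) T
    | ρ-punch (suc c) m T c<m | asc-punch (suc c) T = refl

  -- Behind the single maximal 0 the lowered tail has to begin with 0. It therefore has a zero and
  -- contains the value μ = 0, so that neither K nor the correction `a` appears.
  κ-step-0 : ∀ r q k → κ 0 (suc r) q (suc k) ≡ y * 𝒜 0 r q k
  κ-step-0 r q k = begin
    κ 0 (suc r) q (suc k) ≡⟨ κ-suc 0 r q k ⟩
    y * (1ℤ * (V 0 0 k (λ w → ψ 0 r q (0 ∷ w)) + 0ℤ))
      ≡⟨ cong (λ z → y * (1ℤ * (z + 0ℤ))) (V-cong′ 0 0 k λ w → trans (l₁ _)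
           (trans (ψ-has-0 0 r q (0 ∷ w)) (l₂ _ _))) ⟩
    y * 𝒜 0 r q k ∎
    where
    opaque
      unfolding _+_
      l₁ : ∀ x → x ≡ 1ℤ * x
      l₁ = solve-∀
      l₂ : ∀ x t → x + t * (0ℤ * x) ≡ x
      l₂ = solve-∀

  -- A lowered tail without zero can be lowered once more, which leads to K with one maximal less.
  -- For a lowered tail with a zero, `t^ρ-suc` moves the index of ρ to the one in `θ`, and closing
  -- the gap gives the correction, as in `raise`.
  κ-step : ∀ μ r q k → κ (suc μ) (suc r) q (suc k) ≡
    y * κ μ (suc r) q (suc k) + y * (𝒜 (suc μ) r q k + a * 𝒜 μ r q k)
  κ-step μ r q k = begin
    κ (suc μ) (suc r) q (suc k) ≡⟨ κ-suc (suc μ) r q k ⟩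
    y * (y * y ^ μ * 𝒯 (suc μ) k (ψ (suc μ) r q))
      ≡⟨ cong (λ z → y * (y * y ^ μ * z)) (trans (𝒯-split-0 (suc μ) k (ψ (suc μ) r q)) (cong₂ _+_ without with-0)) ⟩
    y * (y * y ^ μ * (𝒯 μ k (ψ μ r q) + (𝒯 (suc μ) k (θ (suc (suc μ)) r q) + (t - 1ℤ) * 𝒯 μ k (θ (suc μ) r q))))
      ≡⟨ lemma _ _ _ _ _ _ ⟩
    y * (y * (y ^ μ * 𝒯 μ k (ψ μ r q))) + y * (𝒜 (suc μ) r q k + a * 𝒜 μ r q k)
      ≡⟨ cong (λ z → y * z + y * (𝒜 (suc μ) r q k + a * 𝒜 μ r q k)) (κ-suc μ r q k) ⟨
    y * κ μ (suc r) q (suc k) + y * (𝒜 (suc μ) r q k + a * 𝒜 μ r q k) ∎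
    where
    opaque
      unfolding _+_
      lemma : ∀ y p u x z w → y * (y * p * (x + (z + (u - 1ℤ) * w))) ≡ y * (y * (p * x)) + y * (y * p * z + (u - 1ℤ) * y * (p * w))
      lemma = solve-∀
    without : 𝒯 (suc μ) k (λ T → ind (not (has 0 T)) * ψ (suc μ) r q T) ≡ 𝒯 μ k (ψ μ r q)
    without = trans (𝒯-punch 0 μ k (ψ (suc μ) r q) z≤n) (𝒯-cong μ k (ψ-punch-0 μ r q))
    with-0 : 𝒯 (suc μ) k (λ T → ind (has 0 T) * ψ (suc μ) r q T) ≡
      𝒯 (suc μ) k (θ (suc (suc μ)) r q) + (t - 1ℤ) * 𝒯 μ k (θ (suc μ) r q)
    with-0 = begin
      𝒯 (suc μ) k (λ T → ind (has 0 T) * ψ (suc μ) r q T)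
        ≡⟨ 𝒯-cong (suc μ) k (ψ-has-0 (suc μ) r q) ⟩
      _ ≡⟨ 𝒯-+ (suc μ) k (θ (suc (suc μ)) r q) (λ T → (t - 1ℤ) * (ind (not (has (suc μ) T)) * θ (suc (suc μ)) r q T)) ⟩
      _ ≡⟨ cong (λ z → 𝒯 (suc μ) k (θ (suc (suc μ)) r q) + z)
             (𝒯-*ˡ (suc μ) k (t - 1ℤ) (λ T → ind (not (has (suc μ) T)) * θ (suc (suc μ)) r q T)) ⟩
      _ ≡⟨ cong (λ z → 𝒯 (suc μ) k (θ (suc (suc μ)) r q) + (t - 1ℤ) * z)
             (trans (𝒯-punch (suc μ) μ k (θ (suc (suc μ)) r q) ℕₚ.≤-refl)
                    (𝒯-cong μ k λ T → θ-punch (suc μ) r q μ T ℕₚ.≤-refl)) ⟩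
      _ ∎

  κ-base : ∀ μ r q → κ (suc μ) r q 0 ≡ y * κ μ r q 0
  κ-base μ r q = lemma _ _ _
    where
    opaque
      unfolding _+_
      lemma : ∀ y p z → y * p * z ≡ y * (p * z)
      lemma = solve-∀

  -- The last zero is the right-to-left minimum of index 0, and this index qualifies exactly if T
  -- has a second zero. So among tails with rpos = 0 the values 0 and 1 of `qd` separate one zero
  -- from several.
  qd-0 : ∀ T → has 0 T ≡ true → (zs T ≡ 1 × (qd T ≡ 0 ⊎ ∃ λ j → qd T ≡ suc (suc j))) ⊎
                                 (∃ λ z → zs T ≡ suc (suc z)) × (∃ λ j → qd T ≡ suc j)
  qd-0 (suc x ∷ T) eq rewrite has-0⇒¬allGreater (suc x) T eq | has-0⇒¬allGE x T eq = qd-0 T eq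
  qd-0 (zero ∷ T)  eq with has 0 T in e
  ... | true rewrite has-0⇒¬allGreater 0 T e | allGE-0 T =
    inj₂ ((proj₁ (has-0⇒zs T e) , cong suc (proj₂ (has-0⇒zs T e))) , 1⊔ (qd T))
    where
    1⊔ : ∀ n → ∃ λ j → 1 ⊔ n ≡ suc j
    1⊔ zero    = 0 , refl
    1⊔ (suc n) = n , refl
  ... | false rewrite ¬has-0⇒allGreater-0 T e | ¬has-0⇒zs T e = inj₁ (refl , bumped (qd T))
    where
    bumped : ∀ n → bump n ≡ 0 ⊎ ∃ λ j → bump n ≡ suc (suc j)
    bumped zero    = inj₁ refl
    bumped (suc n) = inj₂ (n , refl)

  1^ : ∀ n → 1ℤ ^ n ≡ 1ℤ
  1^ zero    = refl
  1^ (suc n) = trans (*-identityˡ _) (1^ n)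

  θ-0 : ∀ m r T → θ m r 0 T ≡ φ 0ℤ m r 0 T
  θ-0 m r T with has 0 T in eq
  ... | false = trans (*-zeroˡ _) (sym (*-zeroˡ _))
  ... | true with qd-0 T eq
  ...   | inj₁ (z , inj₁ q)       rewrite z | q = lemma _ _
    where
    opaque
      unfolding _+_
      lemma : ∀ c w → 1ℤ * (c * 1ℤ * w) ≡ 1ℤ * (c * 1ℤ * (w * 1ℤ))
      lemma = solve-∀
  ...   | inj₁ (z , inj₂ (j , q)) rewrite z | q = lemma _ _
    where
    opaque
      unfolding _+_
      lemma : ∀ c w → 1ℤ * (c * 0ℤ * w) ≡ 1ℤ * (c * 0ℤ * (w * 1ℤ))
      lemma = solve-∀
  ...   | inj₂ ((z , zz) , j , q) rewrite zz | q = lemma _ _ _ _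
    where
    opaque
      unfolding _+_
      lemma : ∀ c w s d → 1ℤ * (c * 0ℤ * w) ≡ 1ℤ * (c * d * (w * (0ℤ * s)))
      lemma = solve-∀

  θ-1 : ∀ m r T → θ m r 0 T + θ m r 1 T ≡ φ 1ℤ m r 0 T
  θ-1 m r T with has 0 T in eq
  ... | false = lemma _ _ _
    where
    opaque
      unfolding _+_
      lemma : ∀ a b c → 0ℤ * a + 0ℤ * b ≡ 0ℤ * c
      lemma = solve-∀
  ... | true rewrite 1^ (zs T ∸ 1) with qd T
  ...   | zero = lemma _ _
    where
    opaque
      unfolding _+_
      lemma : ∀ c w → 1ℤ * (c * 1ℤ * w) + 1ℤ * (c * 0ℤ * w) ≡ 1ℤ * (c * 1ℤ * (w * 1ℤ))
      lemma = solve-∀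
  ...   | suc zero = lemma _ _
    where
    opaque
      unfolding _+_
      lemma : ∀ c w → 1ℤ * (c * 0ℤ * w) + 1ℤ * (c * 1ℤ * w) ≡ 1ℤ * (c * 1ℤ * (w * 1ℤ))
      lemma = solve-∀
  ...   | suc (suc j) = lemma _ _
    where
    opaque
      unfolding _+_
      lemma : ∀ c w → 1ℤ * (c * 0ℤ * w) + 1ℤ * (c * 0ℤ * w) ≡ 1ℤ * (c * 0ℤ * (w * 1ℤ))
      lemma = solve-∀

  θ-2 : ∀ m r q T → θ m r (suc (suc q)) T ≡ φ 1ℤ m r (suc q) T
  θ-2 m r q T rewrite 1^ (zs T ∸ 1) with qd T
  ... | zero        = lemma _ _ _ _
    where
    opaque
      unfolding _+_
      lemma : ∀ i c d w → i * (c * d * w) ≡ i * (c * d * (w * 1ℤ))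
      lemma = solve-∀
  ... | suc j = lemma _ _ _ _
    where
    opaque
      unfolding _+_
      lemma : ∀ i c d w → i * (c * d * w) ≡ i * (c * d * (w * 1ℤ))
      lemma = solve-∀

  -- The index n of the system is one more than the length of the sequences: a
  -- sequence with maximals 0, …, μ and a tail of k + 1 letters has n = μ + k + 3.
  F : ℤ → ℕ → ℕ → ℕ → ℕ → ℕ → ℤ
  F v n zero    e r q = 0ℤ
  F v n (suc μ) e r q = lag (suc (suc (suc μ))) (f v μ e r q) n

  K : ℕ → ℕ → ℕ → ℕ → ℤ
  K n zero    r q = 0ℤ
  K n (suc μ) r q = lag (suc (suc (suc μ))) (κ μ r q) n

  A : ℕ → ℕ → ℕ → ℕ → ℤ
  A n zero    r q = 0ℤ
  A n (suc μ) r q = lag (suc (suc (suc μ))) (𝒜 μ r q) n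

  -- The sequence (0, 0), of weight t, is the shortest one counted by K. It has n = 3 and m = r = 1,
  -- which `K-step` shifts to 1, 0 and 0.
  start : ℕ → ℕ → ℕ → ℤ
  start n m r = ind (n ≡ᵇ 1) * (ind (m ≡ᵇ 0) * (ind (r ≡ᵇ 0) * t))

  F-step : ∀ v n m e r q → e ℕ.< m → F v n m e r q ≡ T v (λ n m x → F v n m x r q) n m e + ζ e * K n m r q
  F-step v n (suc μ) e r q e< = begin
    lag (3 ℕ.+ μ) (f v μ e r q) n
      ≡⟨ lag-step (3 ℕ.+ μ) _ (λ k → below k + above k) (λ k → ζ e * κ μ r q k) (f-zero v μ e r q)
           (λ k → f-suc v μ e r q k e<) n ⟩
    lag (4 ℕ.+ μ) (λ k → below k + above k) n + lag (3 ℕ.+ μ) (λ k → ζ e * κ μ r q k) n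
      ≡⟨ cong₂ _+_ (lag-+ (4 ℕ.+ μ) below above n) (lag-*ˡ (3 ℕ.+ μ) (ζ e) (κ μ r q) n) ⟩
    lag (4 ℕ.+ μ) below n + lag (4 ℕ.+ μ) above n + ζ e * K n (suc μ) r q
      ≡⟨ cong (_+ ζ e * K n (suc μ) r q) (cong₂ _+_
           (trans (lag-∑-* (4 ℕ.+ μ) (suc μ) (α v e) (λ x → f v μ x r q) n)
             (∑-cong′ (suc μ) λ x → cong (α v e x *_) (sym (prev-lag (3 ℕ.+ μ) (f v μ x r q) n))))
           (lag-∑-* (4 ℕ.+ μ) (suc (suc μ)) (β v e) (λ x → f v (suc μ) x r q) n)) ⟩
    _ ∎
    where
    below above : ℕ → ℤ
    below k = ∑ (suc μ) (λ x → α v e x * f v μ x r q k)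
    above k = ∑ (suc (suc μ)) (λ x → β v e x * f v (suc μ) x r q k)

  φ-rr : ∀ v m r q T → (rr T ≡ᵇ r) ≡ false → φ v m r q T ≡ 0ℤ
  φ-rr v m r q T eq rewrite eq = lemma _ _ _
    where
    opaque
      unfolding _+_
      lemma : ∀ i c w → i * (0ℤ * c * w) ≡ 0ℤ
      lemma = solve-∀

  χ-rr : ∀ m r q T → (rr (0 ∷ T) ≡ᵇ r) ≡ false → χ m r q T ≡ 0ℤ
  χ-rr m r q T eq rewrite eq = lemma _ _ _
    where
    opaque
      unfolding _+_
      lemma : ∀ i c w → i * (0ℤ * c * w) ≡ 0ℤ
      lemma = solve-∀

  F-m : ∀ v n m e r q → n ℕ.≤ m → F v n m e r q ≡ 0ℤ
  F-m v n zero    e r q _   = refl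
  F-m v n (suc μ) e r q n≤m = lag-< (3 ℕ.+ μ) (f v μ e r q) n (ℕₚ.≤-trans (s≤s n≤m) (ℕₚ.n≤1+n _))

  small : ∀ {n r μ k j} → n ℕ.≤ r → n ≡ 3 ℕ.+ μ ℕ.+ k → j ℕ.≤ suc k → j ℕ.< r
  small {μ = μ} {k} n≤r refl j≤ = ℕₚ.≤-trans (s≤s j≤) (ℕₚ.≤-trans
    (s≤s (s≤s (ℕₚ.≤-trans (ℕₚ.m≤n+m k μ) (ℕₚ.n≤1+n _)))) n≤r)

  F-r : ∀ v n m e r q → n ℕ.≤ r → F v n m e r q ≡ 0ℤ
  F-r v n zero    e r q _   = refl
  F-r v n (suc μ) e r q n≤r = lag-zero (3 ℕ.+ μ) (f v μ e r q) n λ k n≡ →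
    trans (cong (y ^ μ *_) (V-zero μ e k λ w len → φ-rr v (suc μ) r q (e ∷ w)
      (<⇒≢ᵇ′ (small n≤r n≡ (subst (λ l → rr (e ∷ w) ℕ.≤ suc l) len (rr≤length (e ∷ w))))))) (*-zeroʳ _)

  K-r : ∀ n m r q → n ℕ.≤ r → K n m r q ≡ 0ℤ
  K-r n zero    r q _   = refl
  K-r n (suc μ) r q n≤r = lag-zero (3 ℕ.+ μ) (κ μ r q) n λ k n≡ →
    trans (cong (y ^ μ *_) (V-zero μ 0 k λ w len → χ-rr (suc μ) r q w
      (<⇒≢ᵇ′ (small n≤r n≡ (subst (λ l → rr (0 ∷ w) ℕ.≤ suc l) len (rr≤length (0 ∷ w))))))) (*-zeroʳ _)

  rr≢0 : ∀ x w → (rr (x ∷ w) ≡ᵇ 0) ≡ false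
  rr≢0 x w = cong (_≡ᵇ 0) (proj₂ (rr-∷ x w))

  F-r₀ : ∀ v n m e q → F v n m e 0 q ≡ 0ℤ
  F-r₀ v n zero    e q = refl
  F-r₀ v n (suc μ) e q = lag-zero (3 ℕ.+ μ) (f v μ e 0 q) n λ k _ →
    trans (cong (y ^ μ *_) (V-zero μ e k λ w _ → φ-rr v (suc μ) 0 q (e ∷ w) (rr≢0 e w))) (*-zeroʳ _)

  K-r₀ : ∀ n m q → K n m 0 q ≡ 0ℤ
  K-r₀ n zero    q = refl
  K-r₀ n (suc μ) q = lag-zero (3 ℕ.+ μ) (κ μ 0 q) n λ k _ →
    trans (cong (y ^ μ *_) (V-zero μ 0 k λ w _ → χ-rr (suc μ) 0 q w (rr≢0 0 w))) (*-zeroʳ _)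

  K-n : ∀ n m r q → n ℕ.≤ 2 → K n m r q ≡ 0ℤ
  K-n n zero    r q _   = refl
  K-n n (suc μ) r q n≤2 = lag-< (3 ℕ.+ μ) (κ μ r q) n (ℕₚ.≤-trans (s≤s n≤2) (s≤s (s≤s (s≤s z≤n))))

  start-sym : ∀ n m r → start n m r ≡ start n r m
  start-sym n m r = cong (ind (n ≡ᵇ 1) *_) (lemma _ _ _)
    where
    opaque
      unfolding _+_
      lemma : ∀ x y z → x * (y * z) ≡ y * (x * z)
      lemma = solve-∀

  start-suc : ∀ n m r → start n m (suc r) ≡ 0ℤ
  start-suc n m r = lemma _ _ _
    where
    opaque
      unfolding _+_
      lemma : ∀ x y z → x * (y * (0ℤ * z)) ≡ 0ℤ
      lemma = solve-∀

  K-step : ∀ n m r q → K (suc (suc n)) (suc m) (suc r) q ≡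
    y * K (suc n) m (suc r) q + y * (A (suc n) (suc m) r q + a * A n m r q) + ζ q * start n m r
  K-step zero zero r q = lemma _ _ _ _
    where
    opaque
      unfolding _+_
      lemma : ∀ y a z p → 0ℤ ≡ y * 0ℤ + y * (0ℤ + a * 0ℤ) + z * (0ℤ * p)
      lemma = solve-∀
  K-step (suc zero) zero r q = trans (base r q) (lemma _ _ _)
    where
    opaque
      unfolding _+_
      lemma : ∀ y a z → z ≡ y * 0ℤ + y * (0ℤ + a * 0ℤ) + z
      lemma = solve-∀
      l₁ : ∀ t → 1ℤ * (1ℤ * (1ℤ * 1ℤ * (t * 1ℤ * 1ℤ))) ≡ 1ℤ * (1ℤ * (1ℤ * (1ℤ * t)))
      l₁ = solve-∀
      l₂ : ∀ t u → 1ℤ * (1ℤ * (u * 0ℤ * (t * 1ℤ * 1ℤ))) ≡ 0ℤ * (1ℤ * (1ℤ * (u * t)))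
      l₂ = solve-∀
      l₃ : ∀ t u v → 1ℤ * (1ℤ * (0ℤ * u * (t * 1ℤ * 1ℤ))) ≡ v * (1ℤ * (1ℤ * (0ℤ * t)))
      l₃ = solve-∀
    base : ∀ r q → κ 0 (suc r) q 0 ≡ ζ q * start 1 0 r
    base zero    zero    = l₁ t
    base zero    (suc q) = l₂ t 1ℤ
    base (suc r) q       = l₃ t (ind (0 ≡ᵇ q)) (ζ q)
  K-step (suc (suc n)) zero r q = trans (κ-step-0 r q n) (lemma _ _ _ _ _)
    where
    opaque
      unfolding _+_
      lemma : ∀ y a z p A → y * A ≡ y * 0ℤ + y * (A + a * 0ℤ) + z * (0ℤ * p)
      lemma = solve-∀
  K-step n (suc μ) r q = begin
    lag (2 ℕ.+ μ) (κ (suc μ) (suc r) q) n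
      ≡⟨ lag-step (2 ℕ.+ μ) _ (λ k → y * (𝒜 (suc μ) r q k + a * 𝒜 μ r q k)) (λ k → y * κ μ (suc r) q k)
           (κ-base μ (suc r) q) (λ k → trans (κ-step μ r q k) (comm _ _)) n ⟩
    _ ≡⟨ cong₂ _+_
           (trans (lag-*ˡ (3 ℕ.+ μ) y (λ k → 𝒜 (suc μ) r q k + a * 𝒜 μ r q k) n) (cong (y *_)
             (trans (lag-+ (3 ℕ.+ μ) (𝒜 (suc μ) r q) (λ k → a * 𝒜 μ r q k) n)
               (cong (λ z → A (suc n) (suc (suc μ)) r q + z) (lag-*ˡ (3 ℕ.+ μ) a (𝒜 μ r q) n)))))
           (lag-*ˡ (2 ℕ.+ μ) y (κ μ (suc r) q) n) ⟩
    y * (A (suc n) (suc (suc μ)) r q + a * A n (suc μ) r q) + y * K (suc n) (suc μ) (suc r) q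
      ≡⟨ lemma _ _ _ _ _ ⟩
    _ ∎
    where
    opaque
      unfolding _+_
      comm : ∀ x y → x + y ≡ y + x
      comm = solve-∀
      lemma : ∀ x z p s u → x + z ≡ z + x + p * (s * (0ℤ * u))
      lemma = solve-∀

  lag-𝒯 : ∀ n μ (g : List ℕ → ℤ) → lag (3 ℕ.+ μ) (λ k → y ^ μ * 𝒯 μ k g) n ≡
    ∑ (suc μ) (λ x → lag (3 ℕ.+ μ) (λ k → y ^ μ * V μ x k (λ w → g (x ∷ w))) n)
  lag-𝒯 n μ g = trans
    (lag-cong (3 ℕ.+ μ) (λ k → sym (∑-*ˡ (y ^ μ) (suc μ) (λ x → V μ x k (λ w → g (x ∷ w))))) n)
    (lag-∑ (3 ℕ.+ μ) (suc μ) (λ x k → y ^ μ * V μ x k (λ w → g (x ∷ w))) n)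

  A-φ : ∀ n μ v r q j → (∀ T → θ (suc μ) r j T ≡ φ v (suc μ) r q T) →
    A n (suc μ) r j ≡ ∑ (suc μ) (λ x → F v n (suc μ) x r q)
  A-φ n μ v r q j eq = trans (lag-cong (3 ℕ.+ μ) (λ k → cong (y ^ μ *_) (𝒯-cong μ k eq)) n) (lag-𝒯 n μ (φ v (suc μ) r q))

  A-0 : ∀ n m r → A n m r 0 ≡ ∑ m (λ x → F 0ℤ n m x r 0)
  A-0 n zero    r = refl
  A-0 n (suc μ) r = A-φ n μ 0ℤ r 0 0 (θ-0 (suc μ) r)

  A-1 : ∀ n m r → A n m r 0 + A n m r 1 ≡ ∑ m (λ x → F 1ℤ n m x r 0)
  A-1 n zero    r = +-≡0 refl refl
  A-1 n (suc μ) r = begin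
    lag (3 ℕ.+ μ) (𝒜 μ r 0) n + lag (3 ℕ.+ μ) (𝒜 μ r 1) n
      ≡⟨ lag-+ (3 ℕ.+ μ) (𝒜 μ r 0) (𝒜 μ r 1) n ⟨
    lag (3 ℕ.+ μ) (λ k → 𝒜 μ r 0 k + 𝒜 μ r 1 k) n
      ≡⟨ lag-cong (3 ℕ.+ μ) (λ k → trans (sym (*-distribˡ-+ (y ^ μ) _ _)) (cong (y ^ μ *_)
           (trans (sym (𝒯-+ μ k (θ (suc μ) r 0) (θ (suc μ) r 1))) (𝒯-cong μ k (θ-1 (suc μ) r))))) n ⟩
    lag (3 ℕ.+ μ) (λ k → y ^ μ * 𝒯 μ k (φ 1ℤ (suc μ) r 0)) n
      ≡⟨ lag-𝒯 n μ (φ 1ℤ (suc μ) r 0) ⟩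
    _ ∎

  A-2 : ∀ n m r q → A n m r (suc (suc q)) ≡ ∑ m (λ x → F 1ℤ n m x r (suc q))
  A-2 n zero    r q = refl
  A-2 n (suc μ) r q = A-φ n μ 1ℤ r (suc q) (suc (suc q)) (θ-2 (suc μ) r q)

  system : System t y
  system = record
    { F = F ; K = K ; A = A ; st = start
    ; F-m = F-m ; F-r = F-r ; F-r₀ = F-r₀ ; K-n = K-n ; K-m₀ = λ _ _ _ → refl ; K-r₀ = K-r₀ ; K-r = K-r
    ; st-sym = start-sym ; st-suc = start-suc ; F-step = F-step ; K-step = K-step
    ; A-0 = A-0 ; A-1 = A-1 ; A-2 = A-2 }

  F-sym : ∀ v n m e r q → e ℕ.< m → q ℕ.< r → F v n m e r q ≡ F v n r q m e
  F-sym v n = Symmetry.Symmetric.F-sym (Symmetry.symmetric system n) v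

-- Whole sequences

bld : ℕ → ℕ → List ℕ → List ℕ
bld j zero    T = T
bld j (suc m) T = j ∷ bld (suc j) m T

Valid : ℕ → ℕ → List ℕ → Set
Valid a l []      = ⊤
Valid a l (x ∷ w) = x ℕ.< suc (suc a) × Valid (up l x ℕ.+ a) x w

V-cong-valid : ∀ a l k {g h} → (∀ w → Valid a l w → g w ≡ h w) → V a l k g ≡ V a l k h
V-cong-valid a l zero    eq = eq [] tt
V-cong-valid a l (suc k) eq = ∑-cong (suc (suc a)) λ x x< →
  V-cong-valid (up l x ℕ.+ a) x k λ w valid → eq (x ∷ w) (x< , valid)

up≤1 : ∀ l x → up l x ℕ.≤ 1
up≤1 l x with l <ᵇ x
... | true  = s≤s z≤n
... | false = z≤n

-- Each letter advances the position by one and the ascent count by at most one. A position beyond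
-- the reach of the letters thus stays beyond it, and the maximals form a prefix.
no-late-maximal : ∀ p a l w → Valid a l w → suc (suc a) ℕ.≤ p → maxFrom p w ≡ 0
no-late-maximal p a l []      _          _   = refl
no-late-maximal p a l (x ∷ w) (x< , val) a<p rewrite <⇒≢ᵇ′ (ℕₚ.≤-trans x< a<p) =
  no-late-maximal (suc p) (up l x ℕ.+ a) x w val
    (s≤s (ℕₚ.≤-trans (s≤s (ℕₚ.+-monoˡ-≤ a (up≤1 l x))) a<p))

bld-snoc : ∀ j m w → bld j m (j ℕ.+ m ∷ w) ≡ bld j (suc m) w
bld-snoc j zero    w = cong (_∷ w) (ℕₚ.+-identityʳ j)
bld-snoc j (suc m) w = cong (j ∷_) (trans (cong (λ z → bld (suc j) m (z ∷ w)) (ℕₚ.+-suc j m)) (bld-snoc (suc j) m w))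

maxFrom-bld : ∀ j m T → maxFrom j (bld j m T) ≡ m ℕ.+ maxFrom (j ℕ.+ m) T
maxFrom-bld j zero    T = cong (λ z → maxFrom z T) (sym (ℕₚ.+-identityʳ j))
maxFrom-bld j (suc m) T rewrite ≡ᵇ-refl j | ℕₚ.+-suc j m = cong suc (maxFrom-bld (suc j) m T)

length-bld : ∀ j m T → length (bld j m T) ≡ m ℕ.+ length T
length-bld j zero    T = refl
length-bld j (suc m) T = cong suc (length-bld (suc j) m T)

at-bld : ∀ j m T → at m (bld j m T) ≡ at 0 T
at-bld j zero    T = refl
at-bld j (suc m) T = at-bld (suc j) m T

maxStat-bld : ∀ μ x w → x ℕ.≤ μ → Valid μ x w → maxStat (bld 0 (suc μ) (x ∷ w)) ≡ suc μ
maxStat-bld μ x w x≤ valid = trans (maxFrom-bld 0 (suc μ) (x ∷ w)) (trans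
  (cong (suc μ ℕ.+_) (trans (cong (λ b → (if b then 1 else 0) ℕ.+ maxFrom (suc (suc μ)) w) (<⇒≢ᵇ′ (s≤s x≤)))
    (no-late-maximal (suc (suc μ)) μ x w valid ℕₚ.≤-refl)))
  (ℕₚ.+-identityʳ (suc μ)))

≢ᵇ-+ : ∀ m l → (m ≡ᵇ m ℕ.+ suc l) ≡ false
≢ᵇ-+ zero    l = refl
≢ᵇ-+ (suc m) l = ≢ᵇ-+ m l

ealm-bld : ∀ μ x w → x ℕ.≤ μ → Valid μ x w → ealm (bld 0 (suc μ) (x ∷ w)) ≡ x
ealm-bld μ x w x≤ valid = trans
  (cong₂ (λ i l → if i ≡ᵇ l then 0 else at i s) (maxStat-bld μ x w x≤ valid) (length-bld 0 (suc μ) (x ∷ w)))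
  (trans (cong (λ b → if b then 0 else at (suc μ) s) (≢ᵇ-+ μ (length w))) (at-bld 0 (suc μ) (x ∷ w)))
  where s = bld 0 (suc μ) (x ∷ w)

maxStat-id : ∀ n → maxStat (bld 0 n []) ≡ n
maxStat-id n = trans (maxFrom-bld 0 n []) (ℕₚ.+-identityʳ n)

ealm-id : ∀ n → ealm (bld 0 n []) ≡ 0
ealm-id n = trans
  (cong₂ (λ i l → if i ≡ᵇ l then 0 else at i s) (maxStat-id n) (trans (length-bld 0 n []) (ℕₚ.+-identityʳ n)))
  (cong (λ b → if b then 0 else at n s) (≡ᵇ-refl n))
  where s = bld 0 n []

≤⇒≮ᵇ : ∀ {x j} → x ℕ.≤ j → (j <ᵇ x) ≡ false
≤⇒≮ᵇ z≤n     = refl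
≤⇒≮ᵇ (s≤s p) = ≤⇒≮ᵇ p

asc-bld : ∀ j m x w → x ℕ.≤ j ℕ.+ m → asc (bld j (suc m) (x ∷ w)) ≡ m ℕ.+ asc (x ∷ w)
asc-bld j zero x w x≤ rewrite ≤⇒≮ᵇ (subst (x ℕ.≤_) (ℕₚ.+-identityʳ j) x≤) = refl
asc-bld j (suc m) x w x≤ rewrite <⇒<ᵇ≡true (ℕₚ.n<1+n j) =
  cong suc (asc-bld (suc j) m x w (subst (x ℕ.≤_) (ℕₚ.+-suc j m) x≤))

ρ-bld : ∀ j m T → ρ j (bld j m T) ≡ ρ (j ℕ.+ m) T
ρ-bld j zero    T = cong (λ z → ρ z T) (sym (ℕₚ.+-identityʳ j))
ρ-bld j (suc m) T rewrite <ᵇ-irrefl j | ℕₚ.+-suc j m =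
  trans (sym (ρ-suc j (bld (suc j) m T))) (ρ-bld (suc j) m T)

zs-bld : ∀ j m T → zs (bld (suc j) m T) ≡ zs T
zs-bld j zero    T = refl
zs-bld j (suc m) T = zs-bld (suc j) m T

has-0-bld : ∀ j m T → has 0 (bld (suc j) m T) ≡ has 0 T
has-0-bld j zero    T = refl
has-0-bld j (suc m) T = has-0-bld (suc j) m T

bld-suc : ∀ j m T → bld (suc j) m (map suc T) ≡ map suc (bld j m T)
bld-suc j zero    T = refl
bld-suc j (suc m) T = cong (suc j ∷_) (bld-suc (suc j) m T)

rr-bld : ∀ j m T → has 0 T ≡ true → rr (bld (suc j) m T) ≡ rr T
rr-bld j zero    T eq = refl
rr-bld j (suc m) T eq
  rewrite has-0⇒¬allGreater (suc j) (bld (suc (suc j)) m T) (trans (has-0-bld (suc j) m T) eq) = rr-bld (suc j) m T eq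

qd-bld : ∀ j m T → has 0 T ≡ true → qd (bld (suc j) m T) ≡ qd T
qd-bld j zero    T eq = refl
qd-bld j (suc m) T eq
  rewrite has-0⇒¬allGreater (suc j) (bld (suc (suc j)) m T) (trans (has-0-bld (suc j) m T) eq)
        | has-0⇒¬allGE j (bld (suc (suc j)) m T) (trans (has-0-bld (suc j) m T) eq) = qd-bld (suc j) m T eq

rr-bld-0 : ∀ μ T → has 0 T ≡ true → rr (bld 0 (suc μ) T) ≡ rr T
rr-bld-0 μ T eq rewrite has-0⇒¬allGreater 0 (bld 1 μ T) (trans (has-0-bld 0 μ T) eq) = rr-bld 0 μ T eq

qd-bld-0 : ∀ μ T → has 0 T ≡ true → qd (bld 0 (suc μ) T) ≡ 1 ⊔ qd T
qd-bld-0 μ T eq rewrite has-0⇒¬allGreater 0 (bld 1 μ T) (trans (has-0-bld 0 μ T) eq) | allGE-0 (bld 1 μ T) =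
  cong (1 ⊔_) (qd-bld 0 μ T eq)

rr-suc : ∀ s → rr (0 ∷ map suc s) ≡ suc (rr s)
rr-suc s rewrite allGreater-0-suc s = cong suc (rr-punch 0 s)

qd-suc : ∀ s → qd (0 ∷ map suc s) ≡ bump (qd s)
qd-suc s rewrite allGreater-0-suc s = cong bump (qd-punch 0 s)

rr-id : ∀ n → rr (bld 0 n []) ≡ n
rr-id zero    = refl
rr-id (suc n) = trans (cong (λ s → rr (0 ∷ s)) (bld-suc 0 n [])) (trans (rr-suc (bld 0 n [])) (cong suc (rr-id n)))

qd-id : ∀ n → qd (bld 0 n []) ≡ 0
qd-id zero    = refl
qd-id (suc n) = trans (cong (λ s → qd (0 ∷ s)) (bld-suc 0 n [])) (trans (qd-suc (bld 0 n [])) (cong bump (qd-id n)))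

zero-free : ∀ T → has 0 T ≡ false → T ≡ map suc (map pred T)
zero-free []          eq = refl
zero-free (suc x ∷ T) eq = cong (suc x ∷_) (zero-free T eq)

1⊔-suc : ∀ j → ∃ λ i → 1 ⊔ j ≡ suc i
1⊔-suc zero    = 0 , refl
1⊔-suc (suc j) = j , refl

-- If the tail has a zero, the value 0 is repeated and index 0 qualifies. If not, the leading zero
-- is removed and all letters are lowered. On sequences with a tail, `bump` therefore acts as a true
-- successor.
qd-bld-suc : ∀ μ x w → x ℕ.≤ μ → ∃ λ j → qd (bld 0 (suc μ) (x ∷ w)) ≡ suc j
qd-bld-suc μ x w x≤ with has 0 (x ∷ w) in eq
... | true = proj₁ (1⊔-suc (qd (x ∷ w))) , trans (qd-bld-0 μ (x ∷ w) eq) (proj₂ (1⊔-suc (qd (x ∷ w))))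
qd-bld-suc (suc μ) (suc x) w (s≤s x≤) | false with qd-bld-suc μ x (map pred w) x≤
... | j , ih = suc j , trans (cong (λ T → qd (0 ∷ bld 1 (suc μ) T)) (zero-free (suc x ∷ w) eq))
  (trans (cong (λ s → qd (0 ∷ s)) (bld-suc 0 (suc μ) (x ∷ map pred w)))
    (trans (qd-suc (bld 0 (suc μ) (x ∷ map pred w))) (cong bump ih)))

∑-select : ∀ n e (g : ℕ → ℤ) → e ℕ.< n → ∑ n (λ x → ind (x ≡ᵇ e) * g x) ≡ g e
∑-select (suc n) zero    g _         = trans (cong₂ _+_ (*-identityˡ _) (∑-zero n λ x _ → *-zeroˡ _)) (+-identityʳ _)
∑-select (suc n) (suc e) g (s≤s e<n) = trans (cong₂ _+_ (*-zeroˡ _) (∑-select n e (g ∘ suc) e<n)) (+-identityˡ _)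

qd≤rr : ∀ w → qd w ℕ.≤ rr w
qd≤rr [] = z≤n
qd≤rr (x ∷ w) with allGreater x w in eq | allGE x w
... | true  | _     with qd w | qd≤rr w
...   | zero  | _ = z≤n
...   | suc j | p = s≤s p
qd≤rr (x ∷ [])    | false | true  with () ← eq
qd≤rr (x ∷ z ∷ w) | false | true  = ℕₚ.⊔-lub (subst (1 ℕ.≤_) (sym (proj₂ (rr-∷ z w))) (s≤s z≤n)) (qd≤rr (z ∷ w))
qd≤rr (x ∷ w)     | false | false = qd≤rr w

-- From tails to all ascent sequences

module Sequences (t y : ℤ) where
  open Tails t y
  open ≡-Reasoning

  weight : ℤ → List ℕ → ℤ
  weight v s = t ^ ρ 0 s * y ^ asc s * v ^ zs s

  H : ℤ → ℕ → ℕ → List ℕ → ℤ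
  H v r q s = cls r q s * weight v s

  h : ℤ → ℕ → ℕ → ℕ → ℕ → List ℕ → ℤ
  h v m e r q s = ind (maxStat s ≡ᵇ m) * (ind (ealm s ≡ᵇ e) * H v r q s)

  full : ℤ → ℕ → ℕ → ℕ → ℕ → ℕ → ℤ
  full v n m e r q = V 0 0 n (λ w → h v m e r q (0 ∷ w))

  sel : ℤ → ℕ → ℕ → ℕ → ℕ → ℕ → ℤ
  sel v μ e r q k = V μ e k (λ w → H v r q (bld 0 (suc μ) (e ∷ w)))

  module _ (v : ℤ) (m e r q : ℕ) where

    chain : ℕ → ℕ → ℤ
    chain μ k = V μ μ k (λ w → h v m e r q (bld 0 (suc μ) w))

    hid : ℕ → ℤ
    hid n = h v m e r q (bld 0 n [])

    chain-suc : ∀ μ k → chain μ (suc k) ≡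
      ∑ (suc μ) (λ x → ind (suc μ ≡ᵇ m) * (ind (x ≡ᵇ e) * sel v μ x r q k)) + chain (suc μ) k
    chain-suc μ k = trans (∑-last (suc μ) (λ x → V (up μ x ℕ.+ μ) x k (λ w → h v m e r q (bld 0 (suc μ) (x ∷ w))))) (cong₂ _+_
      (∑-cong (suc μ) λ x x< → begin
        V (up μ x ℕ.+ μ) x k (λ w → h v m e r q (bld 0 (suc μ) (x ∷ w)))
          ≡⟨ cong (λ b → V ((if b then 1 else 0) ℕ.+ μ) x k (λ w → h v m e r q (bld 0 (suc μ) (x ∷ w)))) (≤⇒≮ᵇ (ℕₚ.≤-pred x<)) ⟩
        V μ x k (λ w → h v m e r q (bld 0 (suc μ) (x ∷ w)))
          ≡⟨ V-cong-valid μ x k (λ w valid → cong₂ (λ a b → ind (a ≡ᵇ m) * (ind (b ≡ᵇ e) * H v r q (bld 0 (suc μ) (x ∷ w))))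
               (maxStat-bld μ x w (ℕₚ.≤-pred x<) valid) (ealm-bld μ x w (ℕₚ.≤-pred x<) valid)) ⟩
        V μ x k (λ w → ind (suc μ ≡ᵇ m) * (ind (x ≡ᵇ e) * H v r q (bld 0 (suc μ) (x ∷ w))))
          ≡⟨ trans (V-*ˡ μ x k (ind (suc μ ≡ᵇ m)) (λ w → ind (x ≡ᵇ e) * H v r q (bld 0 (suc μ) (x ∷ w))))
               (cong (ind (suc μ ≡ᵇ m) *_) (V-*ˡ μ x k (ind (x ≡ᵇ e)) (λ w → H v r q (bld 0 (suc μ) (x ∷ w))))) ⟩
        ind (suc μ ≡ᵇ m) * (ind (x ≡ᵇ e) * sel v μ x r q k) ∎)
      (trans (cong (λ b → V ((if b then 1 else 0) ℕ.+ μ) (suc μ) k (λ w → h v m e r q (bld 0 (suc μ) (suc μ ∷ w)))) (<⇒<ᵇ≡true (ℕₚ.n<1+n μ)))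
        (V-cong′ (suc μ) (suc μ) k λ w → cong (h v m e r q) (bld-snoc 0 (suc μ) w))))

    other-max : ∀ μ k → (suc μ ≡ᵇ m) ≡ false →
      ∑ (suc μ) (λ x → ind (suc μ ≡ᵇ m) * (ind (x ≡ᵇ e) * sel v μ x r q k)) ≡ 0ℤ
    other-max μ k ne = ∑-zero (suc μ) λ x _ → trans (cong (λ b → ind b * (ind (x ≡ᵇ e) * sel v μ x r q k)) ne) (*-zeroˡ _)

    chain-above : ∀ k μ → m ℕ.≤ μ → chain μ k ≡ hid (suc μ ℕ.+ k)
    chain-above zero    μ m≤μ = cong hid (sym (ℕₚ.+-identityʳ (suc μ)))
    chain-above (suc k) μ m≤μ = begin
      chain μ (suc k) ≡⟨ chain-suc μ k ⟩
      _ ≡⟨ cong (_+ chain (suc μ) k) (other-max μ k (<⇒≢ᵇ (s≤s m≤μ))) ⟩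
      0ℤ + chain (suc μ) k ≡⟨ +-identityˡ _ ⟩
      chain (suc μ) k ≡⟨ chain-above k (suc μ) (ℕₚ.m≤n⇒m≤1+n m≤μ) ⟩
      hid (suc (suc μ) ℕ.+ k) ≡⟨ cong (hid ∘ suc) (ℕₚ.+-suc μ k) ⟨
      hid (suc μ ℕ.+ suc k) ∎

    picked : ∀ M k → m ≡ suc M → e ℕ.< m →
      ∑ (suc M) (λ x → ind (suc M ≡ᵇ m) * (ind (x ≡ᵇ e) * sel v M x r q k)) ≡ sel v M e r q k
    picked M k refl e< = trans (∑-cong′ (suc M) λ x → trans (cong (λ b → ind b * (ind (x ≡ᵇ e) * sel v M x r q k)) (≡ᵇ-refl M)) (*-identityˡ _))
      (∑-select (suc M) e (λ x → sel v M x r q k) e<)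

    -- The run of maximals is followed letter by letter. When its length is m, the next letter is
    -- the ealm and is selected. The sequence consisting of maximals only never leaves the run and
    -- remains as the extra term `hid`.
    chain-below : ∀ k d μ → m ≡ suc (μ ℕ.+ d) → e ℕ.< m →
      chain μ k ≡ lag (suc d) (sel v (μ ℕ.+ d) e r q) k + hid (suc μ ℕ.+ k)
    chain-below zero    d       μ m≡ e< = trans (cong hid (sym (ℕₚ.+-identityʳ (suc μ)))) (sym (+-identityˡ _))
    chain-below (suc k) zero    μ m≡ e< = begin
      chain μ (suc k) ≡⟨ chain-suc μ k ⟩
      _ ≡⟨ cong₂ _+_
             (trans (picked μ k (trans m≡ (cong suc (ℕₚ.+-identityʳ μ))) e<) (cong (λ z → sel v z e r q k) (sym (ℕₚ.+-identityʳ μ))))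
             (chain-above k (suc μ) (ℕₚ.≤-reflexive (trans m≡ (cong suc (ℕₚ.+-identityʳ μ))))) ⟩
      sel v (μ ℕ.+ 0) e r q k + hid (suc (suc μ) ℕ.+ k)
        ≡⟨ cong (λ z → sel v (μ ℕ.+ 0) e r q k + hid (suc z)) (ℕₚ.+-suc μ k) ⟨
      _ ∎
    chain-below (suc k) (suc d) μ m≡ e< = begin
      chain μ (suc k) ≡⟨ chain-suc μ k ⟩
      _ ≡⟨ cong₂ _+_ (other-max μ k (trans (cong (suc μ ≡ᵇ_) m≡) (≢ᵇ-+ μ d)))
             (chain-below k d (suc μ) (trans m≡ (cong suc (ℕₚ.+-suc μ d))) e<) ⟩
      0ℤ + (lag (suc d) (sel v (suc μ ℕ.+ d) e r q) k + hid (suc (suc μ) ℕ.+ k))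
        ≡⟨ +-identityˡ _ ⟩
      lag (suc d) (sel v (suc μ ℕ.+ d) e r q) k + hid (suc (suc μ) ℕ.+ k)
        ≡⟨ cong₂ (λ z z′ → lag (suc d) (sel v z e r q) k + hid (suc z′)) (ℕₚ.+-suc μ d) (ℕₚ.+-suc μ k) ⟨
      _ ∎

    chain-no-e : ∀ k μ → m ℕ.≤ e → chain μ k ≡ hid (suc μ ℕ.+ k)
    chain-no-e zero    μ m≤e = cong hid (sym (ℕₚ.+-identityʳ (suc μ)))
    chain-no-e (suc k) μ m≤e = begin
      chain μ (suc k) ≡⟨ chain-suc μ k ⟩
      _ ≡⟨ cong₂ _+_ vanish (chain-no-e k (suc μ) m≤e) ⟩
      0ℤ + hid (suc (suc μ) ℕ.+ k) ≡⟨ +-identityˡ _ ⟩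
      hid (suc (suc μ) ℕ.+ k) ≡⟨ cong (hid ∘ suc) (ℕₚ.+-suc μ k) ⟨
      hid (suc μ ℕ.+ suc k) ∎
      where
      vanish : ∑ (suc μ) (λ x → ind (suc μ ≡ᵇ m) * (ind (x ≡ᵇ e) * sel v μ x r q k)) ≡ 0ℤ
      vanish with suc μ ≡ᵇ m in eq
      ... | false = ∑-zero (suc μ) λ x _ → *-zeroˡ (ind (x ≡ᵇ e) * sel v μ x r q k)
      ... | true = ∑-zero (suc μ) λ x x< → trans
        (cong (λ b → 1ℤ * (ind b * sel v μ x r q k)) (<⇒≢ᵇ′ (ℕₚ.≤-trans x< (ℕₚ.≤-trans (ℕₚ.≤-reflexive (ℕₚ.≡ᵇ⇒≡ (suc μ) m (subst Bool.T (sym eq) tt))) m≤e))))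
        (lemma _ _)
        where
        opaque
          unfolding _+_
          lemma : ∀ x y → x * (0ℤ * y) ≡ 0ℤ
          lemma = solve-∀

  -- The weight of the sequences of length n + 1 that have a tail, so the corresponding index of `F`
  -- is n + 2.
  G : ℤ → ℕ → ℕ → ℕ → ℕ → ℕ → ℤ
  G v n zero    e r q = 0ℤ
  G v n (suc μ) e r q = lag (suc μ) (sel v μ e r q) n

  full-G : ∀ v n m e r q → e ℕ.< m → full v n m e r q ≡ G v n m e r q + hid v m e r q (suc n)
  full-G v n (suc M) e r q e< = chain-below v (suc M) e r q n M 0 refl e<

  full-out : ∀ v n m e r q → m ℕ.≤ e → full v n m e r q ≡ hid v m e r q (suc n)
  full-out v n m e r q m≤e = chain-no-e v m e r q n 0 m≤e

  hid-formula : ∀ v m e r q n → hid v m e r q n ≡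
    ind (n ≡ᵇ m) * (ind (0 ≡ᵇ e) * (ind (n ≡ᵇ r) * ind (0 ≡ᵇ q) * weight v (bld 0 n [])))
  hid-formula v m e r q n = trans
    (cong₂ (λ a b → ind (a ≡ᵇ m) * (ind (b ≡ᵇ e) * H v r q (bld 0 n []))) (maxStat-id n) (ealm-id n))
    (cong (λ z → ind (n ≡ᵇ m) * (ind (0 ≡ᵇ e) * z))
      (cong₂ (λ a b → ind (a ≡ᵇ r) * ind (pred b ≡ᵇ q) * weight v (bld 0 n [])) (rr-id n) (qd-id n)))

  hid-sym : ∀ v m e r q n → hid v m e r q n ≡ hid v r q m e n
  hid-sym v m e r q n = trans (hid-formula v m e r q n) (trans (lemma _ _ _ _ _) (sym (hid-formula v r q m e n)))
    where
    opaque
      unfolding _+_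
      lemma : ∀ a b c d w → a * (b * (c * d * w)) ≡ c * (d * (a * b * w))
      lemma = solve-∀

  hid-out : ∀ v m e r q n → m ℕ.≤ e → hid v m e r q (suc n) ≡ 0ℤ
  hid-out v zero    e       r q n _ = trans (hid-formula v 0 e r q (suc n)) (*-zeroˡ _)
  hid-out v (suc m) (suc e) r q n _ = trans (hid-formula v (suc m) (suc e) r q (suc n)) (lemma _ _)
    where
    opaque
      unfolding _+_
      lemma : ∀ x y → x * (0ℤ * y) ≡ 0ℤ
      lemma = solve-∀

  γ : ℤ → ℕ → ℕ → ℕ → List ℕ → ℤ
  γ v μ r q T = cls r q (bld 0 (suc μ) T) * (wt (suc μ) T * v ^ suc (zs T))

  H-γ : ∀ v μ r q e w → e ℕ.≤ μ → H v r q (bld 0 (suc μ) (e ∷ w)) ≡ y ^ μ * γ v μ r q (e ∷ w)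
  H-γ v μ r q e w e≤ = begin
    cls r q s * (t ^ ρ 0 s * y ^ asc s * v ^ zs s)
      ≡⟨ cong (cls r q s *_) (cong₂ _*_ (cong₂ _*_ (cong (t ^_) (ρ-bld 0 (suc μ) (e ∷ w)))
           (trans (cong (y ^_) (asc-bld 0 μ e w e≤)) (^-+ y μ (asc (e ∷ w)))))
           (cong (λ z → v ^ suc z) (zs-bld 0 μ (e ∷ w)))) ⟩
    cls r q s * (t ^ ρ (suc μ) (e ∷ w) * (y ^ μ * y ^ asc (e ∷ w)) * v ^ suc (zs (e ∷ w)))
      ≡⟨ lemma _ _ _ _ _ ⟩
    _ ∎
    where
    s = bld 0 (suc μ) (e ∷ w)
    opaque
      unfolding _+_
      lemma : ∀ c t p y v → c * (t * (p * y) * v) ≡ p * (c * (t * y * v))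
      lemma = solve-∀

  sel-γ : ∀ v μ e r q k → e ℕ.≤ μ → sel v μ e r q k ≡ y ^ μ * V μ e k (λ w → γ v μ r q (e ∷ w))
  sel-γ v μ e r q k e≤ = trans (V-cong′ μ e k λ w → H-γ v μ r q e w e≤) (V-*ˡ μ e k (y ^ μ) (λ w → γ v μ r q (e ∷ w)))

  γ-has-0 : ∀ v μ r q T → γ v μ r q T ≡ v * v * φ v (suc μ) r q T + ind (not (has 0 T)) * γ v μ r q T
  γ-has-0 v μ r q T with has 0 T in eq
  ... | false = lemma _ _ _
    where
    opaque
      unfolding _+_
      lemma : ∀ x v c → x ≡ v * v * (0ℤ * c) + 1ℤ * x
      lemma = solve-∀
  ... | true rewrite rr-bld-0 μ T eq | qd-bld-0 μ T eq | pred-1⊔ (qd T) | proj₂ (has-0⇒zs T eq) = lemma _ _ _ _ _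
    where
    opaque
      unfolding _+_
      lemma : ∀ c w v u d → c * (w * (v * (v * u))) ≡ v * v * (1ℤ * (c * (w * u))) + 0ℤ * d
      lemma = solve-∀

  γ-split : ∀ v μ e r q k → V μ e k (λ w → γ v μ r q (e ∷ w)) ≡
    v * v * V μ e k (λ w → φ v (suc μ) r q (e ∷ w)) + V μ e k (λ w → ind (not (has 0 (e ∷ w))) * γ v μ r q (e ∷ w))
  γ-split v μ e r q k = trans (V-cong′ μ e k λ w → γ-has-0 v μ r q (e ∷ w))
    (trans (V-+ μ e k (λ w → v * v * φ v (suc μ) r q (e ∷ w)) (λ w → ind (not (has 0 (e ∷ w))) * γ v μ r q (e ∷ w)))
      (cong (_+ V μ e k (λ w → ind (not (has 0 (e ∷ w))) * γ v μ r q (e ∷ w)))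
        (V-*ˡ μ e k (v * v) (λ w → φ v (suc μ) r q (e ∷ w)))))

  below : (ℕ → ℕ → ℤ) → ℕ → ℕ → ℤ
  below g (suc r) (suc q) = g r q
  below g _       _       = 0ℤ

  zs-suc : ∀ T → zs (map suc T) ≡ 0
  zs-suc []      = refl
  zs-suc (x ∷ T) = zs-suc T

  -- Raising the letters destroys the old zeros, so these are counted with v = 1 and the new leading
  -- zero supplies the only v. By `qd-bld-suc` rpos rises by exactly one, as rmin does.
  γ-suc : ∀ v μ r q x w → x ℕ.≤ μ → γ v (suc μ) r q (map suc (x ∷ w)) ≡
    v * below (λ r q → γ 1ℤ μ r q (x ∷ w)) r q
  γ-suc v μ r q x w x≤ = trans
    (cong (λ s → cls r q (0 ∷ s) * (wt (suc (suc μ)) (map suc (x ∷ w)) * v ^ suc (zs (map suc w)))) (bld-suc 0 (suc μ) (x ∷ w)))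
    (trans (cong₂ (λ a b → ind (a ≡ᵇ r) * ind (pred b ≡ᵇ q) * (wt (suc (suc μ)) (map suc (x ∷ w)) * v ^ suc (zs (map suc w))))
             (rr-suc s) (trans (qd-suc s) (cong bump (proj₂ (qd-bld-suc μ x w x≤)))))
      (trans (cong₂ (λ a b → ind (suc (rr s) ≡ᵇ r) * ind (suc j ≡ᵇ q) * (a * v ^ suc b))
               (cong₂ (λ i k → t ^ i * y ^ k) (ρ-punch 0 (suc μ) (x ∷ w) z≤n) (asc-punch 0 (x ∷ w)))
               (zs-suc w))
        (cases r q)))
    where
    s = bld 0 (suc μ) (x ∷ w)
    j = proj₁ (qd-bld-suc μ x w x≤)
    opaque
      unfolding _+_
      l₁ : ∀ c w v → 0ℤ * c * (w * (v * 1ℤ)) ≡ v * 0ℤ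
      l₁ = solve-∀
      l₂ : ∀ c w v → c * 0ℤ * (w * (v * 1ℤ)) ≡ v * 0ℤ
      l₂ = solve-∀
      l₃ : ∀ c w v → c * (w * (v * 1ℤ)) ≡ v * (c * (w * 1ℤ))
      l₃ = solve-∀
    cases : ∀ r q → ind (suc (rr s) ≡ᵇ r) * ind (suc j ≡ᵇ q) * (wt (suc μ) (x ∷ w) * v ^ 1) ≡
      v * below (λ r q → γ 1ℤ μ r q (x ∷ w)) r q
    cases zero    q       = l₁ _ _ _
    cases (suc r) zero    = l₂ _ _ _
    cases (suc r) (suc q) = trans (l₃ _ _ _) (cong (v *_) (cong₂ _*_
      (cong (λ b → ind (rr s ≡ᵇ r) * ind (b ≡ᵇ q)) (cong pred (sym (proj₂ (qd-bld-suc μ x w x≤)))))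
      (cong (wt (suc μ) (x ∷ w) *_) (sym (1^ (suc (zs (x ∷ w))))))))

  V-below : ∀ a l k v (g : ℕ → ℕ → List ℕ → ℤ) r q →
    V a l k (λ w → v * below (λ r q → g r q w) r q) ≡ v * below (λ r q → V a l k (g r q)) r q
  V-below a l k v g zero    q       = trans (V-*ˡ a l k v (λ _ → 0ℤ)) (cong (v *_) (V-zero a l k λ _ _ → refl))
  V-below a l k v g (suc r) zero    = trans (V-*ˡ a l k v (λ _ → 0ℤ)) (cong (v *_) (V-zero a l k λ _ _ → refl))
  V-below a l k v g (suc r) (suc q) = V-*ˡ a l k v (g r q)

  sel-0 : ∀ v μ r q k → sel v μ 0 r q k ≡ v * v * f v μ 0 r q k
  sel-0 v μ r q k = trans (sel-γ v μ 0 r q k z≤n) (trans (cong (y ^ μ *_) (trans (γ-split v μ 0 r q k)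
    (cong (λ z → v * v * V μ 0 k (λ w → φ v (suc μ) r q (0 ∷ w)) + z) (V-zero μ 0 k λ w _ → *-zeroˡ _)))) (lemma _ _ _))
    where
    opaque
      unfolding _+_
      lemma : ∀ p v x → p * (v * v * x + 0ℤ) ≡ v * v * (p * x)
      lemma = solve-∀

  sel-suc : ∀ v μ e r q k → e ℕ.≤ μ → sel v (suc μ) (suc e) r q k ≡
    v * v * f v (suc μ) (suc e) r q k + v * y * below (λ r q → sel 1ℤ μ e r q k) r q
  sel-suc v μ e r q k e≤ = trans (sel-γ v (suc μ) (suc e) r q k (s≤s e≤)) (trans
    (cong (y ^ suc μ *_) (trans (γ-split v (suc μ) (suc e) r q k) (cong (λ z → v * v * V (suc μ) (suc e) k (λ w → φ v (suc (suc μ)) r q (suc e ∷ w)) + z)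
      (trans (V-punch 0 μ e k (λ w → γ v (suc μ) r q (suc e ∷ w)) z≤n)
        (trans (V-cong′ μ e k λ w → γ-suc v μ r q e w e≤) (V-below μ e k v (λ r q w → γ 1ℤ μ r q (e ∷ w)) r q))))))
    (cases r q))
    where
    opaque
      unfolding _+_
      l₁ : ∀ p v y x → y * p * (v * v * x + v * 0ℤ) ≡ v * v * (y * p * x) + v * y * 0ℤ
      l₁ = solve-∀
      l₂ : ∀ p v y x z → y * p * (v * v * x + v * z) ≡ v * v * (y * p * x) + v * y * (p * z)
      l₂ = solve-∀
    cases : ∀ r q → y ^ suc μ * (v * v * V (suc μ) (suc e) k (λ w → φ v (suc (suc μ)) r q (suc e ∷ w))
        + v * below (λ r q → V μ e k (λ w → γ 1ℤ μ r q (e ∷ w))) r q) ≡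
      v * v * f v (suc μ) (suc e) r q k + v * y * below (λ r q → sel 1ℤ μ e r q k) r q
    cases zero    q       = l₁ _ _ _ _
    cases (suc r) zero    = l₁ _ _ _ _
    cases (suc r) (suc q) = trans (l₂ _ _ _ _ _) (cong (λ z → v * v * f v (suc μ) (suc e) (suc r) (suc q) k + v * y * z)
      (sym (sel-γ 1ℤ μ e r q k e≤)))

  G-0 : ∀ v n m r q → 0 ℕ.< m → G v n m 0 r q ≡ v * v * F v (suc (suc n)) m 0 r q
  G-0 v n (suc μ) r q _ = trans (lag-cong (suc μ) (sel-0 v μ r q) n) (lag-*ˡ (suc μ) (v * v) (f v μ 0 r q) n)

  G-suc : ∀ v n m e r q → e ℕ.< m → G v (suc n) (suc m) (suc e) r q ≡
    v * v * F v (suc (suc (suc n))) (suc m) (suc e) r q + v * y * below (λ r q → G 1ℤ n m e r q) r q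
  G-suc v n (suc μ) e r q e< = begin
    lag (suc μ) (sel v (suc μ) (suc e) r q) n
      ≡⟨ lag-cong (suc μ) (λ k → sel-suc v μ e r q k (ℕₚ.≤-pred e<)) n ⟩
    _ ≡⟨ lag-+ (suc μ) (λ k → v * v * f v (suc μ) (suc e) r q k) (λ k → v * y * below (λ r q → sel 1ℤ μ e r q k) r q) n ⟩
    _ ≡⟨ cong₂ _+_ (lag-*ˡ (suc μ) (v * v) (f v (suc μ) (suc e) r q) n)
           (trans (lag-*ˡ (suc μ) (v * y) (λ k → below (λ r q → sel 1ℤ μ e r q k) r q) n) (cong (v * y *_) (lag-below r q))) ⟩
    _ ∎
    where
    lag-below : ∀ r q → lag (suc μ) (λ k → below (λ r q → sel 1ℤ μ e r q k) r q) n ≡ below (λ r q → G 1ℤ n (suc μ) e r q) r q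
    lag-below zero    q       = lag-zero (suc μ) _ n λ _ _ → refl
    lag-below (suc r) zero    = lag-zero (suc μ) _ n λ _ _ → refl
    lag-below (suc r) (suc q) = refl

  below-0 : ∀ x c (g : ℕ → ℕ → ℤ) r → x + c * below g r 0 ≡ x
  below-0 x c g zero    = x+y*0≡x x c
  below-0 x c g (suc r) = x+y*0≡x x c

  G-suc-0 : ∀ v n m e r → e ℕ.< m → G v (suc n) (suc m) (suc e) r 0 ≡ v * v * F v (3 ℕ.+ n) (suc m) (suc e) r 0
  G-suc-0 v n m e r e< = trans (G-suc v n m e r 0 e<) (below-0 _ (v * y) (G 1ℤ n m e) r)

  -- The part with zero ≥ 2 is symmetric by `F-sym`. The part with zero = 1 lowers max, ealm, rmin
  -- and rpos by one each, and is covered by induction; it vanishes for e = 0 and for q = 0 alike,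
  -- which settles the mixed cases.
  G-sym : ∀ v n m e r q → e ℕ.< m → q ℕ.< r → G v n m e r q ≡ G v n r q m e
  G-sym v zero (suc m) e (suc r) q e< q< = refl
  G-sym v (suc n) m zero r zero e< q< = trans (G-0 v (suc n) m r 0 e<)
    (trans (cong (v * v *_) (F-sym v (3 ℕ.+ n) m 0 r 0 e< q<)) (sym (G-0 v (suc n) r m 0 q<)))
  G-sym v (suc n) m zero (suc r) (suc q) e< (s≤s q<) = trans (G-0 v (suc n) m (suc r) (suc q) e<)
    (trans (cong (v * v *_) (F-sym v (3 ℕ.+ n) m 0 (suc r) (suc q) e< (s≤s q<))) (sym (G-suc-0 v n r q m q<)))
  G-sym v (suc n) (suc m) (suc e) r zero (s≤s e<) q< = trans (G-suc-0 v n m e r e<)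
    (trans (cong (v * v *_) (F-sym v (3 ℕ.+ n) (suc m) (suc e) r 0 (s≤s e<) q<)) (sym (G-0 v (suc n) r (suc m) (suc e) q<)))
  G-sym v (suc n) (suc m) (suc e) (suc r) (suc q) (s≤s e<) (s≤s q<) = trans (G-suc v n m e (suc r) (suc q) e<) (trans
    (cong₂ (λ x z → v * v * x + v * y * z) (F-sym v (3 ℕ.+ n) (suc m) (suc e) (suc r) (suc q) (s≤s e<) (s≤s q<)) (G-sym 1ℤ n m e r q e< q<))
    (sym (G-suc v n r q (suc m) (suc e) q<)))

  full-r-out : ∀ v n m e r q → r ℕ.≤ q → full v n m e r q ≡ 0ℤ
  full-r-out v n m e r q r≤q = V-zero 0 0 n λ w _ → vanish (0 ∷ w) (pos w)
    where
    pos : ∀ w → 1 ℕ.≤ rr (0 ∷ w)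
    pos w = subst (1 ℕ.≤_) (sym (proj₂ (rr-∷ 0 w))) (s≤s z≤n)
    opaque
      unfolding _+_
      l₁ : ∀ a b c d → a * (b * (0ℤ * c * d)) ≡ 0ℤ
      l₁ = solve-∀
      l₂ : ∀ a b c d → a * (b * (c * 0ℤ * d)) ≡ 0ℤ
      l₂ = solve-∀
    pred< : ∀ {j i} → j ℕ.≤ i → 1 ℕ.≤ i → pred j ℕ.< i
    pred< {zero}  _   1≤i = 1≤i
    pred< {suc j} j≤i _   = j≤i
    vanish : ∀ s → 1 ℕ.≤ rr s → h v m e r q s ≡ 0ℤ
    vanish s 1≤ with rr s ≡ᵇ r in eq
    ... | false = l₁ (ind (maxStat s ≡ᵇ m)) (ind (ealm s ≡ᵇ e)) _ _
    ... | true rewrite <⇒≢ᵇ′ (ℕₚ.≤-trans (pred< (qd≤rr s) 1≤) (subst (ℕ._≤ q) (sym (ℕₚ.≡ᵇ⇒≡ (rr s) r (subst Bool.T (sym eq) tt))) r≤q)) =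
      l₂ (ind (maxStat s ≡ᵇ m)) (ind (ealm s ≡ᵇ e)) _ _

  -- Only e < m and q < r can occur, as ealm < max and rpos < rmin; for any other values both sides
  -- are zero.
  full-sym : ∀ v n m e r q → full v n m e r q ≡ full v n r q m e
  full-sym v n m e r q with ℕₚ.<-≤-connex e m | ℕₚ.<-≤-connex q r
  ... | inj₁ e<m | inj₁ q<r = trans (full-G v n m e r q e<m) (trans
      (cong₂ _+_ (G-sym v n m e r q e<m q<r) (hid-sym v m e r q (suc n))) (sym (full-G v n r q m e q<r)))
  ... | inj₂ m≤e | _        = trans (full-out v n m e r q m≤e) (trans (hid-out v m e r q n m≤e) (sym (full-r-out v n r q m e m≤e)))
  ... | inj₁ _   | inj₂ r≤q = trans (full-r-out v n m e r q r≤q) (sym (trans (full-out v n r q m e r≤q) (hid-out v r q m e n r≤q)))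

-- The statistics of the statement

zeroStat≡zs : ∀ s → zeroStat s ≡ zs s
zeroStat≡zs []          = refl
zeroStat≡zs (zero ∷ s)  = cong suc (zeroStat≡zs s)
zeroStat≡zs (suc _ ∷ s) = zeroStat≡zs s

occ : ℕ → List ℕ → ℕ
occ c []      = 0
occ c (x ∷ s) = (if c ≡ᵇ x then 1 else 0) ℕ.+ occ c s

≢⇒≢ᵇ : ∀ a b → ¬ a ≡ b → (a ≡ᵇ b) ≡ false
≢⇒≢ᵇ zero    zero    ne = ⊥-elim (ne refl)
≢⇒≢ᵇ zero    (suc b) ne = refl
≢⇒≢ᵇ (suc a) zero    ne = refl
≢⇒≢ᵇ (suc a) (suc b) ne = ≢⇒≢ᵇ a b (ne ∘ cong suc)

≡ᵇ-true : ∀ a b → (a ≡ᵇ b) ≡ true → a ≡ b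
≡ᵇ-true a b eq = ℕₚ.≡ᵇ⇒≡ a b (subst Bool.T (sym eq) tt)

without : ℕ → List ℕ → List ℕ
without x = filter (¬? ∘ (x ℕₚ.≟_))

length-without : ∀ x d → length (without x d) ℕ.+ occ x d ≡ length d
length-without x []      = refl
length-without x (z ∷ d) with x ℕₚ.≟ z
... | yes refl rewrite ≡ᵇ-refl x = trans (ℕₚ.+-suc _ _) (cong suc (length-without x d))
... | no  ne   rewrite ≢⇒≢ᵇ x z ne = cong suc (length-without x d)

occ-without : ∀ c x d → occ c (without x d) ≡ (if c ≡ᵇ x then 0 else occ c d)
occ-without c x [] with c ≡ᵇ x
... | true  = refl
... | false = refl
occ-without c x (z ∷ d) with x ≡ᵇ z in e
... | true rewrite ≡ᵇ-true x z e with c ≡ᵇ z in e′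
...   | true  = trans (occ-without c z d) (cong (λ b → if b then 0 else occ c d) e′)
...   | false = trans (occ-without c z d) (cong (λ b → if b then 0 else occ c d) e′)
occ-without c x (z ∷ d) | false with c ≡ᵇ x in e′
...   | true rewrite ≡ᵇ-true c x e′ | e = trans (occ-without x x d) (cong (λ b → if b then 0 else occ x d) (≡ᵇ-refl x))
...   | false = cong ((if c ≡ᵇ z then 1 else 0) ℕ.+_) (trans (occ-without c x d) (cong (λ b → if b then 0 else occ c d) e′))

occ-deduplicate : ∀ c s → occ c (deduplicate ℕₚ._≟_ s) ≡ (if has c s then 1 else 0)
occ-deduplicate c []      = refl
occ-deduplicate c (x ∷ s) = trans (cong ((if c ≡ᵇ x then 1 else 0) ℕ.+_) (occ-without c x (deduplicate ℕₚ._≟_ s))) (cases (c ≡ᵇ x))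
  where
  cases : ∀ b → (if b then 1 else 0) ℕ.+ (if b then 0 else occ c (deduplicate ℕₚ._≟_ s)) ≡ (if b ∨ has c s then 1 else 0)
  cases true  = refl
  cases false = occ-deduplicate c s

length-deduplicate : ∀ s → length (deduplicate ℕₚ._≟_ s) ℕ.+ ρ 0 s ≡ length s
length-deduplicate []      = refl
length-deduplicate (x ∷ s) = cong suc (begin
  length (without x d) ℕ.+ ((if has x s then 1 else 0) ℕ.+ ρ 0 s)
    ≡⟨ cong (λ z → length (without x d) ℕ.+ (z ℕ.+ ρ 0 s)) (sym (occ-deduplicate x s)) ⟩
  length (without x d) ℕ.+ (occ x d ℕ.+ ρ 0 s)
    ≡⟨ sym (ℕₚ.+-assoc (length (without x d)) (occ x d) (ρ 0 s)) ⟩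
  length (without x d) ℕ.+ occ x d ℕ.+ ρ 0 s
    ≡⟨ cong (ℕ._+ ρ 0 s) (length-without x d) ⟩
  length d ℕ.+ ρ 0 s ≡⟨ length-deduplicate s ⟩
  length s ∎)
  where
  open ≡-Reasoning
  d = deduplicate ℕₚ._≟_ s

rep≡ρ : ∀ s → rep s ≡ ρ 0 s
rep≡ρ s = trans (cong (_∸ length (deduplicate ℕₚ._≟_ s)) (sym (length-deduplicate s)))
  (ℕₚ.m+n∸m≡n (length (deduplicate ℕₚ._≟_ s)) (ρ 0 s))

length-rlMinFrom : ∀ k s → length (rlMinFrom k s) ≡ rr s
length-rlMinFrom k []      = refl
length-rlMinFrom k (x ∷ s) with allGreater x s
... | true  = cong suc (length-rlMinFrom (suc k) s)
... | false = length-rlMinFrom (suc k) s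

rmin≡rr : ∀ s → rmin s ≡ rr s
rmin≡rr = length-rlMinFrom 0

-- Translates the coded index of `qd` into the result of a search whose first index is m; the
-- absence of an index becomes the default 0.
out : ℕ → ℕ → ℕ
out m zero    = 0
out m (suc j) = m ℕ.+ j

out-bump : ∀ m j → out m (bump j) ≡ out (suc m) j
out-bump m zero    = refl
out-bump m (suc j) = ℕₚ.+-suc m j

⊔-out : ∀ m j → m ⊔ out (suc m) j ≡ out m (1 ⊔ bump j)
⊔-out m zero    = trans (ℕₚ.⊔-identityʳ m) (sym (ℕₚ.+-identityʳ m))
⊔-out m (suc j) = trans (ℕₚ.m≤n⇒m⊔n≡n (ℕₚ.≤-trans (ℕₚ.m≤m+n m j) (ℕₚ.n≤1+n _))) (sym (ℕₚ.+-suc m j))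

NoMin : List ℕ → List ℕ → Set
NoMin []      s = ⊤
NoMin (z ∷ u) s = allGreater z (u ++ s) ≡ false × NoMin u s

NoMin-snoc : ∀ u x s → allGreater x s ≡ false → NoMin u (x ∷ s) → NoMin (u ++ x ∷ []) s
NoMin-snoc []      x s eq _       = eq , tt
NoMin-snoc (z ∷ u) x s eq (p , q) =
  trans (cong (allGreater z) (Listₚ.++-assoc u (x ∷ []) s)) p , NoMin-snoc u x s eq q

AllGE : ℕ → List ℕ → Set
AllGE x []      = ⊤
AllGE x (z ∷ u) = x ℕ.≤ z × AllGE x u

<-allGreater : ∀ {z x} → z ℕ.< x → ∀ s → allGreater x s ≡ true → allGreater z s ≡ true
<-allGreater z<x []      _  = refl
<-allGreater {z} {x} z<x (w ∷ s) eq with x <ᵇ w in e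
... | true rewrite <⇒<ᵇ≡true (ℕₚ.<-trans z<x (ℕₚ.<ᵇ⇒< x w (subst Bool.T (sym e) tt))) = <-allGreater z<x s eq

<-allGreater-++ : ∀ {z x} → z ℕ.< x → ∀ u s → AllGE x u → allGreater x s ≡ true → allGreater z (u ++ x ∷ s) ≡ true
<-allGreater-++ z<x []      s _         eq rewrite <⇒<ᵇ≡true z<x = <-allGreater z<x s eq
<-allGreater-++ z<x (w ∷ u) s (x≤w , p) eq rewrite <⇒<ᵇ≡true (ℕₚ.<-≤-trans z<x x≤w) = <-allGreater-++ z<x u s p eq

-- A letter of u below x would lie below every later letter, since the rest of u is at least x by
-- induction and s lies above x. It would then be a right-to-left minimum.
NoMin-AllGE : ∀ u x s → allGreater x s ≡ true → NoMin u (x ∷ s) → AllGE x u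
NoMin-AllGE []      x s eq _       = tt
NoMin-AllGE (z ∷ u) x s eq (p , q) = ℕₚ.≮⇒≥ not-below , NoMin-AllGE u x s eq q
  where
  not-below : ¬ z ℕ.< x
  not-below z<x with () ← trans (sym p) (<-allGreater-++ z<x u s (NoMin-AllGE u x s eq q) eq)

allGreater⇒allGE : ∀ x s → allGreater x s ≡ true → allGE x s ≡ true
allGreater⇒allGE x []      _  = refl
allGreater⇒allGE x (w ∷ s) eq with x <ᵇ w in e
... | true rewrite ≤⇒≮ᵇ (ℕₚ.<⇒≤ (ℕₚ.<ᵇ⇒< x w (subst Bool.T (sym e) tt))) = allGreater⇒allGE x s eq

allGE-min : ∀ x u s → AllGE x u → allGreater x s ≡ true → allGE x (u ++ x ∷ s) ≡ true
allGE-min x []      s _         eq rewrite <ᵇ-irrefl x = allGreater⇒allGE x s eq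
allGE-min x (w ∷ u) s (x≤w , p) eq rewrite ≤⇒≮ᵇ x≤w = allGE-min x u s p eq

¬allGE : ∀ {x z} → x ℕ.< z → ∀ u s → allGE z (u ++ x ∷ s) ≡ false
¬allGE x<z [] s rewrite <⇒<ᵇ≡true x<z = refl
¬allGE {x} {z} x<z (w ∷ u) s with w <ᵇ z
... | true  = refl
... | false = ¬allGE x<z u s

-- All letters of u are at least x. A copy of x has no smaller letter behind it and makes the index
-- 0 qualify; a letter above x sees the smaller x behind it and changes nothing.
qd-NoMin : ∀ u x s → allGreater x s ≡ true → NoMin u (x ∷ s) →
  qd (u ++ x ∷ s) ≡ (if has x u then 1 ⊔ bump (qd s) else bump (qd s))
qd-NoMin []      x s eq _ rewrite eq = refl
qd-NoMin (z ∷ u) x s eq (p , q) rewrite p with x ℕₚ.≟ z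
... | yes refl rewrite ≡ᵇ-refl x | allGE-min x u s (NoMin-AllGE u x s eq q) eq | qd-NoMin u x s eq q = idem (has x u) (bump (qd s))
  where
  idem : ∀ b j → 1 ⊔ (if b then 1 ⊔ j else j) ≡ 1 ⊔ j
  idem true  j = trans (sym (ℕₚ.⊔-assoc 1 1 j)) refl
  idem false j = refl
... | no ne rewrite ≢⇒≢ᵇ x z ne
  | ¬allGE (ℕₚ.≤∧≢⇒< (proj₁ (NoMin-AllGE (z ∷ u) x s eq (p , q))) ne) u s = qd-NoMin u x s eq q

≡ᵇ-comm : ∀ a b → (a ≡ᵇ b) ≡ (b ≡ᵇ a)
≡ᵇ-comm zero    zero    = refl
≡ᵇ-comm zero    (suc b) = refl
≡ᵇ-comm (suc a) zero    = refl
≡ᵇ-comm (suc a) (suc b) = ≡ᵇ-comm a b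

count≡occ : ∀ c s → count c s ≡ occ c s
count≡occ c []      = refl
count≡occ c (x ∷ s) rewrite ≡ᵇ-comm c x with x ≡ᵇ c
... | true  = cong suc (count≡occ c s)
... | false = count≡occ c s

occ-allGreater : ∀ x s → allGreater x s ≡ true → occ x s ≡ 0
occ-allGreater x []      _  = refl
occ-allGreater x (w ∷ s) eq with x <ᵇ w in e
... | true rewrite ≡ᵇ-comm x w | <⇒≢ᵇ (ℕₚ.<ᵇ⇒< x w (subst Bool.T (sym e) tt)) = occ-allGreater x s eq

occ-test : ∀ u x s → allGreater x s ≡ true → (2 ℕ.≤ᵇ occ x (u ++ x ∷ s)) ≡ has x u
occ-test []      x s eq rewrite ≡ᵇ-refl x | occ-allGreater x s eq = refl
occ-test (z ∷ u) x s eq with x ≡ᵇ z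
... | false = occ-test u x s eq
... | true  = positive u
  where
  positive : ∀ u → (2 ℕ.≤ᵇ suc (occ x (u ++ x ∷ s))) ≡ true
  positive []      rewrite ≡ᵇ-refl x = refl
  positive (w ∷ u) with x ≡ᵇ w
  ... | true  = refl
  ... | false = positive u

drop-suc : ∀ q S u x (s : List ℕ) → drop q S ≡ u ++ x ∷ s → drop (suc (q ℕ.+ length u)) S ≡ s
drop-suc zero S u x s refl = go u
  where
  go : ∀ u → drop (suc (length u)) (u ++ x ∷ s) ≡ s
  go []      = refl
  go (_ ∷ u) = go u
drop-suc (suc q) []      []      x s ()
drop-suc (suc q) []      (_ ∷ _) x s ()
drop-suc (suc q) (_ ∷ S) u       x s eq = drop-suc q S u x s eq

NoMin-[] : ∀ u → NoMin u [] → u ≡ []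
NoMin-[] []           _       = refl
NoMin-[] (z ∷ [])     (() , _)
NoMin-[] (z ∷ w ∷ u)  (_ , p) with () ← NoMin-[] (w ∷ u) p

-- The letters u were read after the last right-to-left minimum, which is at
-- position q of S; the right-to-left minima of u ++ s are those of s.
rposGo-qd : ∀ S m q u s → drop q S ≡ u ++ s → NoMin u s →
  rposGo S m q (rlMinFrom (q ℕ.+ length u) s) ≡ out m (qd (u ++ s))
rposGo-qd S m q u [] eq nomin rewrite NoMin-[] u nomin = refl
rposGo-qd S m q u (x ∷ s) eq nomin with allGreater x s in e
... | false = begin
  rposGo S m q (rlMinFrom (suc (q ℕ.+ length u)) s)
    ≡⟨ cong (λ k → rposGo S m q (rlMinFrom k s)) (begin
         suc (q ℕ.+ length u)        ≡⟨ ℕₚ.+-suc q (length u) ⟨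
         q ℕ.+ suc (length u)        ≡⟨ cong (q ℕ.+_) (ℕₚ.+-comm 1 (length u)) ⟩
         q ℕ.+ (length u ℕ.+ 1)      ≡⟨ cong (q ℕ.+_) (Listₚ.length-++ u) ⟨
         q ℕ.+ length (u ++ x ∷ [])  ∎) ⟩
  rposGo S m q (rlMinFrom (q ℕ.+ length (u ++ x ∷ [])) s)
    ≡⟨ rposGo-qd S m q (u ++ x ∷ []) s (trans eq assoc) (NoMin-snoc u x s e nomin) ⟩
  out m (qd ((u ++ x ∷ []) ++ s)) ≡⟨ cong (out m ∘ qd) assoc ⟨
  out m (qd (u ++ x ∷ s)) ∎
  where
  open ≡-Reasoning
  assoc : u ++ x ∷ s ≡ (u ++ x ∷ []) ++ s
  assoc = sym (Listₚ.++-assoc u (x ∷ []) s)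
... | true rewrite eq | count≡occ x (u ++ x ∷ s) | occ-test u x s e | qd-NoMin u x s e nomin = by-test (has x u)
  where
  ih : rposGo S (suc m) (suc (q ℕ.+ length u)) (rlMinFrom (suc (q ℕ.+ length u)) s) ≡ out (suc m) (qd s)
  ih = trans (cong (λ k → rposGo S (suc m) (suc (q ℕ.+ length u)) (rlMinFrom k s)) (sym (ℕₚ.+-identityʳ _)))
    (rposGo-qd S (suc m) (suc (q ℕ.+ length u)) [] s (drop-suc q S u x s eq) tt)
  next : ℕ
  next = rposGo S (suc m) (suc (q ℕ.+ length u)) (rlMinFrom (suc (q ℕ.+ length u)) s)
  by-test : ∀ b → (if b then m ⊔ next else next) ≡ out m (if b then 1 ⊔ bump (qd s) else bump (qd s))
  by-test true  = trans (cong (m ⊔_) ih) (⊔-out m (qd s))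
  by-test false = trans ih (sym (out-bump m (qd s)))

rr≡length⇒qd≡0 : ∀ s → rr s ≡ length s → qd s ≡ 0
rr≡length⇒qd≡0 []      _  = refl
rr≡length⇒qd≡0 (x ∷ s) eq with allGreater x s
... | true  = cong bump (rr≡length⇒qd≡0 s (cong pred eq))
... | false = ⊥-elim (ℕₚ.<⇒≢ (s≤s (rr≤length s)) eq)

rpos≡qd : ∀ s → rpos s ≡ pred (qd s)
rpos≡qd s with rmin s ≡ᵇ length s in eq
... | true  = sym (cong pred (rr≡length⇒qd≡0 s (trans (sym (rmin≡rr s)) (≡ᵇ-true (rmin s) (length s) eq))))
... | false = trans (rposGo-qd s 0 0 [] s refl tt) (out-0 (qd s))
  where
  out-0 : ∀ j → out 0 j ≡ pred j
  out-0 zero    = refl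
  out-0 (suc j) = refl

last : ℕ → List ℕ → ℕ
last z []      = z
last z (x ∷ p) = last x p

asc-snoc : ∀ z p x → asc (z ∷ p ++ x ∷ []) ≡ up (last z p) x ℕ.+ asc (z ∷ p)
asc-snoc z []      x = refl
asc-snoc z (b ∷ p) x = trans (cong (up z b ℕ.+_) (asc-snoc b p x)) (swap (up z b) (up (last b p) x) (asc (b ∷ p)))
  where
  swap : ∀ a b c → a ℕ.+ (b ℕ.+ c) ≡ b ℕ.+ (a ℕ.+ c)
  swap a b c = trans (sym (ℕₚ.+-assoc a b c)) (trans (cong (ℕ._+ c) (ℕₚ.+-comm a b)) (ℕₚ.+-assoc b a c))

last-snoc : ∀ z p x → last z (p ++ x ∷ []) ≡ x
last-snoc z []      x = refl
last-snoc z (b ∷ p) x = last-snoc b p x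

AscCond⇒Valid : ∀ z p w → AscCondFrom (z ∷ p) w → Valid (asc (z ∷ p)) (last z p) w
AscCond⇒Valid z p []      _           = tt
AscCond⇒Valid z p (x ∷ w) (x≤ , cond) =
  s≤s (subst (x ℕ.≤_) (ℕₚ.+-comm (asc (z ∷ p)) 1) x≤) ,
  subst (λ a → Valid a x w) (asc-snoc z p x)
    (subst (λ l → Valid (asc (z ∷ p ++ x ∷ [])) l w) (last-snoc z p x) (AscCond⇒Valid z (p ++ x ∷ []) w cond))

Valid⇒AscCond : ∀ z p w → Valid (asc (z ∷ p)) (last z p) w → AscCondFrom (z ∷ p) w
Valid⇒AscCond z p []      _          = tt
Valid⇒AscCond z p (x ∷ w) (x< , val) =
  subst (x ℕ.≤_) (ℕₚ.+-comm 1 (asc (z ∷ p))) (ℕₚ.≤-pred x<) ,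
  Valid⇒AscCond z (p ++ x ∷ []) w (subst (λ l → Valid (asc (z ∷ p ++ x ∷ [])) l w) (sym (last-snoc z p x))
    (subst (λ a → Valid a x w) (sym (asc-snoc z p x)) val))

Valid⇒IsInv : ∀ k a l w → suc a ℕ.≤ k → Valid a l w → IsInvFrom k w
Valid⇒IsInv k a l []      _   _          = tt
Valid⇒IsInv k a l (x ∷ w) a<k (x< , val) = ℕₚ.≤-trans x< (s≤s a<k) ,
  Valid⇒IsInv (suc k) (up l x ℕ.+ a) x w (s≤s (ℕₚ.≤-trans (ℕₚ.+-monoˡ-≤ a (up≤1 l x)) a<k)) val

Valid⇒InA : ∀ w → Valid 0 0 w → InA (suc (length w)) (0 ∷ w)
Valid⇒InA w val = refl , (s≤s z≤n , Valid⇒IsInv 1 0 0 w ℕₚ.≤-refl val) , Valid⇒AscCond 0 [] w val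

InA⇒Valid : ∀ n s → InA (suc n) s → ∃ λ w → s ≡ 0 ∷ w × length w ≡ n × Valid 0 0 w
InA⇒Valid n (zero ∷ w)  (len , _ , cond)           = w , refl , cong pred len , AscCond⇒Valid 0 [] w cond
InA⇒Valid n (suc x ∷ w) (_ , (s≤s () , _) , _)

-- Enumeration of ascent sequences

cat : {A : Set} → ℕ → (ℕ → List A) → List A
cat zero    f = []
cat (suc n) f = f 0 ++ cat n (f ∘ suc)

words : ℕ → ℕ → ℕ → List (List ℕ)
words a l zero    = [] ∷ []
words a l (suc k) = cat (suc (suc a)) λ x → map (x ∷_) (words (up l x ℕ.+ a) x k)

sumL : {A : Set} → (A → ℤ) → List A → ℤ
sumL g []       = 0ℤ
sumL g (x ∷ xs) = g x + sumL g xs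

sumL-++ : {A : Set} (g : A → ℤ) (xs ys : List A) → sumL g (xs ++ ys) ≡ sumL g xs + sumL g ys
sumL-++ g []       ys = sym (+-identityˡ _)
sumL-++ g (x ∷ xs) ys = trans (cong (λ z → g x + z) (sumL-++ g xs ys)) (lemma _ _ _)
  where
  opaque
    unfolding _+_
    lemma : ∀ x y z → x + (y + z) ≡ x + y + z
    lemma = solve-∀

sumL-map : {A B : Set} (g : B → ℤ) (h : A → B) (xs : List A) → sumL g (map h xs) ≡ sumL (g ∘ h) xs
sumL-map g h []       = refl
sumL-map g h (x ∷ xs) = cong (λ z → g (h x) + z) (sumL-map g h xs)

sumL-cat : {A : Set} (g : A → ℤ) (n : ℕ) (f : ℕ → List A) → sumL g (cat n f) ≡ ∑ n (λ i → sumL g (f i))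
sumL-cat g zero    f = refl
sumL-cat g (suc n) f = trans (sumL-++ g (f 0) (cat n (f ∘ suc))) (cong (λ z → sumL g (f 0) + z) (sumL-cat g n (f ∘ suc)))

sumL-words : ∀ a l k g → sumL g (words a l k) ≡ V a l k g
sumL-words a l zero    g = +-identityʳ _
sumL-words a l (suc k) g = trans (sumL-cat g (suc (suc a)) (λ x → map (x ∷_) (words (up l x ℕ.+ a) x k)))
  (∑-cong′ (suc (suc a)) λ x → trans (sumL-map g (x ∷_) (words (up l x ℕ.+ a) x k)) (sumL-words (up l x ℕ.+ a) x k (λ w → g (x ∷ w))))

∈-cat⁺ : {A : Set} {v : A} (n : ℕ) (f : ℕ → List A) (i : ℕ) → i ℕ.< n → v ∈ f i → v ∈ cat n f
∈-cat⁺ (suc n) f zero    _         v∈ = ∈ₚ.∈-++⁺ˡ v∈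
∈-cat⁺ (suc n) f (suc i) (s≤s i<n) v∈ = ∈ₚ.∈-++⁺ʳ (f 0) (∈-cat⁺ n (f ∘ suc) i i<n v∈)

∈-cat⁻ : {A : Set} {v : A} (n : ℕ) (f : ℕ → List A) → v ∈ cat n f → ∃ λ i → i ℕ.< n × v ∈ f i
∈-cat⁻ (suc n) f v∈ with ∈ₚ.∈-++⁻ (f 0) v∈
... | inj₁ v∈₀ = 0 , s≤s z≤n , v∈₀
... | inj₂ v∈₁ with ∈-cat⁻ n (f ∘ suc) v∈₁
...   | i , i<n , v∈i = suc i , s≤s i<n , v∈i

cat-unique : {A : Set} (n : ℕ) (f : ℕ → List A) → (∀ i → Unique (f i)) →
  (∀ i j v → v ∈ f i → v ∈ f j → i ≡ j) → Unique (cat n f)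
cat-unique zero    f u d = []
cat-unique (suc n) f u d = Uniqueₚ.++⁺ (u 0)
  (cat-unique n (f ∘ suc) (u ∘ suc) λ i j v p q → ℕₚ.suc-injective (d (suc i) (suc j) v p q))
  λ { {v} (p , q) → apart v p (∈-cat⁻ n (f ∘ suc) q) }
  where
  apart : ∀ v → v ∈ f 0 → ¬ (∃ λ i → i ℕ.< n × v ∈ f (suc i))
  apart v p (i , _ , q) with () ← d 0 (suc i) v p q

words-unique : ∀ a l k → Unique (words a l k)
words-unique a l zero    = All.[] ∷ []
words-unique a l (suc k) = cat-unique (suc (suc a)) (λ x → map (x ∷_) (words (up l x ℕ.+ a) x k))
  (λ x → Uniqueₚ.map⁺ Listₚ.∷-injectiveʳ (words-unique (up l x ℕ.+ a) x k))
  same-head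
  where
  same-head : ∀ i j v → v ∈ map (i ∷_) (words (up l i ℕ.+ a) i k) → v ∈ map (j ∷_) (words (up l j ℕ.+ a) j k) → i ≡ j
  same-head i j v p q with ∈ₚ.∈-map⁻ (i ∷_) p | ∈ₚ.∈-map⁻ (j ∷_) q
  ... | _ , _ , eq | _ , _ , eq′ = Listₚ.∷-injectiveˡ (trans (sym eq) eq′)

∈-words⁺ : ∀ a l w → Valid a l w → w ∈ words a l (length w)
∈-words⁺ a l []      _          = here refl
∈-words⁺ a l (x ∷ w) (x< , val) = ∈-cat⁺ (suc (suc a)) (λ x → map (x ∷_) (words (up l x ℕ.+ a) x (length w))) x x< (∈ₚ.∈-map⁺ (x ∷_) (∈-words⁺ (up l x ℕ.+ a) x w val))

∈-words⁻ : ∀ a l k w → w ∈ words a l k → length w ≡ k × Valid a l w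
∈-words⁻ a l zero    w (here refl) = refl , tt
∈-words⁻ a l (suc k) w w∈ with ∈-cat⁻ (suc (suc a)) (λ x → map (x ∷_) (words (up l x ℕ.+ a) x k)) w∈
... | x , x< , w∈x with ∈ₚ.∈-map⁻ (x ∷_) w∈x
...   | w′ , w′∈ , refl with ∈-words⁻ (up l x ℕ.+ a) x k w′ w′∈
...     | refl , val = refl , x< , val

sequences : ℕ → List (List ℕ)
sequences n = map (0 ∷_) (words 0 0 n)

sequences-unique : ∀ n → Unique (sequences n)
sequences-unique n = Uniqueₚ.map⁺ Listₚ.∷-injectiveʳ (words-unique 0 0 n)

InA⇒∈ : ∀ n s → InA (suc n) s → s ∈ sequences n
InA⇒∈ n s s∈A with InA⇒Valid n s s∈A
... | w , refl , refl , val = ∈ₚ.∈-map⁺ (0 ∷_) (∈-words⁺ 0 0 w val)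

∈⇒InA : ∀ n s → s ∈ sequences n → InA (suc n) s
∈⇒InA n s s∈ with ∈ₚ.∈-map⁻ (0 ∷_) s∈
... | w , w∈ , refl with ∈-words⁻ 0 0 n w w∈
...   | refl , val = Valid⇒InA w val

-- Coefficients

opaque
  unfolding _+_

  -- The modulus |c| + 1 is too large to divide a nonzero c.
  small-multiple : ∀ c x → c + (ℤ.+ suc ∣ c ∣) * x ≡ 0ℤ → c ≡ 0ℤ
  small-multiple c x eq = by-size ∣ x ∣ refl
    where
    open ≡-Reasoning
    z : ℤ
    z = (ℤ.+ suc ∣ c ∣) ℤ.* x
    c≡-z : c ≡ ℤ.- z
    c≡-z = trans (lemma c z) (trans (cong (ℤ._- z) eq) (ℤₚ.+-identityˡ (ℤ.- z)))
      where
      lemma : ∀ c z → c ≡ c ℤ.+ z ℤ.- z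
      lemma = solve-∀
    by-size : ∀ k → ∣ x ∣ ≡ k → c ≡ 0ℤ
    by-size zero    ∣x∣ = trans c≡-z (cong ℤ.-_
      (trans (cong ((ℤ.+ suc ∣ c ∣) ℤ.*_) (ℤₚ.∣i∣≡0⇒i≡0 ∣x∣)) (ℤₚ.*-zeroʳ (ℤ.+ suc ∣ c ∣))))
    by-size (suc k) ∣x∣ = ⊥-elim (ℕₚ.<⇒≢ (ℕₚ.m≤m*n (suc ∣ c ∣) (suc k)) (begin
      ∣ c ∣                 ≡⟨ cong ∣_∣ c≡-z ⟩
      ∣ ℤ.- z ∣             ≡⟨ ℤₚ.∣-i∣≡∣i∣ z ⟩
      ∣ z ∣                 ≡⟨ ℤₚ.abs-* (ℤ.+ suc ∣ c ∣) x ⟩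
      suc ∣ c ∣ ℕ.* ∣ x ∣   ≡⟨ cong (suc ∣ c ∣ ℕ.*_) ∣x∣ ⟩
      suc ∣ c ∣ ℕ.* suc k   ∎))

  cancel-suc : ∀ u x → (ℤ.+ suc u) * x ≡ 0ℤ → x ≡ 0ℤ
  cancel-suc u x eq with ℤₚ.i*j≡0⇒i≡0∨j≡0 (ℤ.+ suc u) {x} eq
  ... | inj₂ x≡0 = x≡0

-- Evaluation at u + 1 makes the constant coefficient divisible by u + 1; with u its absolute value,
-- `small-multiple` forces it to be zero. The common factor u + 1 can then be cancelled, and the
-- degree drops.
vanishing-coefficients : ∀ N (c : ℕ → ℤ) →
  (∀ u → ∑ N (λ i → c i * (ℤ.+ suc u) ^ i) ≡ 0ℤ) → ∀ i → i ℕ.< N → c i ≡ 0ℤ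
vanishing-coefficients (suc N) c van = at-index
  where
  higher : ℕ → ℤ
  higher u = ∑ N (λ i → c (suc i) * (ℤ.+ suc u) ^ i)
  opaque
    unfolding _+_
    l₁ : ∀ c t p → c * (t * p) ≡ t * (c * p)
    l₁ = solve-∀
    l₂ : ∀ c x → c + x ≡ c * 1ℤ + x
    l₂ = solve-∀
  factor : ∀ u → c 0 + (ℤ.+ suc u) * higher u ≡ 0ℤ
  factor u = trans (l₂ _ _) (trans (cong (λ z → c 0 * 1ℤ + z)
    (sym (trans (∑-cong′ N λ i → l₁ (c (suc i)) (ℤ.+ suc u) _) (∑-*ˡ (ℤ.+ suc u) N (λ i → c (suc i) * (ℤ.+ suc u) ^ i))))) (van u))
  c₀ : c 0 ≡ 0ℤ
  c₀ = small-multiple (c 0) (higher ∣ c 0 ∣) (factor ∣ c 0 ∣)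
  at-index : ∀ i → i ℕ.< suc N → c i ≡ 0ℤ
  at-index zero    _         = c₀
  at-index (suc i) (s≤s i<N) = vanishing-coefficients N (c ∘ suc)
    (λ u → cancel-suc u (higher u) (trans (sym (+-identityˡ _))
      (trans (cong (_+ (ℤ.+ suc u) * higher u) (sym c₀)) (factor u)))) i i<N

V-∑ : ∀ a l k n (g : ℕ → List ℕ → ℤ) → V a l k (λ w → ∑ n (λ i → g i w)) ≡ ∑ n (λ i → V a l k (g i))
V-∑ a l k zero    g = V-zero a l k λ _ _ → refl
V-∑ a l k (suc n) g = trans (V-+ a l k (g 0) (λ w → ∑ n (λ i → g (suc i) w))) (cong (λ z → V a l k (g 0) + z) (V-∑ a l k n (g ∘ suc)))

V-coefficients : ∀ a l k N (g : List ℕ → ℤ) (p : List ℕ → ℕ) x → (∀ w → length w ≡ k → p w ℕ.< N) →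
  V a l k (λ w → g w * x ^ p w) ≡ ∑ N (λ i → V a l k (λ w → g w * ind (p w ≡ᵇ i)) * x ^ i)
V-coefficients a l k N g p x bound = begin
  V a l k (λ w → g w * x ^ p w)
    ≡⟨ V-cong a l k (λ w len → trans (cong (g w *_) (sym (∑-select N (p w) (x ^_) (bound w len)))) (sym (∑-*ˡ (g w) N _))) ⟩
  V a l k (λ w → ∑ N (λ i → g w * (ind (i ≡ᵇ p w) * x ^ i)))
    ≡⟨ V-∑ a l k N (λ i w → g w * (ind (i ≡ᵇ p w) * x ^ i)) ⟩
  ∑ N (λ i → V a l k (λ w → g w * (ind (i ≡ᵇ p w) * x ^ i)))
    ≡⟨ ∑-cong′ N (λ i → trans (V-cong′ a l k λ w → trans (lemma _ _ _) (cong (λ b → x ^ i * (g w * ind b)) (≡ᵇ-comm i (p w))))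
         (trans (V-*ˡ a l k (x ^ i) (λ w → g w * ind (p w ≡ᵇ i))) (comm _ _))) ⟩
  ∑ N (λ i → V a l k (λ w → g w * ind (p w ≡ᵇ i)) * x ^ i) ∎
  where
  open ≡-Reasoning
  opaque
    unfolding _+_
    lemma : ∀ g b x → g * (b * x) ≡ x * (g * b)
    lemma = solve-∀
    comm : ∀ x y → x * y ≡ y * x
    comm = solve-∀

compare-coefficients : ∀ a l k B (g h : List ℕ → ℤ) (p : List ℕ → ℕ) →
  (∀ w → length w ≡ k → p w ℕ.≤ B) →
  (∀ u → V a l k (λ w → g w * (ℤ.+ suc u) ^ p w) ≡ V a l k (λ w → h w * (ℤ.+ suc u) ^ p w)) →
  ∀ i → V a l k (λ w → g w * ind (p w ≡ᵇ i)) ≡ V a l k (λ w → h w * ind (p w ≡ᵇ i))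
compare-coefficients a l k B g h p bound eq i = x-y≡0⇒x≡y
  (vanishing-coefficients N (λ i → c g i - c h i) difference i (s≤s (ℕₚ.m≤n+m i B)))
  where
  -- The range has to cover the exponents up to B and also the requested index i, which may exceed
  -- B.
  N = suc (B ℕ.+ i)
  c : (List ℕ → ℤ) → ℕ → ℤ
  c g i = V a l k (λ w → g w * ind (p w ≡ᵇ i))
  bound′ : ∀ w → length w ≡ k → p w ℕ.< N
  bound′ w len = s≤s (ℕₚ.≤-trans (bound w len) (ℕₚ.m≤m+n B i))
  opaque
    unfolding _+_
    lemma : ∀ x y z → (x - y) * z ≡ x * z - y * z
    lemma = solve-∀
  difference : ∀ u → ∑ N (λ i → (c g i - c h i) * (ℤ.+ suc u) ^ i) ≡ 0ℤ
  difference u = begin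
    ∑ N (λ i → (c g i - c h i) * x ^ i)
      ≡⟨ ∑-cong′ N (λ i → lemma (c g i) (c h i) (x ^ i)) ⟩
    ∑ N (λ i → c g i * x ^ i - c h i * x ^ i)
      ≡⟨ ∑-- N (λ i → c g i * x ^ i) (λ i → c h i * x ^ i) ⟩
    ∑ N (λ i → c g i * x ^ i) - ∑ N (λ i → c h i * x ^ i)
      ≡⟨ cong₂ _-_ (V-coefficients a l k N g p x bound′) (V-coefficients a l k N h p x bound′) ⟨
    V a l k (λ w → g w * x ^ p w) - V a l k (λ w → h w * x ^ p w)
      ≡⟨ x≡y⇒x-y≡0 (eq u) ⟩
    0ℤ ∎
    where
    open ≡-Reasoning
    x = ℤ.+ suc u

-- Permutations from multiplicities

_≡ᵛ_ : ∀ {n} → Vec ℕ n → Vec ℕ n → Bool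
[]       ≡ᵛ []       = true
(x ∷ xs) ≡ᵛ (y ∷ ys) = (x ≡ᵇ y) ∧ (xs ≡ᵛ ys)

≡ᵛ-refl : ∀ {n} (xs : Vec ℕ n) → (xs ≡ᵛ xs) ≡ true
≡ᵛ-refl []       = refl
≡ᵛ-refl (x ∷ xs) rewrite ≡ᵇ-refl x = ≡ᵛ-refl xs

≡ᵛ-true : ∀ {n} (xs ys : Vec ℕ n) → (xs ≡ᵛ ys) ≡ true → xs ≡ ys
≡ᵛ-true []       []       _  = refl
≡ᵛ-true (x ∷ xs) (y ∷ ys) eq with x ≡ᵇ y in e
... | true = cong₂ _∷_ (≡ᵇ-true x y e) (≡ᵛ-true xs ys eq)

module _ {n : ℕ} where

  mult : Vec ℕ n → List (Vec ℕ n) → ℕ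
  mult κ []       = 0
  mult κ (x ∷ xs) = (if x ≡ᵛ κ then 1 else 0) ℕ.+ mult κ xs

  mult-++ : ∀ κ xs ys → mult κ (xs ++ ys) ≡ mult κ xs ℕ.+ mult κ ys
  mult-++ κ []       ys = refl
  mult-++ κ (x ∷ xs) ys = trans (cong ((if x ≡ᵛ κ then 1 else 0) ℕ.+_) (mult-++ κ xs ys))
    (sym (ℕₚ.+-assoc (if x ≡ᵛ κ then 1 else 0) _ _))

  mult-insert : ∀ κ xs x ys → mult κ (xs ++ x ∷ ys) ≡ (if x ≡ᵛ κ then 1 else 0) ℕ.+ mult κ (xs ++ ys)
  mult-insert κ xs x ys = begin
    mult κ (xs ++ x ∷ ys) ≡⟨ mult-++ κ xs (x ∷ ys) ⟩
    mult κ xs ℕ.+ (b ℕ.+ mult κ ys) ≡⟨ ℕₚ.+-assoc (mult κ xs) b _ ⟨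
    mult κ xs ℕ.+ b ℕ.+ mult κ ys ≡⟨ cong (ℕ._+ mult κ ys) (ℕₚ.+-comm (mult κ xs) b) ⟩
    b ℕ.+ mult κ xs ℕ.+ mult κ ys ≡⟨ ℕₚ.+-assoc b (mult κ xs) _ ⟩
    b ℕ.+ (mult κ xs ℕ.+ mult κ ys) ≡⟨ cong (b ℕ.+_) (mult-++ κ xs ys) ⟨
    b ℕ.+ mult κ (xs ++ ys) ∎
    where
    open ≡-Reasoning
    b = if x ≡ᵛ κ then 1 else 0

  mult⇒∈ : ∀ κ xs {j} → mult κ xs ≡ suc j → κ ∈ xs
  mult⇒∈ κ (x ∷ xs) eq with x ≡ᵛ κ in e
  ... | true  = here (sym (≡ᵛ-true x κ e))
  ... | false = there (mult⇒∈ κ xs eq)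

  mult-head : ∀ κ xs → mult κ (κ ∷ xs) ≡ suc (mult κ xs)
  mult-head κ xs rewrite ≡ᵛ-refl κ = refl

  mult⇒↭ : ∀ xs ys → (∀ κ → mult κ xs ≡ mult κ ys) → xs ↭ ys
  mult⇒↭ []       []       eq = ↭-refl
  mult⇒↭ []       (y ∷ ys) eq with () ← trans (eq y) (mult-head y ys)
  mult⇒↭ (x ∷ xs) ys       eq with ∈ₚ.∈-∃++ (mult⇒∈ x ys (trans (sym (eq x)) (mult-head x xs)))
  ... | us , vs , refl = ↭-trans (prep x (mult⇒↭ xs (us ++ vs) λ κ →
    ℕₚ.+-cancelˡ-≡ (if x ≡ᵛ κ then 1 else 0) _ _ (trans (eq κ) (mult-insert κ us x vs)))) (↭-sym (↭ₚ.shift x us vs))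

  opaque
    unfolding _+_

    sumL-mult : {A : Set} (k : A → Vec ℕ n) (κ : Vec ℕ n) (xs : List A) →
      sumL (λ s → ind (k s ≡ᵛ κ)) xs ≡ ℤ.+ mult κ (map k xs)
    sumL-mult k κ []       = refl
    sumL-mult k κ (x ∷ xs) with k x ≡ᵛ κ
    ... | true  = cong (λ z → 1ℤ ℤ.+ z) (sumL-mult k κ xs)
    ... | false = trans (ℤₚ.+-identityˡ _) (sumL-mult k κ xs)

-- Matching equally long lists entry by entry

_≟ᴸ_ : (s s′ : List ℕ) → _
_≟ᴸ_ = Listₚ.≡-dec ℕₚ._≟_

match : List (List ℕ) → List (List ℕ) → List ℕ → List ℕ
match []       _        s = s
match (_ ∷ _)  []       s = s
match (x ∷ xs) (y ∷ ys) s with s ≟ᴸ x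
... | yes _ = y
... | no  _ = match xs ys s

match-∈ : ∀ xs ys s → length xs ≡ length ys → s ∈ xs → match xs ys s ∈ ys
match-∈ (x ∷ xs) (y ∷ ys) s len s∈ with s ≟ᴸ x
... | yes _ = here refl
match-∈ (x ∷ xs) (y ∷ ys) s len (here eq)  | no ne = ⊥-elim (ne eq)
match-∈ (x ∷ xs) (y ∷ ys) s len (there s∈) | no ne = there (match-∈ xs ys s (cong pred len) s∈)

match-key : {K : Set} (f g : List ℕ → K) → ∀ xs ys s → map f xs ≡ map g ys → s ∈ xs → f s ≡ g (match xs ys s)
match-key f g (x ∷ xs) (y ∷ ys) s eq s∈ with s ≟ᴸ x
... | yes refl = Listₚ.∷-injectiveˡ eq
match-key f g (x ∷ xs) (y ∷ ys) s eq (here e)   | no ne = ⊥-elim (ne e)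
match-key f g (x ∷ xs) (y ∷ ys) s eq (there s∈) | no ne = match-key f g xs ys s (Listₚ.∷-injectiveʳ eq) s∈

match-inverse : ∀ xs ys s → length xs ≡ length ys → Unique ys → s ∈ xs → match ys xs (match xs ys s) ≡ s
match-inverse (x ∷ xs) (y ∷ ys) s len (y∉ ∷ u) s∈ with s ≟ᴸ x
... | yes refl with y ≟ᴸ y
...   | yes _ = refl
...   | no ne = ⊥-elim (ne refl)
match-inverse (x ∷ xs) (y ∷ ys) s len (y∉ ∷ u) (here e)   | no ne = ⊥-elim (ne e)
match-inverse (x ∷ xs) (y ∷ ys) s len (y∉ ∷ u) (there s∈) | no ne with match xs ys s ≟ᴸ y
... | yes eq = ⊥-elim (All.lookup y∉ (match-∈ xs ys s (cong pred len) s∈) (sym eq))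
... | no  _  = match-inverse xs ys s (cong pred len) u s∈

-- Joint coefficients of the statistics

ρ≤length : ∀ m s → ρ m s ℕ.≤ length s
ρ≤length m []      = z≤n
ρ≤length m (x ∷ s) with (x <ᵇ m) ∨ has x s
... | true  = s≤s (ρ≤length m s)
... | false = ℕₚ.m≤n⇒m≤1+n (ρ≤length m s)

asc≤length : ∀ s → asc s ℕ.≤ length s
asc≤length []          = z≤n
asc≤length (x ∷ [])    = z≤n
asc≤length (x ∷ z ∷ s) = ℕₚ.+-mono-≤ (up≤1 x z) (asc≤length (z ∷ s))

zs≤length : ∀ s → zs s ℕ.≤ length s
zs≤length []          = z≤n
zs≤length (zero ∷ s)  = s≤s (zs≤length s)
zs≤length (suc _ ∷ s) = ℕₚ.m≤n⇒m≤1+n (zs≤length s)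

bound : (p : List ℕ → ℕ) → (∀ s → p s ℕ.≤ length s) → ∀ n w → length w ≡ n → p (0 ∷ w) ℕ.≤ suc n
bound p p≤ n w refl = p≤ (0 ∷ w)

indicator : ℕ → ℕ → ℕ → ℕ → List ℕ → ℤ
indicator m e r q s = ind (maxStat s ≡ᵇ m) * (ind (ealm s ≡ᵇ e) * (ind (rr s ≡ᵇ r) * ind (pred (qd s) ≡ᵇ q)))

module _ (n m e r q : ℕ) where

  -- The exponents are separated one variable at a time. Here t varies while y and v are fixed
  -- positive integers; the next two lemmas release y and then v.
  coefficients-ρ : ∀ i u u′ →
    V 0 0 n (λ w → indicator m e r q (0 ∷ w) * (ℤ.+ suc u) ^ asc (0 ∷ w) * (ℤ.+ suc u′) ^ zs (0 ∷ w) * ind (ρ 0 (0 ∷ w) ≡ᵇ i)) ≡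
    V 0 0 n (λ w → indicator r q m e (0 ∷ w) * (ℤ.+ suc u) ^ asc (0 ∷ w) * (ℤ.+ suc u′) ^ zs (0 ∷ w) * ind (ρ 0 (0 ∷ w) ≡ᵇ i))
  coefficients-ρ i u u′ = compare-coefficients 0 0 n (suc n) _ _ (λ w → ρ 0 (0 ∷ w)) (bound (ρ 0) (ρ≤length 0) n)
    (λ u″ → trans (V-cong′ 0 0 n λ w → lemma (ind (maxStat (0 ∷ w) ≡ᵇ m)) (ind (ealm (0 ∷ w) ≡ᵇ e)) _ _ _ _)
      (trans (Sequences.full-sym (ℤ.+ suc u″) (ℤ.+ suc u) (ℤ.+ suc u′) n m e r q)
        (V-cong′ 0 0 n λ w → sym (lemma (ind (maxStat (0 ∷ w) ≡ᵇ r)) (ind (ealm (0 ∷ w) ≡ᵇ q)) _ _ _ _)))) i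
    where
    opaque
      unfolding _+_
      lemma : ∀ a b c y v t → a * (b * c) * y * v * t ≡ a * (b * (c * (t * y * v)))
      lemma = solve-∀

  coefficients-asc : ∀ i j u →
    V 0 0 n (λ w → indicator m e r q (0 ∷ w) * ind (ρ 0 (0 ∷ w) ≡ᵇ i) * (ℤ.+ suc u) ^ zs (0 ∷ w) * ind (asc (0 ∷ w) ≡ᵇ j)) ≡
    V 0 0 n (λ w → indicator r q m e (0 ∷ w) * ind (ρ 0 (0 ∷ w) ≡ᵇ i) * (ℤ.+ suc u) ^ zs (0 ∷ w) * ind (asc (0 ∷ w) ≡ᵇ j))
  coefficients-asc i j u = compare-coefficients 0 0 n (suc n) _ _ (λ w → asc (0 ∷ w)) (bound asc asc≤length n)
    (λ u′ → trans (V-cong′ 0 0 n λ w → lemma (indicator m e r q (0 ∷ w)) _ _ _) (trans (coefficients-ρ i u′ u)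
      (V-cong′ 0 0 n λ w → sym (lemma (indicator r q m e (0 ∷ w)) _ _ _)))) j
    where
    opaque
      unfolding _+_
      lemma : ∀ a b v y → a * b * v * y ≡ a * y * v * b
      lemma = solve-∀

  coefficients : ∀ i j l →
    V 0 0 n (λ w → indicator m e r q (0 ∷ w) * ind (ρ 0 (0 ∷ w) ≡ᵇ i) * ind (asc (0 ∷ w) ≡ᵇ j) * ind (zs (0 ∷ w) ≡ᵇ l)) ≡
    V 0 0 n (λ w → indicator r q m e (0 ∷ w) * ind (ρ 0 (0 ∷ w) ≡ᵇ i) * ind (asc (0 ∷ w) ≡ᵇ j) * ind (zs (0 ∷ w) ≡ᵇ l))
  coefficients i j l = compare-coefficients 0 0 n (suc n) _ _ (λ w → zs (0 ∷ w)) (bound zs zs≤length n)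
    (λ u → trans (V-cong′ 0 0 n λ w → lemma (indicator m e r q (0 ∷ w)) _ _ _) (trans (coefficients-asc i j u)
      (V-cong′ 0 0 n λ w → sym (lemma (indicator r q m e (0 ∷ w)) _ _ _)))) l
    where
    opaque
      unfolding _+_
      lemma : ∀ a b y v → a * b * y * v ≡ a * b * v * y
      lemma = solve-∀

-- Keys of the seven statistics and the bijection

key key′ : List ℕ → Vec ℕ 7
key  s = asc s ∷ rep s ∷ zeroStat s ∷ maxStat s ∷ ealm s ∷ rmin s ∷ rpos s ∷ []
key′ s = asc s ∷ rep s ∷ zeroStat s ∷ rmin s ∷ rpos s ∷ maxStat s ∷ ealm s ∷ []

ind-∧ : ∀ a {b z} → ind b ≡ z → ind (a ∧ b) ≡ ind a * z
ind-∧ true  eq = trans eq (sym (*-identityˡ _))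
ind-∧ false eq = sym (*-zeroˡ _)

ind-≡ᵛ : ∀ a b c d x y z a′ b′ c′ d′ x′ y′ z′ →
  ind ((a ∷ b ∷ c ∷ d ∷ x ∷ y ∷ z ∷ []) ≡ᵛ (a′ ∷ b′ ∷ c′ ∷ d′ ∷ x′ ∷ y′ ∷ z′ ∷ [])) ≡
  ind (d ≡ᵇ d′) * (ind (x ≡ᵇ x′) * (ind (y ≡ᵇ y′) * ind (z ≡ᵇ z′))) * ind (b ≡ᵇ b′) * ind (a ≡ᵇ a′) * ind (c ≡ᵇ c′)
ind-≡ᵛ a b c d x y z a′ b′ c′ d′ x′ y′ z′ = trans
  (ind-∧ (a ≡ᵇ a′) (ind-∧ (b ≡ᵇ b′) (ind-∧ (c ≡ᵇ c′) (ind-∧ (d ≡ᵇ d′)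
    (ind-∧ (x ≡ᵇ x′) (ind-∧ (y ≡ᵇ y′) (ind-∧ (z ≡ᵇ z′) {true} refl)))))))
  (lemma _ _ _ _ _ _ _)
  where
  opaque
    unfolding _+_
    lemma : ∀ a b c d x y z → a * (b * (c * (d * (x * (y * (z * 1ℤ)))))) ≡ d * (x * (y * z)) * b * a * c
    lemma = solve-∀

ind-key : ∀ j i l m e r q s → ind (key s ≡ᵛ (j ∷ i ∷ l ∷ m ∷ e ∷ r ∷ q ∷ [])) ≡
  indicator m e r q s * ind (ρ 0 s ≡ᵇ i) * ind (asc s ≡ᵇ j) * ind (zs s ≡ᵇ l)
ind-key j i l m e r q s rewrite rep≡ρ s | zeroStat≡zs s | rpos≡qd s | rmin≡rr s =
  ind-≡ᵛ (asc s) (ρ 0 s) (zs s) (maxStat s) (ealm s) (rr s) (pred (qd s)) j i l m e r q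

ind-key′ : ∀ j i l m e r q s → ind (key′ s ≡ᵛ (j ∷ i ∷ l ∷ m ∷ e ∷ r ∷ q ∷ [])) ≡
  indicator r q m e s * ind (ρ 0 s ≡ᵇ i) * ind (asc s ≡ᵇ j) * ind (zs s ≡ᵇ l)
ind-key′ j i l m e r q s rewrite rep≡ρ s | zeroStat≡zs s | rpos≡qd s | rmin≡rr s =
  trans (ind-≡ᵛ (asc s) (ρ 0 s) (zs s) (rr s) (pred (qd s)) (maxStat s) (ealm s) j i l m e r q)
    (cong (λ z → z * ind (ρ 0 s ≡ᵇ i) * ind (asc s ≡ᵇ j) * ind (zs s ≡ᵇ l)) (lemma _ _ _ _))
  where
  opaque
    unfolding _+_
    lemma : ∀ a b c d → a * (b * (c * d)) ≡ c * (d * (a * b))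
    lemma = solve-∀

mult-key : ∀ n κ → mult κ (map key (sequences n)) ≡ mult κ (map key′ (sequences n))
mult-key n κ@(j ∷ i ∷ l ∷ m ∷ e ∷ r ∷ q ∷ []) = ℤₚ.+-injective (begin
  ℤ.+ mult κ (map key (sequences n))
    ≡⟨ sumL-mult key κ (sequences n) ⟨
  sumL (λ s → ind (key s ≡ᵛ κ)) (sequences n)
    ≡⟨ trans (sumL-map _ (0 ∷_) (words 0 0 n)) (sumL-words 0 0 n _) ⟩
  V 0 0 n (λ w → ind (key (0 ∷ w) ≡ᵛ κ))
    ≡⟨ V-cong′ 0 0 n (λ w → ind-key j i l m e r q (0 ∷ w)) ⟩
  _ ≡⟨ coefficients n m e r q i j l ⟩
  _ ≡⟨ V-cong′ 0 0 n (λ w → ind-key′ j i l m e r q (0 ∷ w)) ⟨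
  V 0 0 n (λ w → ind (key′ (0 ∷ w) ≡ᵛ κ))
    ≡⟨ trans (sumL-map _ (0 ∷_) (words 0 0 n)) (sumL-words 0 0 n _) ⟨
  sumL (λ s → ind (key′ s ≡ᵛ κ)) (sequences n)
    ≡⟨ sumL-mult key′ κ (sequences n) ⟩
  ℤ.+ mult κ (map key′ (sequences n)) ∎)
  where open ≡-Reasoning

key-components : ∀ s s′ → key s ≡ key′ s′ →
  (asc s ≡ asc s′) × (rep s ≡ rep s′) × (zeroStat s ≡ zeroStat s′) ×
  (maxStat s ≡ rmin s′) × (ealm s ≡ rpos s′) × (rmin s ≡ maxStat s′) × (rpos s ≡ ealm s′)
key-components s s′ eq =
  at-head (λ { (a ∷ _) → a }) , at-head (λ { (_ ∷ a ∷ _) → a }) , at-head (λ { (_ ∷ _ ∷ a ∷ _) → a }) ,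
  at-head (λ { (_ ∷ _ ∷ _ ∷ a ∷ _) → a }) , at-head (λ { (_ ∷ _ ∷ _ ∷ _ ∷ a ∷ _) → a }) ,
  at-head (λ { (_ ∷ _ ∷ _ ∷ _ ∷ _ ∷ a ∷ _) → a }) , at-head (λ { (_ ∷ _ ∷ _ ∷ _ ∷ _ ∷ _ ∷ a ∷ _) → a })
  where
  at-head : ∀ (π : Vec ℕ 7 → ℕ) → π (key s) ≡ π (key′ s′)
  at-head π = cong π eq

theorem6 : (n : ℕ) → n ≥ 1 →
    Σ (List ℕ → List ℕ) λ Φ → Σ (List ℕ → List ℕ) λ Ψ →
    ((s : List ℕ) → InA n s → InA n (Φ s)) ×
    ((s : List ℕ) → InA n s → InA n (Ψ s)) ×
    ((s : List ℕ) → InA n s → Ψ (Φ s) ≡ s) ×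
    ((s : List ℕ) → InA n s → Φ (Ψ s) ≡ s) ×
    ((s : List ℕ) → InA n s →
    (asc s ≡ asc (Φ s)) × (rep s ≡ rep (Φ s)) × (zeroStat s ≡ zeroStat (Φ s)) ×
    (maxStat s ≡ rmin (Φ s)) × (ealm s ≡ rpos (Φ s)) ×
    (rmin s ≡ maxStat (Φ s)) × (rpos s ≡ ealm (Φ s)))
theorem6 (suc n) _
  -- Equal multiplicities make the two lists of keys permutations of each other. Pulling this back
  -- along `key′` reorders the sequences to `L′` so that `key` on `L` and `key′` on `L′` agree entry
  -- by entry.
  with L′ , keys , L↭L′ ← ↭ₚ.↭-map-inv key′ (mult⇒↭ (map key′ (sequences n)) (map key (sequences n)) λ κ → sym (mult-key n κ)) =
    match L L′ , match L′ L ,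
    (λ s s∈A → to-A (from-L′ (match-∈ L L′ s len (InA⇒∈ n s s∈A)))) ,
    (λ s s∈A → to-A (match-∈ L′ L s (sym len) (to-L′ (InA⇒∈ n s s∈A)))) ,
    (λ s s∈A → match-inverse L L′ s len unique′ (InA⇒∈ n s s∈A)) ,
    (λ s s∈A → match-inverse L′ L s (sym len) (sequences-unique n) (to-L′ (InA⇒∈ n s s∈A))) ,
    (λ s s∈A → key-components s (match L L′ s) (match-key key key′ L L′ s keys (InA⇒∈ n s s∈A)))
  where
  L = sequences n
  len : length L ≡ length L′
  len = ↭ₚ.↭-length L↭L′
  unique′ : Unique L′
  unique′ = Unique-resp-↭ (↭⇒↭ₛ L↭L′) (sequences-unique n)
  to-A : ∀ {s} → s ∈ L → InA (suc n) s
  to-A = ∈⇒InA n _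
  from-L′ : ∀ {s} → s ∈ L′ → s ∈ L
  from-L′ = ↭ₚ.∈-resp-↭ (↭-sym L↭L′)
  to-L′ : ∀ {s} → s ∈ L → s ∈ L′
  to-L′ = ↭ₚ.∈-resp-↭ L↭L′
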